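{- For a nonnegative integer $n$, let $p_8(n)$ denote the number of $8$-colour partitions of $n$, i.e. $\sum_{n\ge 0} p_8(n)q^n=\prod_{j\ge1}(1-q^j)^{ -8}$. Then for all nonnegative integers $n$ and all integers $\alpha\geq 1$: \begin{align*} p_8(2n+1) &\equiv 0 \pmod{2^3},\\ p_8\!\left(2^{2\alpha}n + \tfrac{2^{2\alpha+1}+1}{3}\right) &\equiv 0 \pmod{2^{3\alpha+3}},\\ p_8\!\left(2^{2\alpha+1}n + \tfrac{7\cdot 2^{2\alpha-1}+1}{3}\right) &\equiv 0 \pmod{2^{3\alpha+2}},\\ p_8\!\left(2^{2\alpha+1}n + \tfrac{5\cdot 2^{2\alpha}+1}{3}\right) &\equiv 0 \pmod{2^{3\alpha+8}},\\ p_8\!\left(2^{2\alpha+2}n + \tfrac{13\cdot 2^{2\alpha-1}+1}{3}\right) &\equiv 0 \pmod{2^{3\alpha+1}},\\ p_8\!\left(2^{2\alpha+2}n + \tfrac{19\cdot 2^{2\alpha-1}+1}{3}\right) &\equiv 0 \pmod{2^{3\alpha+3}},\\ p_8\!\left(2^{2\alpha+2}n + \tfrac{11\cdot 2^{2\alpha}+1}{3}\right) &\equiv 0 \pmod{2^{3\alpha+10}},\\ p_8\!\left(2^{2\alpha+3}n + \tfrac{17\cdot 2^{2\alpha}+1}{3}\right) &\equiv 0 \pmod{2^{3\alpha+9}}, \end{align*} and, if $n$ is not a generalised pentagonal number (i.e. $n\neq k(3k-1)/2$ for every integer $k$), then \[p_8\!\left(2^{2\alpha+2}n + \tfrac{2^{2\alpha-1}+1}{3}\right)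 \equiv 0 \pmod{2^{3\alpha+1}}.\]
   Context: $p_8(n)$ is defined by the generating function $\sum_{n=0}^\infty p_8(n)q^n = \prod_{j=1}^\infty (1-q^j)^{ -8}$. A generalised pentagonal number is an integer of the form $k(3k-1)/2$ with $k\in\mathbb{Z}$. -}

module Defs where

open import Data.Nat using (ℕ; zero; suc; _+_; _*_; _∸_; _≤ᵇ_)
open import Data.Bool using (if_then_else_)
open import Data.Integer as ℤ using (ℤ; +_)
open import Data.Product using (∃)
open import Relation.Binary.PropositionalEquality using (_≡_)

-- Formal power series over ℕ, represented by their coefficient functions.
Series : Set
Series = ℕ → ℕ

one : Series
one zero    = 1
one (suc _) = 0

sumTo : ℕ → (ℕ → ℕ) → ℕ
sumTo zero    g = g 0
sumTo (suc m) g = sumTo m g + g (suc m)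

-- f ↦ f · (1 - q^j)^{-1} = f · Σ_{k≥0} q^{kj}   (for j ≥ 1):
-- coefficient i is Σ_{k ≥ 0, kj ≤ i} f (i - kj)
divGeom : ℕ → Series → Series
divGeom j f i = sumTo i (λ k → if k * j ≤ᵇ i then f (i ∸ k * j) else 0)

iter : ℕ → (Series → Series) → Series → Series
iter zero    h f = f
iter (suc r) h f = h (iter r h f)

prod8 : ℕ → Series
prod8 zero    = one
prod8 (suc m) = iter 8 (divGeom (suc m)) (prod8 m)

-- p₈(n) = coefficient of q^n in ∏_{j≥1} (1 - q^j)^{-8}.
-- Factors with j > n do not affect the coefficient of q^n,
-- so it equals the coefficient of q^n in the finite product up to j = n.
p8 : ℕ → ℕ
p8 n = prod8 n n

GenPentagonal : ℕ → Set
GenPentagonal n = ∃ λ (k : ℤ) → + (2 * n) ≡ k ℤ.* (+ 3 ℤ.* k ℤ.- + 1)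

{-# OPTIONS --safe #-}
module Submission where

-- Let E = ∏(1 - q^j), y = (E(q²)/E(q))⁸ and K = E⁻⁸, the generating function of p₈.  Jacobi's identity
-- θ₃⁴ - θ₄⁴ = θ₂⁴ (from the triple product) gives y(q) - y(-q) = 16 q y(q²)², and y(q) y(-q) = y(q²), so
-- y² = y(q²) + 16 q y(q²)² y.  Hence extracting alternately the odd and the even coefficients from
-- K = K(q²) y leads from K to 8^{α+1} K y² A(X) and 8^{α+2} K y³ B(X), with A, B ∈ ℤ[X] and X = 128 q y³.
-- Modulo 128 only the constant terms of A and B matter, and the residues of K y² (modulo 8) and of K y³
-- (modulo 128) along the subprogressions follow from f^{2^k} ≡ f(q²)^{2^{k-1}} modulo 2^k.
-- In particular K y² has the coefficients of E(q⁸) modulo 2, where Euler's pentagonal theorem enters.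

open import Defs
open import Algebra.Bundles using (CommutativeRing)
open import Algebra.Structures using (IsCommutativeRing)
open import Algebra.Solver.Ring.AlmostCommutativeRing using (fromCommutativeRing; _-Raw-AlmostCommutative⟶_)
import Algebra.Properties.Semiring.Exp as SemiringExp
import Algebra.Solver.Ring as RingSolver
open import Data.Bool as Bool using (true; false; if_then_else_)
open import Data.Empty using (⊥-elim)
open import Data.Integer as ℤ using (ℤ; +_)
import Data.Integer.Properties as ℤₚ
import Data.Integer.Tactic.RingSolver as ℤ-Solver
open import Data.Maybe using (just; nothing)
open import Data.Nat using (ℕ; zero; suc; _+_; _*_; _∸_; _^_; _/_; _≤_; _<_; _≤ᵇ_; _<ᵇ_; z≤n; s≤s)
open import Data.Nat.Divisibility using (_∣_; divides)
open import Data.Nat.DivMod using (m*n/n≡m)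
import Data.Nat.Properties as ℕₚ
import Data.Nat.Tactic.RingSolver as ℕ-Solver
open import Data.Product using (∃; _×_; _,_; proj₁; proj₂)
open import Data.Sum using (inj₁; inj₂)
open import Data.Unit using (tt)
open import Function using (_∘_)
open import Level using (0ℓ)
open import Relation.Binary using (Setoid)
open import Relation.Binary.Definitions using (WeaklyDecidable; Tri; tri<; tri≈; tri>)
open import Relation.Binary.PropositionalEquality as ≡ using (_≡_; cong; cong₂)
import Relation.Binary.Reasoning.Setoid as SetoidReasoning
open import Relation.Nullary using (¬_; yes; no)

-- Exact identities come before any congruence: the factor 8 gained at each odd extraction must be a
-- literal factor (`U′y`), since a congruence for `y` modulo a fixed power of 2 could not be
-- iterated over α. The cofactors A and B change at every step and are never computed; it suffices
-- that they stay in ℤ[X]. This ring is stable because `y`, hence `X`, is quadratic over the series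
-- in q², so that an extraction is determined by what it does to 1 and `X`. Each claim then concerns
-- a coefficient of the form 8^m (c e(n) + 2^j w(n)) with an unspecified integer c, and holds
-- because the residue e(n) vanishes. Infinite products are compared through their truncations
-- modulo q^N, and the triple product is derived with the denominators of Euler's series cleared.

-- The ring of formal power series over ℤ

PS : Set
PS = ℕ → ℤ

tail : PS → PS
tail f n = f (suc n)

infix 4 _≈_

-- A record rather than a bare function type, so that `f` and `g` can be inferred from a proof.
record _≈_ (f g : PS) : Set where
  constructor pointwise
  field
    at : ∀ n → f n ≡ g n

open _≈_

infixl 6 _⊕_ _⊖_
infixl 7 _⊗_
infix 8 ⊝_

opaque
  _⊕_ : PS → PS → PS
  (f ⊕ g) n = f n ℤ.+ g n

  ⊝_ : PS → PS
  (⊝ f) n = ℤ.- f n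

  -- The Cauchy product through f = f(0) + q · `tail f`: recursion on the index replaces finite
  -- sums.
  _⊗_ : PS → PS → PS
  (f ⊗ g) zero    = f 0 ℤ.* g 0
  (f ⊗ g) (suc n) = f 0 ℤ.* g (suc n) ℤ.+ (tail f ⊗ g) n

  ι : ℤ → PS
  ι c zero    = c
  ι c (suc _) = + 0

  q : PS
  q zero          = + 0
  q (suc zero)    = + 1
  q (suc (suc _)) = + 0

  ⊕-at : ∀ f g n → (f ⊕ g) n ≡ f n ℤ.+ g n
  ⊕-at f g n = ≡.refl

  ⊝-at : ∀ f n → (⊝ f) n ≡ ℤ.- f n
  ⊝-at f n = ≡.refl

  ⊗-zero : ∀ f g → (f ⊗ g) 0 ≡ f 0 ℤ.* g 0
  ⊗-zero f g = ≡.refl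

  ⊗-suc : ∀ f g n → (f ⊗ g) (suc n) ≡ f 0 ℤ.* g (suc n) ℤ.+ (tail f ⊗ g) n
  ⊗-suc f g n = ≡.refl

  ι-zero : ∀ c → ι c 0 ≡ c
  ι-zero c = ≡.refl

  ι-suc : ∀ c n → ι c (suc n) ≡ + 0
  ι-suc c n = ≡.refl

  private
    ⊗-cong-at : ∀ n {f f′ g g′ : PS} → (∀ m → f m ≡ f′ m) → (∀ m → g m ≡ g′ m) → (f ⊗ g) n ≡ (f′ ⊗ g′) n
    ⊗-cong-at zero    p r = cong₂ ℤ._*_ (p 0) (r 0)
    ⊗-cong-at (suc n) p r = cong₂ ℤ._+_ (cong₂ ℤ._*_ (p 0) (r (suc n))) (⊗-cong-at n (p ∘ suc) r)

    -- The product peels its left factor; commutativity also needs this peeling of the right one.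
    ⊗-comm-suc : ∀ f g n → (f ⊗ g) (suc n) ≡ (f ⊗ tail g) n ℤ.+ f (suc n) ℤ.* g 0
    ⊗-comm-suc f g zero    = ≡.refl
    ⊗-comm-suc f g (suc n) = ≡.trans (cong (λ t → f 0 ℤ.* g (suc (suc n)) ℤ.+ t) (⊗-comm-suc (tail f) g n))
      (≡.sym (ℤₚ.+-assoc (f 0 ℤ.* g (suc (suc n))) _ _))

    ⊗-comm-at : ∀ n f g → (f ⊗ g) n ≡ (g ⊗ f) n
    ⊗-comm-at zero    f g = ℤₚ.*-comm (f 0) (g 0)
    ⊗-comm-at (suc n) f g = ≡.trans (⊗-comm-suc f g n)
      (≡.trans (ℤₚ.+-comm ((f ⊗ tail g) n) _)
        (cong₂ ℤ._+_ (ℤₚ.*-comm (f (suc n)) (g 0)) (⊗-comm-at n f (tail g))))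

    ⊗-distribʳ-at : ∀ n h f g → ((f ⊕ g) ⊗ h) n ≡ ((f ⊗ h) ⊕ (g ⊗ h)) n
    ⊗-distribʳ-at zero    h f g = ℤₚ.*-distribʳ-+ (h 0) (f 0) (g 0)
    ⊗-distribʳ-at (suc n) h f g = ≡.trans
      (cong (λ t → (f 0 ℤ.+ g 0) ℤ.* h (suc n) ℤ.+ t) (⊗-distribʳ-at n h (tail f) (tail g)))
      (rearrange (f 0) (g 0) (h (suc n)) ((tail f ⊗ h) n) ((tail g ⊗ h) n))
      where
      rearrange : ∀ a b c u v → (a ℤ.+ b) ℤ.* c ℤ.+ (u ℤ.+ v) ≡ (a ℤ.* c ℤ.+ u) ℤ.+ (b ℤ.* c ℤ.+ v)
      rearrange = ℤ-Solver.solve-∀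

    scale-⊗ : ∀ n c f g → ((λ m → c ℤ.* f m) ⊗ g) n ≡ c ℤ.* (f ⊗ g) n
    scale-⊗ zero    c f g = ℤₚ.*-assoc c (f 0) (g 0)
    scale-⊗ (suc n) c f g = ≡.trans (cong₂ ℤ._+_ (ℤₚ.*-assoc c (f 0) (g (suc n))) (scale-⊗ n c (tail f) g))
      (≡.sym (ℤₚ.*-distribˡ-+ c _ _))

    ⊗-assoc-at : ∀ n f g h → ((f ⊗ g) ⊗ h) n ≡ (f ⊗ (g ⊗ h)) n
    ⊗-assoc-at zero    f g h = ℤₚ.*-assoc (f 0) (g 0) (h 0)
    ⊗-assoc-at (suc n) f g h = ≡.trans
      (cong₂ ℤ._+_ (ℤₚ.*-assoc (f 0) (g 0) (h (suc n)))
        (≡.trans (⊗-distribʳ-at n h (λ m → f 0 ℤ.* g (suc m)) (tail f ⊗ g))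
          (cong₂ ℤ._+_ (scale-⊗ n (f 0) (tail g) h) (⊗-assoc-at n (tail f) g h))))
      (rearrange (f 0) (g 0 ℤ.* h (suc n)) ((tail g ⊗ h) n) ((tail f ⊗ (g ⊗ h)) n))
      where
      rearrange : ∀ a b c d → a ℤ.* b ℤ.+ (a ℤ.* c ℤ.+ d) ≡ a ℤ.* (b ℤ.+ c) ℤ.+ d
      rearrange = ℤ-Solver.solve-∀

    0-⊗ : ∀ n f g → (∀ m → f m ≡ + 0) → (f ⊗ g) n ≡ + 0
    0-⊗ zero    f g p rewrite p 0 = ≡.refl
    0-⊗ (suc n) f g p rewrite p 0 | 0-⊗ n (tail f) g (p ∘ suc) = ≡.refl

    ι-⊗-at : ∀ n c f → (ι c ⊗ f) n ≡ c ℤ.* f n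
    ι-⊗-at zero    c f = ≡.refl
    ι-⊗-at (suc n) c f = ≡.trans (cong (λ t → c ℤ.* f (suc n) ℤ.+ t) (0-⊗ n (tail (ι c)) f (λ _ → ≡.refl)))
      (ℤₚ.+-identityʳ _)

  ι-⊗ : ∀ c f n → (ι c ⊗ f) n ≡ c ℤ.* f n
  ι-⊗ c f n = ι-⊗-at n c f

  q⊗-zero : ∀ f → (q ⊗ f) 0 ≡ + 0
  q⊗-zero f = ≡.refl

  q⊗-suc : ∀ f n → (q ⊗ f) (suc n) ≡ f n
  q⊗-suc f n = ≡.trans (ℤₚ.+-identityˡ _)
    (≡.trans (⊗-cong-at n {f = tail q} {f′ = ι (+ 1)} (λ { zero → ≡.refl ; (suc _) → ≡.refl }) (λ _ → ≡.refl))
      (≡.trans (ι-⊗-at n (+ 1) f) (ℤₚ.*-identityˡ (f n))))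

  ι-+ : ∀ a b → ι (a ℤ.+ b) ≈ ι a ⊕ ι b
  ι-+ a b .at zero    = ≡.refl
  ι-+ a b .at (suc _) = ≡.refl

  ι-* : ∀ a b → ι (a ℤ.* b) ≈ ι a ⊗ ι b
  ι-* a b .at zero    = ≡.refl
  ι-* a b .at (suc n) = ≡.sym (≡.trans (ι-⊗-at (suc n) a (ι b)) (ℤₚ.*-zeroʳ a))

  ι-neg : ∀ a → ι (ℤ.- a) ≈ ⊝ ι a
  ι-neg a .at zero    = ≡.refl
  ι-neg a .at (suc _) = ≡.refl

  PS-isCommutativeRing : IsCommutativeRing _≈_ _⊕_ _⊗_ ⊝_ (ι (+ 0)) (ι (+ 1))
  PS-isCommutativeRing = record
    { isRing = record
      { +-isAbelianGroup = record
        { isGroup = record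
          { isMonoid = record
            { isSemigroup = record
              { isMagma = record
                { isEquivalence = record
                  { refl  = pointwise λ _ → ≡.refl
                  ; sym   = λ p → pointwise λ n → ≡.sym (p .at n)
                  ; trans = λ p r → pointwise λ n → ≡.trans (p .at n) (r .at n) }
                ; ∙-cong = λ p r → pointwise λ n → cong₂ ℤ._+_ (p .at n) (r .at n) }
              ; assoc = λ f g h → pointwise λ n → ℤₚ.+-assoc (f n) (g n) (h n) }
            ; identity = (λ f → pointwise λ { zero → ℤₚ.+-identityˡ (f 0) ; (suc n) → ℤₚ.+-identityˡ (f (suc n)) })
                       , (λ f → pointwise λ { zero → ℤₚ.+-identityʳ (f 0) ; (suc n) → ℤₚ.+-identityʳ (f (suc n)) }) }
          ; inverse = (λ f → pointwise λ { zero → ℤₚ.+-inverseˡ (f 0) ; (suc n) → ℤₚ.+-inverseˡ (f (suc n)) })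
                    , (λ f → pointwise λ { zero → ℤₚ.+-inverseʳ (f 0) ; (suc n) → ℤₚ.+-inverseʳ (f (suc n)) })
          ; ⁻¹-cong = λ p → pointwise λ n → cong ℤ.-_ (p .at n) }
        ; comm = λ f g → pointwise λ n → ℤₚ.+-comm (f n) (g n) }
      ; *-cong = λ p r → pointwise λ n → ⊗-cong-at n (p .at) (r .at)
      ; *-assoc = λ f g h → pointwise λ n → ⊗-assoc-at n f g h
      ; *-identity = (λ f → pointwise λ n → ≡.trans (ι-⊗-at n (+ 1) f) (ℤₚ.*-identityˡ (f n)))
                   , (λ f → pointwise λ n → ≡.trans (⊗-comm-at n f (ι (+ 1))) (≡.trans (ι-⊗-at n (+ 1) f) (ℤₚ.*-identityˡ (f n))))
      ; distrib = (λ f g h → pointwise λ n → ≡.trans (⊗-comm-at n f (g ⊕ h))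
                     (≡.trans (⊗-distribʳ-at n f g h) (cong₂ ℤ._+_ (⊗-comm-at n g f) (⊗-comm-at n h f))))
                , (λ h f g → pointwise λ n → ⊗-distribʳ-at n h f g) }
    ; *-comm = λ f g → pointwise λ n → ⊗-comm-at n f g }

PS-ring : CommutativeRing 0ℓ 0ℓ
PS-ring = record { isCommutativeRing = PS-isCommutativeRing }

_⊖_ : PS → PS → PS
f ⊖ g = f ⊕ ⊝ g

open CommutativeRing PS-ring
  using (refl; sym; trans; setoid; semiring; +-cong; *-cong; -‿cong)
  renaming ( +-identityˡ to ⊕-identityˡ; +-identityʳ to ⊕-identityʳ; *-identityˡ to ⊗-identityˡ; *-identityʳ to ⊗-identityʳ
           ; *-assoc to ⊗-assoc; *-comm to ⊗-comm; zeroˡ to ⊗-zeroˡ; zeroʳ to ⊗-zeroʳ)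

open SemiringExp semiring public using () renaming (_^_ to _↑_; ^-congˡ to ↑-cong; ^-homo-* to ↑-+)

private
  ℤ⟶PS : ℤ.+-*-rawRing -Raw-AlmostCommutative⟶ fromCommutativeRing PS-ring
  ℤ⟶PS = record { ⟦_⟧ = ι ; +-homo = ι-+ ; *-homo = ι-* ; -‿homo = ι-neg ; 0-homo = refl ; 1-homo = refl }

  -- Matching on refl instead of using subst would make the solver recurse over its constants in unary.
  ι-≟ : WeaklyDecidable (λ a b → ι a ≈ ι b)
  ι-≟ a b with a ℤ.≟ b
  ... | yes a≡b = just (≡.subst (λ b → ι a ≈ ι b) a≡b refl)
  ... | no  _   = nothing

open RingSolver ℤ.+-*-rawRing (fromCommutativeRing PS-ring) ℤ⟶PS ι-≟
  using (solve; _:=_; _:+_; _:*_; _:-_; :-_; _:^_; con)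

open SetoidReasoning setoid using (begin_; step-≈-⟩; step-≈-⟨; _∎)

⊕-congˡ : ∀ {f g g′} → g ≈ g′ → f ⊕ g ≈ f ⊕ g′
⊕-congˡ = +-cong refl

⊕-congʳ : ∀ {f f′ g} → f ≈ f′ → f ⊕ g ≈ f′ ⊕ g
⊕-congʳ p = +-cong p refl

⊗-congˡ : ∀ {f g g′} → g ≈ g′ → f ⊗ g ≈ f ⊗ g′
⊗-congˡ = *-cong refl

⊗-congʳ : ∀ {f f′ g} → f ≈ f′ → f ⊗ g ≈ f′ ⊗ g
⊗-congʳ p = *-cong p refl

𝟘 𝟙 : PS
𝟘 = ι (+ 0)
𝟙 = ι (+ 1)

𝟙-↑ : ∀ {f} n → f ≈ 𝟙 → f ↑ n ≈ 𝟙
𝟙-↑ zero    p = refl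
𝟙-↑ (suc n) p = trans (*-cong p (𝟙-↑ n p)) (⊗-identityˡ 𝟙)

↑-⊗ : ∀ a b n → (a ⊗ b) ↑ n ≈ a ↑ n ⊗ b ↑ n
↑-⊗ a b zero    = sym (⊗-identityˡ 𝟙)
↑-⊗ a b (suc n) = trans (⊗-congˡ (↑-⊗ a b n))
  (solve 4 (λ a b A B → a :* b :* (A :* B) := a :* A :* (b :* B)) refl a b (a ↑ n) (b ↑ n))

-- Congruences between series

-- The moduli are of two kinds: integers ι d, and q ↑ N, which makes ≋ agreement of the first N coefficients.

infix 4 _≋_mod_

record _≋_mod_ (f g d : PS) : Set where
  constructor quotient
  field
    quot  : PS
    equal : f ≈ g ⊕ d ⊗ quot

open _≋_mod_

≈⇒≋ : ∀ {f g d} → f ≈ g → f ≋ g mod d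
≈⇒≋ {f} {g} {d} p = quotient 𝟘 (trans p (solve 2 (λ g d → g := g :+ d :* con (+ 0)) refl g d))

≋-refl : ∀ {f d} → f ≋ f mod d
≋-refl = ≈⇒≋ refl

≋-sym : ∀ {f g d} → f ≋ g mod d → g ≋ f mod d
≋-sym {f} {g} {d} (quotient h p) = quotient (⊝ h) (begin
  g                      ≈⟨ solve 3 (λ g d h → g := (g :+ d :* h) :+ d :* (:- h)) refl g d h ⟩
  g ⊕ d ⊗ h ⊕ d ⊗ (⊝ h)  ≈⟨ ⊕-congʳ p ⟨
  f ⊕ d ⊗ (⊝ h)          ∎)

≋-trans : ∀ {f g h d} → f ≋ g mod d → g ≋ h mod d → f ≋ h mod d
≋-trans {f} {g} {h} {d} (quotient u p) (quotient v r) = quotient (u ⊕ v) (begin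
  f                  ≈⟨ p ⟩
  g ⊕ d ⊗ u          ≈⟨ ⊕-congʳ r ⟩
  h ⊕ d ⊗ v ⊕ d ⊗ u  ≈⟨ solve 4 (λ h d u v → h :+ d :* v :+ d :* u := h :+ d :* (u :+ v)) refl h d u v ⟩
  h ⊕ d ⊗ (u ⊕ v)    ∎)

≋-setoid : PS → Setoid _ _
≋-setoid d = record
  { Carrier = PS ; _≈_ = λ f g → f ≋ g mod d
  ; isEquivalence = record { refl = ≋-refl ; sym = ≋-sym ; trans = ≋-trans } }

⊕-≋ : ∀ {f f′ g g′ d} → f ≋ f′ mod d → g ≋ g′ mod d → f ⊕ g ≋ f′ ⊕ g′ mod d
⊕-≋ {f} {f′} {g} {g′} {d} (quotient u p) (quotient v r) = quotient (u ⊕ v) (trans (+-cong p r)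
  (solve 5 (λ f g d u v → (f :+ d :* u) :+ (g :+ d :* v) := (f :+ g) :+ d :* (u :+ v)) refl f′ g′ d u v))

⊗-≋ : ∀ {f f′ g g′ d} → f ≋ f′ mod d → g ≋ g′ mod d → f ⊗ g ≋ f′ ⊗ g′ mod d
⊗-≋ {f} {f′} {g} {g′} {d} (quotient u p) (quotient v r) = quotient (f′ ⊗ v ⊕ u ⊗ g′ ⊕ d ⊗ u ⊗ v) (trans (*-cong p r)
  (solve 5 (λ f g d u v → (f :+ d :* u) :* (g :+ d :* v) := f :* g :+ d :* (f :* v :+ u :* g :+ d :* u :* v)) refl f′ g′ d u v))

⊝-≋ : ∀ {f g d} → f ≋ g mod d → ⊝ f ≋ ⊝ g mod d
⊝-≋ {f} {g} {d} (quotient u p) = quotient (⊝ u) (trans (-‿cong p)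
  (solve 3 (λ g d u → :- (g :+ d :* u) := :- g :+ d :* (:- u)) refl g d u))

↑-≋ : ∀ {f g d} n → f ≋ g mod d → f ↑ n ≋ g ↑ n mod d
↑-≋ zero    p = ≋-refl
↑-≋ (suc n) p = ⊗-≋ p (↑-≋ n p)

≋-multiple : ∀ d h → d ⊗ h ≋ 𝟘 mod d
≋-multiple d h = quotient h (sym (⊕-identityˡ _))

≋-weaken : ∀ {f g d} e → f ≋ g mod (d ⊗ e) → f ≋ g mod d
≋-weaken {f} {g} {d} e (quotient u p) = quotient (e ⊗ u) (trans p (⊕-congˡ (⊗-assoc d e u)))

≋-scale : ∀ {f g d} c → f ≋ g mod d → c ⊗ f ≋ c ⊗ g mod (c ⊗ d)
≋-scale {f} {g} {d} c (quotient u p) = quotient u (trans (⊗-congˡ p)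
  (solve 4 (λ g d u c → c :* (g :+ d :* u) := c :* g :+ c :* d :* u) refl g d u c))

≋-modulus : ∀ {f g d d′} → d ≈ d′ → f ≋ g mod d → f ≋ g mod d′
≋-modulus e (quotient u p) = quotient u (trans p (⊕-congˡ (⊗-congʳ e)))

≋-respʳ : ∀ {f g h d} → g ≈ h → f ≋ g mod d → f ≋ h mod d
≋-respʳ e (quotient u p) = quotient u (trans p (⊕-congʳ e))

≋-respˡ : ∀ {f g h d} → f ≈ h → f ≋ g mod d → h ≋ g mod d
≋-respˡ e (quotient u p) = quotient u (trans (sym e) p)

⊗-cancelˡ-≋ : ∀ {f g d} e e⁻¹ → e⁻¹ ⊗ e ≈ 𝟙 → e ⊗ f ≋ e ⊗ g mod d → f ≋ g mod d
⊗-cancelˡ-≋ {f} {g} e e⁻¹ inv p = ≋-respˡ (cancel f) (≋-respʳ (cancel g) (⊗-≋ (≋-refl {e⁻¹}) p))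
  where
  cancel : ∀ h → e⁻¹ ⊗ (e ⊗ h) ≈ h
  cancel h = trans (sym (⊗-assoc e⁻¹ e h)) (trans (⊗-congʳ inv) (⊗-identityˡ h))

⊗-cancelˡ : ∀ {f g} e e⁻¹ → e⁻¹ ⊗ e ≈ 𝟙 → e ⊗ f ≈ e ⊗ g → f ≈ g
⊗-cancelˡ {f} {g} e e⁻¹ inv p = trans (sym (cancel f)) (trans (⊗-congˡ p) (cancel g))
  where
  cancel : ∀ h → e⁻¹ ⊗ (e ⊗ h) ≈ h
  cancel h = trans (sym (⊗-assoc e⁻¹ e h)) (trans (⊗-congʳ inv) (⊗-identityˡ h))

head-tail : ∀ f → f ≈ ι (f 0) ⊕ q ⊗ tail f
head-tail f .at zero = ≡.sym (≡.trans (⊕-at _ _ 0) (≡.trans (cong₂ ℤ._+_ (ι-zero (f 0)) (q⊗-zero (tail f))) (ℤₚ.+-identityʳ (f 0))))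
head-tail f .at (suc n) = ≡.sym (≡.trans (⊕-at _ _ (suc n)) (≡.trans (cong₂ ℤ._+_ (ι-suc (f 0) n) (q⊗-suc (tail f) n)) (ℤₚ.+-identityˡ (f (suc n)))))

q↑⊗-below : ∀ N h n → n < N → (q ↑ N ⊗ h) n ≡ + 0
q↑⊗-below (suc N) h zero    n<N = ≡.trans (⊗-assoc q (q ↑ N) h .at 0) (q⊗-zero (q ↑ N ⊗ h))
q↑⊗-below (suc N) h (suc n) (s≤s n<N) = ≡.trans (⊗-assoc q (q ↑ N) h .at (suc n))
  (≡.trans (q⊗-suc (q ↑ N ⊗ h) n) (q↑⊗-below N h n n<N))

≋-coeff : ∀ {f g} N → f ≋ g mod (q ↑ N) → ∀ n → n < N → f n ≡ g n
≋-coeff {f} {g} N (quotient h p) n n<N = ≡.trans (p .at n) (≡.trans (⊕-at g _ n)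
  (≡.trans (cong (λ t → g n ℤ.+ t) (q↑⊗-below N h n n<N)) (ℤₚ.+-identityʳ (g n))))

coeff-≋ : ∀ N {f g} → (∀ n → n < N → f n ≡ g n) → f ≋ g mod (q ↑ N)
coeff-≋ zero    {f} {g} p = quotient (f ⊖ g) (solve 2 (λ f g → f := g :+ con (+ 1) :* (f :- g)) refl f g)
coeff-≋ (suc N) {f} {g} p with coeff-≋ N {tail f} {tail g} (λ n n<N → p (suc n) (s≤s n<N))
... | quotient h r = quotient h (begin
  f                                           ≈⟨ head-tail f ⟩
  ι (f 0) ⊕ q ⊗ tail f                        ≈⟨ +-cong (≡⇒≈ (p 0 (s≤s z≤n))) (⊗-congˡ r) ⟩
  ι (g 0) ⊕ q ⊗ (tail g ⊕ q ↑ N ⊗ h)          ≈⟨ solve 5 (λ c q t Q h → c :+ q :* (t :+ Q :* h) := (c :+ q :* t) :+ q :* Q :* h) refl (ι (g 0)) q (tail g) (q ↑ N) h ⟩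
  (ι (g 0) ⊕ q ⊗ tail g) ⊕ q ⊗ q ↑ N ⊗ h      ≈⟨ ⊕-congʳ (head-tail g) ⟨
  g ⊕ q ⊗ q ↑ N ⊗ h                           ∎)
  where
  ≡⇒≈ : ∀ {a b} → a ≡ b → ι a ≈ ι b
  ≡⇒≈ ≡.refl = refl

-- The q-adic topology is separated; this is the passage from truncated products to exact
-- identities.
≋-ext : ∀ {f g} → (∀ N → f ≋ g mod (q ↑ N)) → f ≈ g
≋-ext p .at n = ≋-coeff (suc n) (p (suc n)) n (s≤s ℕₚ.≤-refl)

q↑-weaken : ∀ {f g M N} → M ≤ N → f ≋ g mod (q ↑ N) → f ≋ g mod (q ↑ M)
q↑-weaken {M = M} {N} M≤N p = coeff-≋ M λ n n<M → ≋-coeff N p n (ℕₚ.≤-trans n<M M≤N)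

-- Dissection operators

opaque
  unfolding _⊕_

  -- V f = f(q²); U f and U′ f collect the even and the odd coefficients; σ f = f(-q).

  V : PS → PS
  V f zero          = f 0
  V f (suc zero)    = + 0
  V f (suc (suc n)) = V (tail f) n

  U : PS → PS
  U f zero    = f 0
  U f (suc n) = U (tail (tail f)) n

  U′ : PS → PS
  U′ f = U (tail f)

  σ : PS → PS
  σ f zero    = f 0
  σ f (suc n) = ℤ.- σ (tail f) n

  U-at : ∀ f n → U f n ≡ f (2 * n)
  U-at f zero    = ≡.refl
  U-at f (suc n) = ≡.trans (U-at (tail (tail f)) n) (cong (f ∘ suc) (≡.sym (ℕₚ.+-suc n (n + 0))))

  U′-at : ∀ f n → U′ f n ≡ f (suc (2 * n))
  U′-at f n = U-at (tail f) n

  private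
    V-cong-at : ∀ n {f g : PS} → (∀ m → f m ≡ g m) → V f n ≡ V g n
    V-cong-at zero          p = p 0
    V-cong-at (suc zero)    p = ≡.refl
    V-cong-at (suc (suc n)) p = V-cong-at n (p ∘ suc)

    V-⊕-at : ∀ n f g → V (f ⊕ g) n ≡ V f n ℤ.+ V g n
    V-⊕-at zero          f g = ≡.refl
    V-⊕-at (suc zero)    f g = ≡.refl
    V-⊕-at (suc (suc n)) f g = V-⊕-at n (tail f) (tail g)

    V-scale-at : ∀ n c f → V (λ m → c ℤ.* f m) n ≡ c ℤ.* V f n
    V-scale-at zero          c f = ≡.refl
    V-scale-at (suc zero)    c f = ≡.sym (ℤₚ.*-zeroʳ c)
    V-scale-at (suc (suc n)) c f = V-scale-at n c (tail f)

    V-⊗-at : ∀ n f g → V (f ⊗ g) n ≡ (V f ⊗ V g) n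
    V-⊗-at zero          f g = ≡.refl
    V-⊗-at (suc zero)    f g = ≡.sym (≡.trans (ℤₚ.+-identityʳ (f 0 ℤ.* + 0)) (ℤₚ.*-zeroʳ (f 0)))
    V-⊗-at (suc (suc n)) f g = ≡.trans (V-⊕-at n (λ m → f 0 ℤ.* g (suc m)) (tail f ⊗ g))
      (cong₂ ℤ._+_ (V-scale-at n (f 0) (tail g)) (≡.trans (V-⊗-at n (tail f) g) (≡.sym (ℤₚ.+-identityˡ _))))

    U-cong-at : ∀ n {f g : PS} → (∀ m → f m ≡ g m) → U f n ≡ U g n
    U-cong-at zero    p = p 0
    U-cong-at (suc n) p = U-cong-at n (p ∘ suc ∘ suc)

    U-⊕-at : ∀ n f g → U (f ⊕ g) n ≡ U f n ℤ.+ U g n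
    U-⊕-at zero    f g = ≡.refl
    U-⊕-at (suc n) f g = U-⊕-at n (tail (tail f)) (tail (tail g))

    σ-cong-at : ∀ n {f g : PS} → (∀ m → f m ≡ g m) → σ f n ≡ σ g n
    σ-cong-at zero    p = p 0
    σ-cong-at (suc n) p = cong ℤ.-_ (σ-cong-at n (p ∘ suc))

    σ-⊕-at : ∀ n f g → σ (f ⊕ g) n ≡ σ f n ℤ.+ σ g n
    σ-⊕-at zero    f g = ≡.refl
    σ-⊕-at (suc n) f g = ≡.trans (cong ℤ.-_ (σ-⊕-at n (tail f) (tail g))) (ℤₚ.neg-distrib-+ (σ (tail f) n) _)

    σ-scale-at : ∀ n c f → σ (λ m → c ℤ.* f m) n ≡ c ℤ.* σ f n
    σ-scale-at zero    c f = ≡.refl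
    σ-scale-at (suc n) c f = ≡.trans (cong ℤ.-_ (σ-scale-at n c (tail f))) (ℤₚ.neg-distribʳ-* c _)

    σ-⊗-at : ∀ n f g → σ (f ⊗ g) n ≡ (σ f ⊗ σ g) n
    σ-⊗-at zero    f g = ≡.refl
    σ-⊗-at (suc n) f g = ≡.trans (cong ℤ.-_ (≡.trans (σ-⊕-at n (λ m → f 0 ℤ.* g (suc m)) (tail f ⊗ g))
        (cong₂ ℤ._+_ (σ-scale-at n (f 0) (tail g)) (σ-⊗-at n (tail f) g))))
      (≡.trans (ℤₚ.neg-distrib-+ (f 0 ℤ.* σ (tail g) n) _)
        (cong₂ ℤ._+_ (ℤₚ.neg-distribʳ-* (f 0) _)
          (≡.sym (solve 2 (λ a b → :- a :* b := :- (a :* b)) refl (σ (tail f)) (σ g) .at n))))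

    ι0≡0 : ∀ n → 𝟘 n ≡ + 0
    ι0≡0 zero    = ≡.refl
    ι0≡0 (suc n) = ≡.refl

    0-V : ∀ n {f : PS} → (∀ m → f m ≡ + 0) → V f n ≡ + 0
    0-V zero          p = p 0
    0-V (suc zero)    p = ≡.refl
    0-V (suc (suc n)) p = 0-V n (p ∘ suc)

    0-σ : ∀ n {f : PS} → (∀ m → f m ≡ + 0) → σ f n ≡ + 0
    0-σ zero    p = p 0
    0-σ (suc n) p = cong ℤ.-_ (0-σ n (p ∘ suc))

    UV-at : ∀ n f → U (V f) n ≡ f n
    UV-at zero    f = ≡.refl
    UV-at (suc n) f = UV-at n (tail f)

    U′V-at : ∀ n f → U (tail (V f)) n ≡ + 0
    U′V-at zero    f = ≡.refl
    U′V-at (suc n) f = U′V-at n (tail f)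

    σV-at : ∀ n f → σ (V f) n ≡ V f n
    σV-at zero          f = ≡.refl
    σV-at (suc zero)    f = ≡.refl
    σV-at (suc (suc n)) f = ≡.trans (ℤₚ.neg-involutive (σ (V (tail f)) n)) (σV-at n (tail f))

    split-at : ∀ n f → f n ≡ (V (U f) ⊕ q ⊗ V (U (tail f))) n
    split-at zero          f = ≡.sym (ℤₚ.+-identityʳ (f 0))
    split-at (suc zero)    f = ≡.sym (≡.trans (ℤₚ.+-identityˡ _) (q⊗-suc (V (U (tail f))) 0))
    split-at (suc (suc n)) f = ≡.trans (split-at n (tail (tail f)))
      (cong (λ t → V (U (tail (tail f))) n ℤ.+ t) (lemma n))
      where
      lemma : ∀ n → (q ⊗ V (U (tail (tail (tail f))))) n ≡ (q ⊗ V (U (tail f))) (suc (suc n))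
      lemma zero    = ≡.sym (q⊗-suc (V (U (tail f))) 1)
      lemma (suc n) = ≡.trans (q⊗-suc (V (U (tail (tail (tail f))))) n) (≡.sym (q⊗-suc (V (U (tail f))) (suc (suc n))))

  V-cong : ∀ {f g} → f ≈ g → V f ≈ V g
  V-cong p .at n = V-cong-at n (p .at)

  V-⊕ : ∀ f g → V (f ⊕ g) ≈ V f ⊕ V g
  V-⊕ f g .at n = V-⊕-at n f g

  V-⊗ : ∀ f g → V (f ⊗ g) ≈ V f ⊗ V g
  V-⊗ f g .at n = V-⊗-at n f g

  V-ι : ∀ c → V (ι c) ≈ ι c
  V-ι c .at zero          = ≡.refl
  V-ι c .at (suc zero)    = ≡.refl
  V-ι c .at (suc (suc n)) = 0-V n (λ _ → ≡.refl)

  V-q : V q ≈ q ⊗ q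
  V-q .at zero                = ≡.refl
  V-q .at (suc zero)          = ≡.refl
  V-q .at (suc (suc zero))    = ≡.refl
  V-q .at (suc (suc (suc n))) = ≡.sym (≡.trans (q⊗-suc q (suc (suc n))) (≡.sym (lemma n)))
    where
    lemma : ∀ n → V (tail q) (suc n) ≡ + 0
    lemma zero    = ≡.refl
    lemma (suc n) = 0-V n (λ _ → ≡.refl)

  U-cong : ∀ {f g} → f ≈ g → U f ≈ U g
  U-cong p .at n = U-cong-at n (p .at)

  U′-cong : ∀ {f g} → f ≈ g → U′ f ≈ U′ g
  U′-cong p .at n = U-cong-at n (p .at ∘ suc)

  U-⊕ : ∀ f g → U (f ⊕ g) ≈ U f ⊕ U g
  U-⊕ f g .at n = U-⊕-at n f g

  U′-⊕ : ∀ f g → U′ (f ⊕ g) ≈ U′ f ⊕ U′ g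
  U′-⊕ f g .at n = U-⊕-at n (tail f) (tail g)

  U-V : ∀ f → U (V f) ≈ f
  U-V f .at n = UV-at n f

  U′-V : ∀ f → U′ (V f) ≈ 𝟘
  U′-V f .at n = ≡.trans (U′V-at n f) (≡.sym (ι0≡0 n))

  U′-q : ∀ f → U′ (q ⊗ f) ≈ U f
  U′-q f .at n = U-cong-at n (q⊗-suc f)

  U-q : ∀ f → U (q ⊗ f) ≈ q ⊗ U′ f
  U-q f .at zero    = ≡.refl
  U-q f .at (suc n) = ≡.trans (U-cong-at n (q⊗-suc f ∘ suc)) (≡.sym (q⊗-suc (U′ f) n))

  split : ∀ f → f ≈ V (U f) ⊕ q ⊗ V (U′ f)
  split f .at n = split-at n f

  σ-cong : ∀ {f g} → f ≈ g → σ f ≈ σ g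
  σ-cong p .at n = σ-cong-at n (p .at)

  σ-⊕ : ∀ f g → σ (f ⊕ g) ≈ σ f ⊕ σ g
  σ-⊕ f g .at n = σ-⊕-at n f g

  σ-⊗ : ∀ f g → σ (f ⊗ g) ≈ σ f ⊗ σ g
  σ-⊗ f g .at n = σ-⊗-at n f g

  σ-ι : ∀ c → σ (ι c) ≈ ι c
  σ-ι c .at zero    = ≡.refl
  σ-ι c .at (suc n) = cong ℤ.-_ (0-σ n (λ _ → ≡.refl))

  σ-V : ∀ f → σ (V f) ≈ V f
  σ-V f .at n = σV-at n f

  σ-q : σ q ≈ ⊝ q
  σ-q .at zero          = ≡.refl
  σ-q .at (suc zero)    = ≡.refl
  σ-q .at (suc (suc n)) = lemma n
    where
    lemma : ∀ n → σ q (suc (suc n)) ≡ + 0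
    lemma n = ≡.trans (ℤₚ.neg-involutive (σ (tail (tail q)) n)) (0-σ n (λ _ → ≡.refl))

-- Extraction is linear over the series in q²: multiplying by one of them does not mix the even and
-- the odd part of `g`.
U-V⊗ : ∀ f g → U (V f ⊗ g) ≈ f ⊗ U g
U-V⊗ f g = begin
  U (V f ⊗ g)                              ≈⟨ U-cong (⊗-congˡ (split g)) ⟩
  U (V f ⊗ (V (U g) ⊕ q ⊗ V (U′ g)))       ≈⟨ U-cong (solve 4 (λ f a q b → f :* (a :+ q :* b) := f :* a :+ q :* (f :* b)) refl (V f) (V (U g)) q (V (U′ g))) ⟩
  U (V f ⊗ V (U g) ⊕ q ⊗ (V f ⊗ V (U′ g))) ≈⟨ U-⊕ _ _ ⟩
  U (V f ⊗ V (U g)) ⊕ U (q ⊗ (V f ⊗ V (U′ g))) ≈⟨ +-cong (trans (U-cong (sym (V-⊗ f (U g)))) (U-V _)) (trans (U-q _) (⊗-congˡ (trans (U′-cong (sym (V-⊗ f (U′ g)))) (U′-V _)))) ⟩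
  f ⊗ U g ⊕ q ⊗ 𝟘                          ≈⟨ solve 2 (λ a q → a :+ q :* con (+ 0) := a) refl (f ⊗ U g) q ⟩
  f ⊗ U g                                  ∎

U′-V⊗ : ∀ f g → U′ (V f ⊗ g) ≈ f ⊗ U′ g
U′-V⊗ f g = begin
  U′ (V f ⊗ g)                              ≈⟨ U′-cong (⊗-congˡ (split g)) ⟩
  U′ (V f ⊗ (V (U g) ⊕ q ⊗ V (U′ g)))       ≈⟨ U′-cong (solve 4 (λ f a q b → f :* (a :+ q :* b) := f :* a :+ q :* (f :* b)) refl (V f) (V (U g)) q (V (U′ g))) ⟩
  U′ (V f ⊗ V (U g) ⊕ q ⊗ (V f ⊗ V (U′ g))) ≈⟨ U′-⊕ _ _ ⟩
  U′ (V f ⊗ V (U g)) ⊕ U′ (q ⊗ (V f ⊗ V (U′ g))) ≈⟨ +-cong (trans (U′-cong (sym (V-⊗ f (U g)))) (U′-V _)) (trans (U′-q _) (trans (U-cong (sym (V-⊗ f (U′ g)))) (U-V _))) ⟩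
  𝟘 ⊕ f ⊗ U′ g                              ≈⟨ ⊕-identityˡ _ ⟩
  f ⊗ U′ g                                  ∎

V-injective : ∀ {f g} → V f ≈ V g → f ≈ g
V-injective {f} {g} p = trans (sym (U-V f)) (trans (U-cong p) (U-V g))

V-⊝ : ∀ f → V (⊝ f) ≈ ⊝ V f
V-⊝ f = begin
  V (⊝ f)              ≈⟨ V-cong (solve 1 (λ f → :- f := con (ℤ.- + 1) :* f) refl f) ⟩
  V (ι (ℤ.- + 1) ⊗ f)  ≈⟨ trans (V-⊗ _ f) (⊗-congʳ (V-ι _)) ⟩
  ι (ℤ.- + 1) ⊗ V f    ≈⟨ solve 1 (λ f → con (ℤ.- + 1) :* f := :- f) refl (V f) ⟩
  ⊝ V f                ∎

σ-⊝ : ∀ f → σ (⊝ f) ≈ ⊝ σ f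
σ-⊝ f = begin
  σ (⊝ f)              ≈⟨ σ-cong (solve 1 (λ f → :- f := con (ℤ.- + 1) :* f) refl f) ⟩
  σ (ι (ℤ.- + 1) ⊗ f)  ≈⟨ trans (σ-⊗ _ f) (⊗-congʳ (σ-ι _)) ⟩
  ι (ℤ.- + 1) ⊗ σ f    ≈⟨ solve 1 (λ f → con (ℤ.- + 1) :* f := :- f) refl (σ f) ⟩
  ⊝ σ f                ∎

V-↑ : ∀ f n → V (f ↑ n) ≈ V f ↑ n
V-↑ f zero    = V-ι _
V-↑ f (suc n) = trans (V-⊗ f (f ↑ n)) (⊗-congˡ (V-↑ f n))

σ-↑ : ∀ f n → σ (f ↑ n) ≈ σ f ↑ n
σ-↑ f zero    = σ-ι _
σ-↑ f (suc n) = trans (σ-⊗ f (f ↑ n)) (⊗-congˡ (σ-↑ f n))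

U-ι⊗ : ∀ c f → U (ι c ⊗ f) ≈ ι c ⊗ U f
U-ι⊗ c f = trans (U-cong (⊗-congʳ (sym (V-ι c)))) (U-V⊗ (ι c) f)

U′-ι⊗ : ∀ c f → U′ (ι c ⊗ f) ≈ ι c ⊗ U′ f
U′-ι⊗ c f = trans (U′-cong (⊗-congʳ (sym (V-ι c)))) (U′-V⊗ (ι c) f)

U-≋ : ∀ {f g} c → f ≋ g mod ι c → U f ≋ U g mod ι c
U-≋ {f} {g} c (quotient h p) = quotient (U h) (trans (U-cong p) (trans (U-⊕ _ _) (⊕-congˡ (U-ι⊗ c h))))

U′-≋ : ∀ {f g} c → f ≋ g mod ι c → U′ f ≋ U′ g mod ι c
U′-≋ {f} {g} c (quotient h p) = quotient (U′ h) (trans (U′-cong p) (trans (U′-⊕ _ _) (⊕-congˡ (U′-ι⊗ c h))))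

V-≋ : ∀ {f g} c → f ≋ g mod ι c → V f ≋ V g mod ι c
V-≋ c (quotient h p) = quotient (V h) (trans (V-cong p) (trans (V-⊕ _ _) (⊕-congˡ (trans (V-⊗ _ h) (⊗-congʳ (V-ι c))))))

-- The precision in fact doubles; the surplus q^N goes into the quotient, so that a whole
-- computation keeps one modulus.
V-≋-q↑ : ∀ {f g} N → f ≋ g mod (q ↑ N) → V f ≋ V g mod (q ↑ N)
V-≋-q↑ {f} {g} N (quotient h p) = quotient (q ↑ N ⊗ V h) (begin
  V f                          ≈⟨ V-cong p ⟩
  V (g ⊕ q ↑ N ⊗ h)            ≈⟨ trans (V-⊕ _ _) (⊕-congˡ (trans (V-⊗ _ h) (⊗-congʳ (trans (V-↑ q N) (↑-cong N V-q))))) ⟩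
  V g ⊕ (q ⊗ q) ↑ N ⊗ V h      ≈⟨ ⊕-congˡ (trans (⊗-congʳ (↑-⊗ q q N)) (⊗-assoc _ _ _)) ⟩
  V g ⊕ q ↑ N ⊗ (q ↑ N ⊗ V h)  ∎)

σ-≋-q↑ : ∀ {f g} N → f ≋ g mod (q ↑ N) → σ f ≋ σ g mod (q ↑ N)
σ-≋-q↑ {f} {g} N (quotient h p) = quotient (ι (ℤ.- + 1) ↑ N ⊗ σ h) (begin
  σ f                                    ≈⟨ σ-cong p ⟩
  σ (g ⊕ q ↑ N ⊗ h)                      ≈⟨ trans (σ-⊕ _ _) (⊕-congˡ (trans (σ-⊗ _ h) (⊗-congʳ (trans (σ-↑ q N) (sign N))))) ⟩
  σ g ⊕ q ↑ N ⊗ ι (ℤ.- + 1) ↑ N ⊗ σ h    ≈⟨ ⊕-congˡ (⊗-assoc _ _ _) ⟩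
  σ g ⊕ q ↑ N ⊗ (ι (ℤ.- + 1) ↑ N ⊗ σ h)  ∎)
  where
  sign : ∀ n → σ q ↑ n ≈ q ↑ n ⊗ ι (ℤ.- + 1) ↑ n
  sign zero    = sym (⊗-identityˡ 𝟙)
  sign (suc n) = trans (*-cong σ-q (sign n))
    (solve 3 (λ a A B → :- a :* (A :* B) := a :* A :* (con (ℤ.- + 1) :* B)) refl q (q ↑ n) (ι (ℤ.- + 1) ↑ n))

-- Finite and infinite products

∏ : (ℕ → PS) → ℕ → PS
∏ f zero    = 𝟙
∏ f (suc n) = ∏ f n ⊗ f n

∏-cong : ∀ {f g} → (∀ j → f j ≈ g j) → ∀ n → ∏ f n ≈ ∏ g n
∏-cong p zero    = refl
∏-cong p (suc n) = *-cong (∏-cong p n) (p n)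

∏-⊗ : ∀ f g n → ∏ f n ⊗ ∏ g n ≈ ∏ (λ j → f j ⊗ g j) n
∏-⊗ f g zero    = ⊗-identityˡ 𝟙
∏-⊗ f g (suc n) = trans
  (solve 4 (λ F f G g → F :* f :* (G :* g) := F :* G :* (f :* g)) refl (∏ f n) (f n) (∏ g n) (g n))
  (⊗-congʳ (∏-⊗ f g n))

V-∏ : ∀ f n → V (∏ f n) ≈ ∏ (V ∘ f) n
V-∏ f zero    = V-ι _
V-∏ f (suc n) = trans (V-⊗ _ _) (⊗-congʳ (V-∏ f n))

σ-∏ : ∀ f n → σ (∏ f n) ≈ ∏ (σ ∘ f) n
σ-∏ f zero    = σ-ι _
σ-∏ f (suc n) = trans (σ-⊗ _ _) (⊗-congʳ (σ-∏ f n))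

∏-stable : ∀ {d} f n → (∀ j → n ≤ j → f j ≋ 𝟙 mod d) → ∀ k → ∏ f (k + n) ≋ ∏ f n mod d
∏-stable f n p zero    = ≋-refl
∏-stable f n p (suc k) = ≋-respʳ (⊗-identityʳ _) (⊗-≋ (∏-stable f n p k) (p (k + n) (ℕₚ.m≤n+m n k)))

-- Coefficient n is read off the first n factors. This is the infinite product when the factor of
-- index j is 1 modulo q^(j+1), as later factors then leave that coefficient alone.
lim∏ : (ℕ → PS) → PS
lim∏ f n = ∏ f n n

lim∏-≋ : ∀ f → (∀ j → f j ≋ 𝟙 mod (q ↑ suc j)) → ∀ M {N} → N ≤ suc M → lim∏ f ≋ ∏ f M mod (q ↑ N)
lim∏-≋ f p M {N} N≤1+M = coeff-≋ N λ n n<N →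
  ≡.sym (≋-coeff (suc n)
    (≡.subst (λ m → ∏ f m ≋ ∏ f n mod (q ↑ suc n)) (ℕₚ.m∸n+n≡m (ℕₚ.≤-pred (ℕₚ.≤-trans n<N N≤1+M)))
      (∏-stable f n (λ j n≤j → q↑-weaken (s≤s n≤j) (p j)) (M ∸ n)))
    n ℕₚ.≤-refl)

≋0-⊗ʳ : ∀ {f d} g → f ≋ 𝟘 mod d → f ⊗ g ≋ 𝟘 mod d
≋0-⊗ʳ g p = ≋-respʳ (⊗-zeroˡ g) (⊗-≋ p ≋-refl)

≋0-⊗ˡ : ∀ {f d} g → f ≋ 𝟘 mod d → g ⊗ f ≋ 𝟘 mod d
≋0-⊗ˡ g p = ≋-respʳ (⊗-zeroʳ g) (⊗-≋ (≋-refl {g}) p)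

≋-⊕0 : ∀ {f g h d} → f ≋ g mod d → h ≋ 𝟘 mod d → f ⊕ h ≋ g mod d
≋-⊕0 p r = ≋-respʳ (⊕-identityʳ _) (⊕-≋ p r)

-- The order of `f` adds to the precision of `g`, which `T-tl` needs where neither suffices alone.
≋-⊗-order : ∀ {f g h} M N → f ≋ 𝟘 mod (q ↑ M) → g ≋ h mod (q ↑ N) → f ⊗ g ≋ f ⊗ h mod (q ↑ (M + N))
≋-⊗-order {f} {g} {h} M N (quotient u p) (quotient v r) = quotient (u ⊗ v) (begin
  f ⊗ g                                        ≈⟨ ⊗-congˡ r ⟩
  f ⊗ (h ⊕ q ↑ N ⊗ v)                          ≈⟨ solve 4 (λ f h Q v → f :* (h :+ Q :* v) := f :* h :+ f :* (Q :* v)) refl f h (q ↑ N) v ⟩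
  f ⊗ h ⊕ f ⊗ (q ↑ N ⊗ v)                      ≈⟨ ⊕-congˡ (⊗-congʳ p) ⟩
  f ⊗ h ⊕ (𝟘 ⊕ q ↑ M ⊗ u) ⊗ (q ↑ N ⊗ v)        ≈⟨ ⊕-congˡ (solve 4 (λ Q R u v → (con (+ 0) :+ Q :* u) :* (R :* v) := Q :* R :* (u :* v)) refl (q ↑ M) (q ↑ N) u v) ⟩
  f ⊗ h ⊕ q ↑ M ⊗ q ↑ N ⊗ (u ⊗ v)              ≈⟨ ⊕-congˡ (⊗-congʳ (↑-+ q M N)) ⟨
  f ⊗ h ⊕ q ↑ (M + N) ⊗ (u ⊗ v)                ∎)

-- Jacobi's triple product

-- Jacobi's triple product (x)_∞ (-a; x)_∞ (-b; x)_∞ = Σ_k a^{k(k+1)/2} b^{k(k-1)/2}, x = ab, modulo q^n.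

module TripleProduct (a b w : PS) (ab≈qw : a ⊗ b ≈ q ⊗ w) where

  x : PS
  x = a ⊗ b

  -- T i n is the term with index k = i - n.
  T : ℕ → ℕ → PS
  T zero    zero    = 𝟙
  T (suc i) (suc n) = T i n
  T (suc i) zero    = T i zero ⊗ (a ⊗ x ↑ i)
  T zero    (suc n) = T zero n ⊗ (b ⊗ x ↑ n)

  -- Consecutive terms have the ratio x^(i-n)/b, multiplied out here to avoid negative exponents.
  T-shift : ∀ i n → b ⊗ x ↑ n ⊗ T i n ≈ x ↑ i ⊗ T i (suc n)
  T-shift zero    n       = solve 3 (λ b X t → b :* X :* t := con (+ 1) :* (t :* (b :* X))) refl b (x ↑ n) (T zero n)
  T-shift (suc i) zero    = solve 4 (λ a b X t → b :* con (+ 1) :* (t :* (a :* X)) := a :* b :* X :* t) refl a b (x ↑ i) (T i zero)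
  T-shift (suc i) (suc n) = begin
    b ⊗ (x ⊗ x ↑ n) ⊗ T i n    ≈⟨ solve 4 (λ b x X t → b :* (x :* X) :* t := x :* (b :* X :* t)) refl b x (x ↑ n) (T i n) ⟩
    x ⊗ (b ⊗ x ↑ n ⊗ T i n)    ≈⟨ ⊗-congˡ (T-shift i n) ⟩
    x ⊗ (x ↑ i ⊗ T i (suc n))  ≈⟨ ⊗-assoc _ _ _ ⟨
    x ⊗ x ↑ i ⊗ T i (suc n)    ∎

  T-diagˡ : ∀ k m → T (m + k) m ≡ T k 0
  T-diagˡ k zero    = ≡.refl
  T-diagˡ k (suc m) = T-diagˡ k m

  T-diagʳ : ∀ k m → T m (m + k) ≡ T 0 k
  T-diagʳ k zero    = ≡.refl
  T-diagʳ k (suc m) = T-diagʳ k m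

  x↑-order : ∀ k → x ↑ k ≋ 𝟘 mod (q ↑ k)
  x↑-order k = ≋-respˡ (sym (trans (↑-cong k ab≈qw) (↑-⊗ q w k))) (≋-multiple (q ↑ k) (w ↑ k))

  T⁺-order : ∀ k → T (suc k) 0 ≋ 𝟘 mod (q ↑ k)
  T⁺-order k = ≋0-⊗ˡ _ (≋0-⊗ˡ a (x↑-order k))

  T⁻-order : ∀ k → T 0 (suc k) ≋ 𝟘 mod (q ↑ k)
  T⁻-order k = ≋0-⊗ˡ _ (≋0-⊗ˡ b (x↑-order k))

  -- tl l i = ∏_{i < j ≤ i + l} (1 - x^j)
  tl : ℕ → ℕ → PS
  tl zero    i = 𝟙
  tl (suc l) i = (𝟙 ⊖ x ↑ suc i) ⊗ tl l (suc i)

  X∏ A∏ B∏ : ℕ → PS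
  X∏ = ∏ (λ j → 𝟙 ⊖ x ↑ suc j)
  A∏ = ∏ (λ j → 𝟙 ⊕ a ⊗ x ↑ j)
  B∏ = ∏ (λ j → 𝟙 ⊕ b ⊗ x ↑ j)

  tl-∏ : ∀ l → tl l 0 ≈ X∏ l
  tl-∏ l = trans (sym (⊗-identityˡ _)) (≡.subst (λ m → 𝟙 ⊗ tl l 0 ≈ X∏ m) (ℕₚ.+-identityʳ l) (extend l 0))
    where
    extend : ∀ l i → X∏ i ⊗ tl l i ≈ X∏ (l + i)
    extend zero    i = ⊗-identityʳ _
    extend (suc l) i = trans (sym (⊗-assoc _ _ _)) (≡.subst (λ m → X∏ (suc i) ⊗ tl l (suc i) ≈ X∏ m) (ℕₚ.+-suc l i) (extend l (suc i)))

  tl-≋ : ∀ l i → tl l i ≋ 𝟙 mod (q ↑ suc i)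
  tl-≋ zero    i = ≋-refl
  tl-≋ (suc l) i = ≋-respʳ (solve 0 ((con (+ 1) :- con (+ 0)) :* con (+ 1) := con (+ 1)) refl)
    (⊗-≋ (⊕-≋ ≋-refl (⊝-≋ (x↑-order (suc i)))) (q↑-weaken (ℕₚ.n≤1+n (suc i)) (tl-≋ l (suc i))))

  -- Σ_{i ≤ j ≤ i + l} A j · ∏_{j < k ≤ i + l} (1 - x^k)
  weighted : (ℕ → PS) → ℕ → ℕ → PS
  weighted A zero    i = A i
  weighted A (suc l) i = A i ⊗ tl (suc l) i ⊕ weighted A l (suc i)

  -- Summation by parts. `B j` occurs twice, once with x^j times its weight and once with the weight
  -- of the index before, which is 1 - x^j times its own; the two add up to its weight. What remains
  -- are boundary terms, and the lower one carries 1 - x^i, which is 0 at i = 0.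
  weighted-step : ∀ A B c → (∀ i → (𝟙 ⊕ c) ⊗ A i ≈ x ↑ i ⊗ B i ⊕ B (suc i)) → ∀ l i →
    (𝟙 ⊕ c) ⊗ weighted A l i ≈ weighted B l i ⊖ (𝟙 ⊖ x ↑ i) ⊗ (B i ⊗ tl l i) ⊕ B (suc (l + i))
  weighted-step A B c p zero    i = trans (p i)
    (solve 3 (λ X b b′ → X :* b :+ b′ := b :- (con (+ 1) :- X) :* (b :* con (+ 1)) :+ b′) refl (x ↑ i) (B i) (B (suc i)))
  weighted-step A B c p (suc l) i = begin
    (𝟙 ⊕ c) ⊗ (A i ⊗ (t₁ ⊗ t) ⊕ weighted A l (suc i))
      ≈⟨ solve 4 (λ c a t w → c :* (a :* t :+ w) := c :* a :* t :+ c :* w) refl (𝟙 ⊕ c) (A i) (t₁ ⊗ t) (weighted A l (suc i)) ⟩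
    (𝟙 ⊕ c) ⊗ A i ⊗ (t₁ ⊗ t) ⊕ (𝟙 ⊕ c) ⊗ weighted A l (suc i)
      ≈⟨ +-cong (⊗-congʳ (p i)) (weighted-step A B c p l (suc i)) ⟩
    (x ↑ i ⊗ B i ⊕ B (suc i)) ⊗ (t₁ ⊗ t) ⊕ (weighted B l (suc i) ⊖ t₁ ⊗ (B (suc i) ⊗ t) ⊕ B (suc (l + suc i)))
      ≈⟨ solve 7 (λ X b b′ t₁ t w e → (X :* b :+ b′) :* (t₁ :* t) :+ (w :- t₁ :* (b′ :* t) :+ e)
           := b :* (t₁ :* t) :+ w :- (con (+ 1) :- X) :* (b :* (t₁ :* t)) :+ e) refl
           (x ↑ i) (B i) (B (suc i)) t₁ t (weighted B l (suc i)) (B (suc (l + suc i))) ⟩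
    B i ⊗ (t₁ ⊗ t) ⊕ weighted B l (suc i) ⊖ (𝟙 ⊖ x ↑ i) ⊗ (B i ⊗ (t₁ ⊗ t)) ⊕ B (suc (l + suc i))
      ≈⟨ ⊕-congˡ (≡.subst (λ m → B (suc (l + suc i)) ≈ B (suc m)) (ℕₚ.+-suc l i) refl) ⟩
    B i ⊗ (t₁ ⊗ t) ⊕ weighted B l (suc i) ⊖ (𝟙 ⊖ x ↑ i) ⊗ (B i ⊗ (t₁ ⊗ t)) ⊕ B (suc (suc l + i)) ∎
    where
    t₁ = 𝟙 ⊖ x ↑ suc i
    t  = tl l (suc i)

  weighted-step₀ : ∀ A B c → (∀ i → (𝟙 ⊕ c) ⊗ A i ≈ x ↑ i ⊗ B i ⊕ B (suc i)) → ∀ l →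
    (𝟙 ⊕ c) ⊗ weighted A l 0 ≈ weighted B l 0 ⊕ B (suc l)
  weighted-step₀ A B c p l = begin
    (𝟙 ⊕ c) ⊗ weighted A l 0                                                ≈⟨ weighted-step A B c p l 0 ⟩
    weighted B l 0 ⊖ (𝟙 ⊖ 𝟙) ⊗ (B 0 ⊗ tl l 0) ⊕ B (suc (l + 0))            ≈⟨ solve 3 (λ w t b → w :- (con (+ 1) :- con (+ 1)) :* t :+ b := w :+ b) refl (weighted B l 0) (B 0 ⊗ tl l 0) (B (suc (l + 0))) ⟩
    weighted B l 0 ⊕ B (suc (l + 0))                                        ≈⟨ ⊕-congˡ (≡.subst (λ m → B (suc (l + 0)) ≈ B (suc m)) (ℕₚ.+-identityʳ l) refl) ⟩
    weighted B l 0 ⊕ B (suc l)                                              ∎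

  weighted-0 : ∀ {d} A → (∀ i → A (suc i) ≋ 𝟘 mod d) → ∀ l i → weighted A l (suc i) ≋ 𝟘 mod d
  weighted-0 A p zero    i = p i
  weighted-0 A p (suc l) i = ≋-⊕0 (≋0-⊗ʳ _ (p i)) (weighted-0 A p l (suc i))

  -- The numerators of Euler's series for ∏_{j ≥ m} (1 + a x^j); its denominators (x; x)_i are
  -- cleared by the weights of `weighted`.
  W : ℕ → ℕ → PS
  W m i = (x ↑ m) ↑ i ⊗ T i 0

  W-step : ∀ m i → (𝟙 ⊕ a ⊗ x ↑ m) ⊗ W (suc m) i ≈ x ↑ i ⊗ W m i ⊕ W m (suc i)
  W-step m i = trans (⊗-congˡ (⊗-congʳ (↑-⊗ x (x ↑ m) i)))
    (solve 5 (λ a X Y Z t → (con (+ 1) :+ a :* X) :* (Y :* Z :* t) := Y :* (Z :* t) :+ X :* Z :* (t :* (a :* Y))) refl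
      a (x ↑ m) (x ↑ i) ((x ↑ m) ↑ i) (T i 0))

  -- Euler's functional equation f(a) = (1 + a) f(a x), iterated m times; each iteration leaves an
  -- upper boundary term of order at least l.
  A∏-≋ : ∀ l m → A∏ m ⊗ weighted (W m) l 0 ≋ weighted (W 0) l 0 mod (q ↑ l)
  A∏-≋ l zero    = ≈⇒≋ (⊗-identityˡ _)
  A∏-≋ l (suc m) = ≋-trans (≈⇒≋ (trans (⊗-assoc _ _ _) (⊗-congˡ (weighted-step₀ (W (suc m)) (W m) _ (W-step m) l))))
    (≋-trans (⊗-≋ (≋-refl {A∏ m}) (≋-⊕0 ≋-refl (≋0-⊗ˡ _ (T⁺-order l)))) (A∏-≋ l m))

  -- Every summand except i = 0 contains the factor x^n.
  W-∞ : ∀ n l → weighted (W n) l 0 ≋ tl l 0 mod (q ↑ n)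
  W-∞ n zero    = ≈⇒≋ (⊗-identityˡ _)
  W-∞ n (suc l) = ≋-⊕0 (≈⇒≋ (solve 1 (λ t → con (+ 1) :* con (+ 1) :* t := t) refl (tl (suc l) 0)))
    (weighted-0 (W n) (λ i → ≋0-⊗ʳ _ (≋0-⊗ʳ _ (x↑-order n))) l 0)

  -- Each factor 1 + b x^m shifts the window of indices k down by one: the terms obey the same
  -- recurrence as `W`, by `T-shift` and because `T i m` is also `T (suc i) (suc m)`. The window has
  -- length 2n so that the terms dropped at its top still have order at least n.
  B∏-≋ : ∀ n m → m ≤ n → B∏ m ⊗ weighted (λ i → T i 0) (n + n) 0 ≋ weighted (λ i → T i m) (n + n) 0 mod (q ↑ n)
  B∏-≋ n zero    m≤n = ≈⇒≋ (⊗-identityˡ _)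
  B∏-≋ n (suc m) m<n = ≋-trans
    (≈⇒≋ (solve 3 (λ B c w → B :* c :* w := c :* (B :* w)) refl (B∏ m) (𝟙 ⊕ b ⊗ x ↑ m) _))
    (≋-trans (⊗-≋ ≋-refl (B∏-≋ n m (ℕₚ.<⇒≤ m<n)))
      (≋-trans (≈⇒≋ (weighted-step₀ (λ i → T i m) (λ i → T i (suc m)) _ step (n + n))) (≋-⊕0 ≋-refl (error m<n))))
    where
    step : ∀ i → (𝟙 ⊕ b ⊗ x ↑ m) ⊗ T i m ≈ x ↑ i ⊗ T i (suc m) ⊕ T (suc i) (suc m)
    step i = trans (solve 2 (λ c t → (con (+ 1) :+ c) :* t := c :* t :+ t) refl (b ⊗ x ↑ m) (T i m)) (⊕-congʳ (T-shift i m))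
    error : m < n → T (n + n) m ≋ 𝟘 mod (q ↑ n)
    error m<n = ≡.subst (λ t → t ≋ 𝟘 mod (q ↑ n))
      (≡.trans (≡.sym (T-diagˡ (suc (n ∸ suc m + n)) m))
        (cong (λ k → T k m) (≡.trans (ℕₚ.+-suc m _) (≡.trans (≡.sym (ℕₚ.+-assoc (suc m) (n ∸ suc m) n)) (cong (_+ n) (ℕₚ.m+[n∸m]≡n m<n))))))
      (q↑-weaken (ℕₚ.m≤n+m n (n ∸ suc m)) (T⁺-order (n ∸ suc m + n)))

  Σ[_] : ℕ → (ℕ → PS) → ℕ → PS
  Σ[ zero  ] A i = A i
  Σ[ suc l ] A i = A i ⊕ Σ[ l ] A (suc i)

  -- The weight is 1 only modulo q^(i+1); for small i the term itself has order n - i - 1 and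
  -- supplies the rest.
  T-tl : ∀ n l i → T i n ⊗ tl l i ≋ T i n mod (q ↑ n)
  T-tl n l i with ℕₚ.≤-total n (suc i)
  ... | inj₁ n≤1+i = ≋-respʳ (⊗-identityʳ _) (⊗-≋ ≋-refl (q↑-weaken n≤1+i (tl-≋ l i)))
  ... | inj₂ i<n = ≋-respʳ (⊗-identityʳ _)
    (q↑-weaken (ℕₚ.≤-reflexive (≡.sym (ℕₚ.m∸n+n≡m i<n))) (≋-⊗-order (n ∸ suc i) (suc i)
      (≡.subst (λ t → t ≋ 𝟘 mod (q ↑ (n ∸ suc i)))
        (≡.trans (≡.sym (T-diagʳ (suc (n ∸ suc i)) i)) (cong (T i) (≡.trans (ℕₚ.+-suc i _) (ℕₚ.m+[n∸m]≡n i<n))))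
        (T⁻-order (n ∸ suc i)))
      (tl-≋ l i)))

  weighted-Σ : ∀ n l i → weighted (λ j → T j n) l i ≋ Σ[ l ] (λ j → T j n) i mod (q ↑ n)
  weighted-Σ n zero    i = ≋-refl
  weighted-Σ n (suc l) i = ⊕-≋ (T-tl n (suc l) i) (weighted-Σ n l (suc i))

  Θ : ℕ → PS
  Θ zero    = 𝟙
  Θ (suc n) = Θ n ⊕ (T (suc n) 0 ⊕ T 0 (suc n))

  Σ-last : ∀ A l i → Σ[ suc l ] A i ≈ Σ[ l ] A i ⊕ A (suc (l + i))
  Σ-last A zero    i = refl
  Σ-last A (suc l) i = trans (⊕-congˡ (Σ-last A l (suc i)))
    (trans (solve 3 (λ a b c → a :+ (b :+ c) := a :+ b :+ c) refl _ _ _)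
      (⊕-congˡ (≡.subst (λ m → A (suc (l + suc i)) ≈ A (suc m)) (ℕₚ.+-suc l i) refl)))

  Σ-shift : ∀ n l i → Σ[ l ] (λ j → T j (suc n)) (suc i) ≈ Σ[ l ] (λ j → T j n) i
  Σ-shift n zero    i = refl
  Σ-shift n (suc l) i = ⊕-congˡ (Σ-shift n l (suc i))

  Σ-Θ : ∀ n → Σ[ n + n ] (λ j → T j n) 0 ≈ Θ n
  Σ-Θ zero    = refl
  Σ-Θ (suc n) = begin
    T 0 (suc n) ⊕ Σ[ n + suc n ] (λ j → T j (suc n)) 1  ≈⟨ ⊕-congˡ (Σ-shift n (n + suc n) 0) ⟩
    T 0 (suc n) ⊕ Σ[ n + suc n ] (λ j → T j n) 0        ≈⟨ ⊕-congˡ (≡.subst (λ m → Σ[ m ] (λ j → T j n) 0 ≈ Σ[ suc (n + n) ] (λ j → T j n) 0) (≡.sym (ℕₚ.+-suc n n)) refl) ⟩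
    T 0 (suc n) ⊕ Σ[ suc (n + n) ] (λ j → T j n) 0      ≈⟨ ⊕-congˡ (Σ-last (λ j → T j n) (n + n) 0) ⟩
    T 0 (suc n) ⊕ (Σ[ n + n ] (λ j → T j n) 0 ⊕ T (suc (n + n + 0)) n)  ≈⟨ ⊕-congˡ (+-cong (Σ-Θ n) (≡.subst (λ t → T (suc (n + n + 0)) n ≈ t) last refl)) ⟩
    T 0 (suc n) ⊕ (Θ n ⊕ T (suc n) 0)                   ≈⟨ solve 3 (λ a b c → a :+ (b :+ c) := b :+ (c :+ a)) refl (T 0 (suc n)) (Θ n) (T (suc n) 0) ⟩
    Θ n ⊕ (T (suc n) 0 ⊕ T 0 (suc n))                   ∎
    where
    last : T (suc (n + n + 0)) n ≡ T (suc n) 0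
    last = ≡.trans (cong (λ m → T m n) (≡.trans (cong suc (ℕₚ.+-identityʳ (n + n))) (≡.sym (ℕₚ.+-suc n n)))) (T-diagˡ (suc n) n)

  -- `X∏ (n + n)` clears the denominators of Euler's series for `A∏`, and the n factors of `B∏` move
  -- its window 0 ≤ k ≤ 2n to -n ≤ k ≤ n, where the weights disappear.
  triple-product : ∀ n → X∏ (n + n) ⊗ A∏ n ⊗ B∏ n ≋ Θ n mod (q ↑ n)
  triple-product n = MR.begin
    X∏ (n + n) ⊗ A∏ n ⊗ B∏ n  MR.≈⟨ ≈⇒≋ (trans (⊗-congʳ (⊗-congʳ (sym (tl-∏ (n + n))))) (solve 3 (λ t A B → t :* A :* B := B :* (A :* t)) refl _ _ _)) ⟩
    B∏ n ⊗ (A∏ n ⊗ tl (n + n) 0)                   MR.≈⟨ ⊗-≋ ≋-refl (⊗-≋ ≋-refl (W-∞ n (n + n))) ⟨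
    B∏ n ⊗ (A∏ n ⊗ weighted (W n) (n + n) 0)       MR.≈⟨ ⊗-≋ ≋-refl (q↑-weaken (ℕₚ.m≤m+n n n) (A∏-≋ (n + n) n)) ⟩
    B∏ n ⊗ weighted (W 0) (n + n) 0                MR.≈⟨ ⊗-≋ ≋-refl (≈⇒≋ (W₀ (n + n) 0)) ⟩
    B∏ n ⊗ weighted (λ i → T i 0) (n + n) 0        MR.≈⟨ B∏-≋ n n ℕₚ.≤-refl ⟩
    weighted (λ i → T i n) (n + n) 0               MR.≈⟨ weighted-Σ n (n + n) 0 ⟩
    Σ[ n + n ] (λ i → T i n) 0                     MR.≈⟨ ≈⇒≋ (Σ-Θ n) ⟩
    Θ n                                            MR.∎
    where
    module MR = SetoidReasoning (≋-setoid (q ↑ n))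
    W₀-at : ∀ i → W 0 i ≈ T i 0
    W₀-at i = trans (⊗-congʳ (𝟙-↑ i refl)) (⊗-identityˡ _)
    W₀ : ∀ l i → weighted (W 0) l i ≈ weighted (λ i → T i 0) l i
    W₀ zero    i = W₀-at i
    W₀ (suc l) i = +-cong (⊗-congʳ (W₀-at i)) (W₀ l (suc i))

-- The generating function of `p8`

term : ℕ → Series → ℕ → ℕ → ℕ
term j f i k = if k * j ≤ᵇ i then f (i ∸ k * j) else 0

term-0 : ∀ j f i k → i < k * j → term j f i k ≡ 0
term-0 j f i k i<kj with k * j ≤ᵇ i in eq
... | false = ≡.refl
... | true  = ⊥-elim (ℕₚ.<⇒≱ i<kj (ℕₚ.≤ᵇ⇒≤ (k * j) i (≡.subst Bool.T (≡.sym eq) tt)))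

+-≤ᵇ : ∀ j m n → (j + m ≤ᵇ j + n) ≡ (m ≤ᵇ n)
+-≤ᵇ zero    m n = ≡.refl
+-≤ᵇ (suc j) m n = ≡.trans (lemma (j + m) (j + n)) (+-≤ᵇ j m n)
  where
  lemma : ∀ m n → (m <ᵇ suc n) ≡ (m ≤ᵇ n)
  lemma zero    n = ≡.refl
  lemma (suc m) n = ≡.refl

term-suc : ∀ j f m k → term j f (j + m) (suc k) ≡ term j f m k
term-suc j f m k rewrite +-≤ᵇ j (k * j) m | ℕₚ.[m+n]∸[m+o]≡n∸o j m (k * j) = ≡.refl

sumTo-suc : ∀ m g → sumTo (suc m) g ≡ g 0 + sumTo m (g ∘ suc)
sumTo-suc zero    g = ≡.refl
sumTo-suc (suc m) g = ≡.trans (cong (_+ g (suc (suc m))) (sumTo-suc m g)) (ℕₚ.+-assoc (g 0) _ _)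

sumTo-cong : ∀ m {g h} → (∀ k → g k ≡ h k) → sumTo m g ≡ sumTo m h
sumTo-cong zero    p = p 0
sumTo-cong (suc m) p = cong₂ _+_ (sumTo-cong m p) (p (suc m))

sumTo-extend : ∀ m {g} → (∀ k → m < k → g k ≡ 0) → ∀ l → sumTo (l + m) g ≡ sumTo m g
sumTo-extend m p zero    = ≡.refl
sumTo-extend m p (suc l) = ≡.trans (cong₂ _+_ (sumTo-extend m p l) (p (suc (l + m)) (s≤s (ℕₚ.m≤n+m m l)))) (ℕₚ.+-identityʳ _)

sumTo-0 : ∀ m {g} → (∀ k → g k ≡ 0) → sumTo m g ≡ 0
sumTo-0 zero    p = p 0
sumTo-0 (suc m) p = cong₂ _+_ (sumTo-0 m p) (p (suc m))

divGeom-< : ∀ j f i → i < suc j → divGeom (suc j) f i ≡ f i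
divGeom-< j f zero    i<j = ≡.refl
divGeom-< j f (suc i) i<j = ≡.trans (sumTo-suc i (term (suc j) f (suc i)))
  (≡.trans (cong (λ t → f (suc i) + t) (sumTo-0 i λ k → term-0 (suc j) f (suc i) (suc k) (ℕₚ.≤-trans i<j (ℕₚ.m≤m+n (suc j) _))))
    (ℕₚ.+-identityʳ _))

-- The recurrence g = f + q^(j+1) g: the summand k = 0 splits off and the others shift by one. The
-- remaining sum runs up to j + m, but its summands beyond m are 0.
divGeom-+ : ∀ j f m → divGeom (suc j) f (suc j + m) ≡ f (suc j + m) + divGeom (suc j) f m
divGeom-+ j f m = ≡.trans (sumTo-suc (j + m) (term (suc j) f (suc j + m)))
  (cong (λ t → f (suc j + m) + t)
    (≡.trans (sumTo-cong (j + m) (term-suc (suc j) f m))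
      (sumTo-extend m (λ k m<k → term-0 (suc j) f m k (ℕₚ.≤-trans m<k (ℕₚ.m≤m*n k (suc j)))) j)))

cast : Series → PS
cast f n = + f n

q↑⊗-at : ∀ k f n → (q ↑ k ⊗ f) (k + n) ≡ f n
q↑⊗-at zero    f n = ⊗-identityˡ f .at n
q↑⊗-at (suc k) f n = ≡.trans (⊗-assoc q (q ↑ k) f .at (suc k + n)) (≡.trans (q⊗-suc (q ↑ k ⊗ f) (k + n)) (q↑⊗-at k f n))

F : ℕ → PS
F j = 𝟙 ⊖ q ↑ suc j

F-divGeom : ∀ j f → F j ⊗ cast (divGeom (suc j) f) ≈ cast f
F-divGeom j f = trans (solve 2 (λ Q g → (con (+ 1) :- Q) :* g := g :- Q :* g) refl (q ↑ suc j) g)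
  (pointwise λ n → ≡.trans (⊕-at g _ n) (≡.trans (cong (λ t → g n ℤ.+ t) (⊝-at _ n)) (coefficient n)))
  where
  g = cast (divGeom (suc j) f)
  coefficient : ∀ n → g n ℤ.+ ℤ.- (q ↑ suc j ⊗ g) n ≡ + f n
  coefficient n with ℕₚ.<-≤-connex n (suc j)
  ... | inj₁ n<j = ≡.trans
    (cong₂ (λ u v → u ℤ.+ ℤ.- v) (cong +_ (divGeom-< j f n n<j)) (q↑⊗-below (suc j) g n n<j)) (ℤₚ.+-identityʳ _)
  ... | inj₂ j≤n = ≡.subst (λ n → g n ℤ.+ ℤ.- (q ↑ suc j ⊗ g) n ≡ + f n) (ℕₚ.m+[n∸m]≡n j≤n)
    (≡.trans (cong₂ (λ u v → u ℤ.+ ℤ.- v) (cong +_ (divGeom-+ j f m)) (q↑⊗-at (suc j) g m))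
      (cancel (+ f (suc j + m)) (g m)))
    where
    m = n ∸ suc j
    cancel : ∀ a b → a ℤ.+ b ℤ.+ ℤ.- b ≡ a
    cancel = ℤ-Solver.solve-∀

G : ℕ → PS
G j = cast (divGeom (suc j) one)

F⊗G : ∀ j → F j ⊗ G j ≈ 𝟙
F⊗G j = trans (F-divGeom j one) (pointwise λ { zero → ≡.sym (ι-zero (+ 1)) ; (suc n) → ≡.sym (ι-suc (+ 1) n) })

cast-divGeom : ∀ j f → cast (divGeom (suc j) f) ≈ G j ⊗ cast f
cast-divGeom j f = begin
  g                ≈⟨ trans (sym (⊗-identityˡ g)) (⊗-congʳ (sym (F⊗G j))) ⟩
  F j ⊗ G j ⊗ g    ≈⟨ solve 3 (λ f h g → f :* h :* g := h :* (f :* g)) refl (F j) (G j) g ⟩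
  G j ⊗ (F j ⊗ g)  ≈⟨ ⊗-congˡ (F-divGeom j f) ⟩
  G j ⊗ cast f     ∎
  where g = cast (divGeom (suc j) f)

cast-iter : ∀ j r f → cast (iter r (divGeom (suc j)) f) ≈ G j ↑ r ⊗ cast f
cast-iter j zero    f = sym (⊗-identityˡ _)
cast-iter j (suc r) f = trans (cast-divGeom j _) (trans (⊗-congˡ (cast-iter j r f)) (sym (⊗-assoc _ _ _)))

cast-prod8 : ∀ n → cast (prod8 n) ≈ ∏ G n ↑ 8
cast-prod8 zero    = trans (pointwise λ { zero → ≡.sym (ι-zero (+ 1)) ; (suc n) → ≡.sym (ι-suc (+ 1) n) }) (sym (𝟙-↑ 8 refl))
cast-prod8 (suc n) = begin
  cast (prod8 (suc n))      ≈⟨ cast-iter n 8 (prod8 n) ⟩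
  G n ↑ 8 ⊗ cast (prod8 n)  ≈⟨ ⊗-congˡ (cast-prod8 n) ⟩
  G n ↑ 8 ⊗ ∏ G n ↑ 8       ≈⟨ ⊗-comm _ _ ⟩
  ∏ G n ↑ 8 ⊗ G n ↑ 8       ≈⟨ ↑-⊗ (∏ G n) (G n) 8 ⟨
  (∏ G n ⊗ G n) ↑ 8         ∎

F-≋ : ∀ j → F j ≋ 𝟙 mod (q ↑ suc j)
F-≋ j = quotient (⊝ 𝟙) (solve 1 (λ Q → con (+ 1) :- Q := con (+ 1) :+ Q :* (:- con (+ 1))) refl (q ↑ suc j))

G-≋ : ∀ j → G j ≋ 𝟙 mod (q ↑ suc j)
G-≋ j = quotient (G j) (begin
  G j                                ≈⟨ solve 2 (λ Q g → g := (con (+ 1) :- Q) :* g :+ Q :* g) refl (q ↑ suc j) (G j) ⟩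
  F j ⊗ G j ⊕ q ↑ suc j ⊗ G j        ≈⟨ ⊕-congʳ (F⊗G j) ⟩
  𝟙 ⊕ q ↑ suc j ⊗ G j                ∎)

E P K : PS
E = lim∏ F
P = lim∏ G
K = P ↑ 8

E-≋ : ∀ M {N} → N ≤ suc M → E ≋ ∏ F M mod (q ↑ N)
E-≋ = lim∏-≋ F F-≋

E⊗P : E ⊗ P ≈ 𝟙
E⊗P = ≋-ext λ N → ≋-trans (⊗-≋ (E-≋ N (ℕₚ.n≤1+n N)) (lim∏-≋ G G-≋ N (ℕₚ.n≤1+n N))) (≈⇒≋ (trans (∏-⊗ F G N) (all-𝟙 N)))
  where
  all-𝟙 : ∀ N → ∏ (λ j → F j ⊗ G j) N ≈ 𝟙
  all-𝟙 zero    = refl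
  all-𝟙 (suc N) = trans (*-cong (all-𝟙 N) (F⊗G N)) (⊗-identityˡ 𝟙)

-- `prod8 n` stops at the factor n, and so does coefficient n of `lim∏`.
K-p8 : ∀ n → K n ≡ + p8 n
K-p8 n = ≡.trans (≋-coeff (suc n) (↑-≋ 8 (lim∏-≋ G G-≋ n ℕₚ.≤-refl)) n ℕₚ.≤-refl) (≡.sym (cast-prod8 n .at n))

-- The product E(q) E(-q)

E₂ E₄ P₂ P₄ : PS
E₂ = V E
E₄ = V E₂
P₂ = V P
P₄ = V P₂

V-unit : ∀ {f g} → f ⊗ g ≈ 𝟙 → V f ⊗ V g ≈ 𝟙
V-unit {f} {g} p = trans (sym (V-⊗ f g)) (trans (V-cong p) (V-ι _))

E₂⊗P₂ : E₂ ⊗ P₂ ≈ 𝟙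
E₂⊗P₂ = V-unit E⊗P

E₄⊗P₄ : E₄ ⊗ P₄ ≈ 𝟙
E₄⊗P₄ = V-unit E₂⊗P₂

q↑*2 : ∀ n → q ↑ (n * 2) ≈ (q ⊗ q) ↑ n
q↑*2 zero    = refl
q↑*2 (suc n) = trans (⊗-congˡ (⊗-congˡ (q↑*2 n))) (sym (⊗-assoc _ _ _))

V-q↑ : ∀ n → V (q ↑ n) ≈ (q ⊗ q) ↑ n
V-q↑ n = trans (V-↑ q n) (↑-cong n V-q)

V-⊖ : ∀ f g → V (f ⊖ g) ≈ V f ⊖ V g
V-⊖ f g = trans (V-⊕ f (⊝ g)) (⊕-congˡ (V-⊝ g))

⊖-cong : ∀ {f f′ g g′} → f ≈ f′ → g ≈ g′ → f ⊖ g ≈ f′ ⊖ g′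
⊖-cong p r = +-cong p (-‿cong r)

V-F : ∀ j → V (F j) ≈ 𝟙 ⊖ (q ⊗ q) ↑ suc j
V-F j = trans (V-⊖ _ _) (⊖-cong (V-ι _) (V-q↑ (suc j)))

-- The factors of (q; q²)_∞.
o : ℕ → PS
o j = 𝟙 ⊖ q ⊗ (q ⊗ q) ↑ j

-- Among the first 2n factors, the odd exponents give (q; q²)_n and the even ones give E(q²)
-- truncated at n factors.
∏F-double : ∀ n → ∏ F (n * 2) ≈ ∏ o n ⊗ V (∏ F n)
∏F-double zero    = sym (trans (⊗-identityˡ _) (V-ι _))
∏F-double (suc n) = begin
  ∏ F (n * 2) ⊗ F (n * 2) ⊗ F (suc (n * 2))       ≈⟨ *-cong (*-cong (∏F-double n) (⊖-cong refl (⊗-congˡ (q↑*2 n)))) (⊖-cong refl (q↑*2 (suc n))) ⟩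
  ∏ o n ⊗ V (∏ F n) ⊗ o n ⊗ (𝟙 ⊖ (q ⊗ q) ↑ suc n)  ≈⟨ ⊗-congˡ (V-F n) ⟨
  ∏ o n ⊗ V (∏ F n) ⊗ o n ⊗ V (F n)               ≈⟨ solve 4 (λ a b c d → a :* b :* c :* d := a :* c :* (b :* d)) refl (∏ o n) (V (∏ F n)) (o n) (V (F n)) ⟩
  ∏ o n ⊗ o n ⊗ (V (∏ F n) ⊗ V (F n))             ≈⟨ ⊗-congˡ (V-⊗ _ _) ⟨
  ∏ o n ⊗ o n ⊗ V (∏ F n ⊗ F n)                   ∎

n≤n*2 : ∀ n → n ≤ n * 2
n≤n*2 n = ℕₚ.m≤m*n n 2

∏o-E₂ : ∀ n → ∏ o n ⊗ E₂ ≋ E mod (q ↑ n)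
∏o-E₂ n = ≋-trans (⊗-≋ ≋-refl (V-≋-q↑ n (E-≋ n (ℕₚ.n≤1+n n))))
  (≋-trans (≈⇒≋ (sym (∏F-double n))) (≋-sym (E-≋ (n * 2) (ℕₚ.m≤n⇒m≤1+n (n≤n*2 n)))))

∏o-≋ : ∀ n → ∏ o n ≋ E ⊗ P₂ mod (q ↑ n)
∏o-≋ n = ≋-respˡ (trans (⊗-assoc _ _ _) (trans (⊗-congˡ E₂⊗P₂) (⊗-identityʳ _))) (⊗-≋ (∏o-E₂ n) (≋-refl {P₂}))

σ-q⊗q : σ (q ⊗ q) ≈ q ⊗ q
σ-q⊗q = trans (σ-cong (sym V-q)) (trans (σ-V q) V-q)

-- Pairing (1 - q^(2j+1)) (1 + q^(2j+1)) = 1 - q^(4j+2) turns (q; q²)_∞ (-q; q²)_∞ into (q²; q⁴)_∞ =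
-- E(q²)/E(q⁴); the factors with even exponent are fixed by `σ` and contribute E(q²)².
E⊗σE : E ⊗ σ E ≈ E₂ ↑ 3 ⊗ P₄
E⊗σE = ≋-ext λ N → let module MR = SetoidReasoning (≋-setoid (q ↑ N)) in MR.begin
  E ⊗ σ E                                  MR.≈⟨ ⊗-≋ (∏o-E₂ N) (σ-≋-q↑ N (∏o-E₂ N)) ⟨
  ∏ o N ⊗ E₂ ⊗ σ (∏ o N ⊗ E₂)              MR.≈⟨ ≈⇒≋ (⊗-congˡ (trans (σ-⊗ _ _) (⊗-congˡ (σ-V E)))) ⟩
  ∏ o N ⊗ E₂ ⊗ (σ (∏ o N) ⊗ E₂)            MR.≈⟨ ≈⇒≋ (solve 3 (λ a b c → a :* b :* (c :* b) := a :* c :* (b :* b)) refl (∏ o N) E₂ (σ (∏ o N))) ⟩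
  ∏ o N ⊗ σ (∏ o N) ⊗ (E₂ ⊗ E₂)            MR.≈⟨ ≈⇒≋ (⊗-congʳ (norm N)) ⟩
  V (∏ o N) ⊗ (E₂ ⊗ E₂)                    MR.≈⟨ ⊗-≋ (V-≋-q↑ N (∏o-≋ N)) ≋-refl ⟩
  V (E ⊗ P₂) ⊗ (E₂ ⊗ E₂)                   MR.≈⟨ ≈⇒≋ (trans (⊗-congʳ (V-⊗ _ _)) (solve 2 (λ a b → a :* b :* (a :* a) := a :^ 3 :* b) refl E₂ P₄)) ⟩
  E₂ ↑ 3 ⊗ P₄                              MR.∎
  where
  factor : ∀ j → o j ⊗ σ (o j) ≈ V (o j)
  factor j = begin
    o j ⊗ σ (o j)
      ≈⟨ ⊗-congˡ (trans (σ-⊕ _ _) (+-cong (σ-ι _) (trans (σ-⊝ _) (-‿cong (trans (σ-⊗ _ _) (*-cong σ-q (trans (σ-↑ _ j) (↑-cong j σ-q⊗q)))))))) ⟩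
    o j ⊗ (𝟙 ⊖ ⊝ q ⊗ (q ⊗ q) ↑ j)
      ≈⟨ solve 2 (λ q Q → (con (+ 1) :- q :* Q) :* (con (+ 1) :- (:- q) :* Q) := con (+ 1) :- q :* q :* (Q :* Q)) refl q ((q ⊗ q) ↑ j) ⟩
    𝟙 ⊖ q ⊗ q ⊗ ((q ⊗ q) ↑ j ⊗ (q ⊗ q) ↑ j)
      ≈⟨ ⊖-cong (V-ι _) (trans (V-⊗ _ _) (*-cong V-q (trans (V-↑ _ j) (trans (↑-cong j (trans (V-⊗ q q) (*-cong V-q V-q))) (↑-⊗ _ _ j))))) ⟨
    V 𝟙 ⊖ V (q ⊗ (q ⊗ q) ↑ j)
      ≈⟨ V-⊖ _ _ ⟨
    V (o j) ∎
  norm : ∀ N → ∏ o N ⊗ σ (∏ o N) ≈ V (∏ o N)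
  norm N = trans (⊗-congˡ (σ-∏ o N)) (trans (∏-⊗ o (σ ∘ o) N) (trans (∏-cong factor N) (sym (V-∏ o N))))

-- Theta functions and their products

-- φ⁻ = Σ_k (-1)^k q^{k²} and θ = Σ_k q^{k(k-1)/2}, sums over k ∈ ℤ, given by their product forms.

φ⁻ φ θ : PS
φ⁻ = E ⊗ E ⊗ P₂
φ = σ φ⁻
θ = ι (+ 2) ⊗ (E₂ ⊗ E₂) ⊗ P

module Square = TripleProduct (⊝ q) (⊝ q) q (solve 1 (λ q → (:- q) :* (:- q) := q :* q) refl q)

square-x : Square.x ≈ q ⊗ q
square-x = solve 1 (λ q → (:- q) :* (:- q) := q :* q) refl q

Square-Θ : ∀ n → Square.Θ n ≋ φ⁻ mod (q ↑ n)
Square-Θ n = let module MR = SetoidReasoning (≋-setoid (q ↑ n)) in MR.begin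
  Square.Θ n                                      MR.≈⟨ Square.triple-product n ⟨
  Square.X∏ (n + n) ⊗ Square.A∏ n ⊗ Square.A∏ n   MR.≈⟨ ≈⇒≋ (*-cong (*-cong X≈ A≈) A≈) ⟩
  V (∏ F (n + n)) ⊗ ∏ o n ⊗ ∏ o n                 MR.≈⟨ ⊗-≋ (⊗-≋ (V-≋-q↑ n (E-≋ (n + n) (ℕₚ.m≤n⇒m≤1+n (ℕₚ.m≤m+n n n)))) (≋-sym (∏o-≋ n))) (≋-sym (∏o-≋ n)) ⟨
  E₂ ⊗ (E ⊗ P₂) ⊗ (E ⊗ P₂)                        MR.≈⟨ ≈⇒≋ (solve 3 (λ e e₂ p₂ → e₂ :* (e :* p₂) :* (e :* p₂) := (e₂ :* p₂) :* (e :* e :* p₂)) refl E E₂ P₂) ⟩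
  E₂ ⊗ P₂ ⊗ φ⁻                                    MR.≈⟨ ≈⇒≋ (trans (⊗-congʳ E₂⊗P₂) (⊗-identityˡ _)) ⟩
  φ⁻                                              MR.∎
  where
  X≈ : Square.X∏ (n + n) ≈ V (∏ F (n + n))
  X≈ = trans (∏-cong (λ j → trans (⊖-cong refl (↑-cong (suc j) square-x)) (sym (V-F j))) (n + n)) (sym (V-∏ F (n + n)))
  A≈ : Square.A∏ n ≈ ∏ o n
  A≈ = ∏-cong (λ j → trans (⊕-congˡ (⊗-congˡ (↑-cong j square-x))) (solve 2 (λ q Q → con (+ 1) :+ (:- q) :* Q := con (+ 1) :- q :* Q) refl q ((q ⊗ q) ↑ j))) n

module Triangular = TripleProduct 𝟙 q 𝟙 (⊗-comm 𝟙 q)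

triangular-x : Triangular.x ≈ q
triangular-x = ⊗-identityˡ q

Triangular-Θ : ∀ n → Triangular.Θ n ≋ θ mod (q ↑ n)
Triangular-Θ n = let module MR = SetoidReasoning (≋-setoid (q ↑ n)) in MR.begin
  Triangular.Θ n                                                 MR.≈⟨ Triangular.triple-product n ⟨
  Triangular.X∏ (n + n) ⊗ Triangular.A∏ n ⊗ Triangular.B∏ n      MR.≈⟨ ⊗-≋ (⊗-≋ X≋ (≋-trans A≋ (⊗-≋ ≋-refl B≋))) B≋ ⟩
  E ⊗ (ι (+ 2) ⊗ (E₂ ⊗ P)) ⊗ (E₂ ⊗ P)                            MR.≈⟨ ≈⇒≋ (solve 3 (λ e e₂ p → e :* (con (+ 2) :* (e₂ :* p)) :* (e₂ :* p) := (e :* p) :* (con (+ 2) :* (e₂ :* e₂) :* p)) refl E E₂ P) ⟩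
  E ⊗ P ⊗ θ                                                      MR.≈⟨ ≈⇒≋ (trans (⊗-congʳ E⊗P) (⊗-identityˡ _)) ⟩
  θ                                                              MR.∎
  where
  X≋ : Triangular.X∏ (n + n) ≋ E mod (q ↑ n)
  X≋ = ≋-trans (≈⇒≋ (∏-cong (λ j → ⊖-cong refl (↑-cong (suc j) triangular-x)) (n + n)))
    (≋-sym (E-≋ (n + n) (ℕₚ.m≤n⇒m≤1+n (ℕₚ.m≤m+n n n))))
  -- The factor j = 0 of `A∏` is 1 + 1 = 2; the later ones are the factors of `B∏`.
  double : ∀ m → Triangular.A∏ (suc m) ≈ ι (+ 2) ⊗ Triangular.B∏ m
  double zero    = solve 0 (con (+ 1) :* (con (+ 1) :+ con (+ 1) :* con (+ 1)) := con (+ 2) :* con (+ 1)) refl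
  double (suc m) = trans (*-cong (double m) (⊕-congˡ (trans (⊗-identityˡ _) (⊗-congʳ triangular-x)))) (⊗-assoc _ _ _)
  A≋ : Triangular.A∏ n ≋ ι (+ 2) ⊗ Triangular.B∏ n mod (q ↑ n)
  A≋ = ≋-respʳ (double n) (≋-sym (≋-respʳ (⊗-identityʳ _)
    (⊗-≋ (≋-refl {Triangular.A∏ n}) (≋-⊕0 ≋-refl (≋0-⊗ˡ 𝟙 (Triangular.x↑-order n))))))
  B⊗F : Triangular.B∏ n ⊗ ∏ F n ≈ V (∏ F n)
  B⊗F = trans (∏-⊗ _ F n) (trans (∏-cong factor n) (sym (V-∏ F n)))
    where
    factor : ∀ j → (𝟙 ⊕ q ⊗ Triangular.x ↑ j) ⊗ F j ≈ V (F j)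
    factor j = begin
      (𝟙 ⊕ q ⊗ Triangular.x ↑ j) ⊗ F j   ≈⟨ ⊗-congʳ (⊕-congˡ (⊗-congˡ (↑-cong j triangular-x))) ⟩
      (𝟙 ⊕ q ⊗ q ↑ j) ⊗ (𝟙 ⊖ q ⊗ q ↑ j)  ≈⟨ solve 1 (λ Q → (con (+ 1) :+ Q) :* (con (+ 1) :- Q) := con (+ 1) :- Q :* Q) refl (q ⊗ q ↑ j) ⟩
      𝟙 ⊖ q ↑ suc j ⊗ q ↑ suc j          ≈⟨ ⊖-cong refl (↑-⊗ q q (suc j)) ⟨
      𝟙 ⊖ (q ⊗ q) ↑ suc j                ≈⟨ V-F j ⟨
      V (F j)                            ∎
  B≋ : Triangular.B∏ n ≋ E₂ ⊗ P mod (q ↑ n)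
  B≋ = ≋-respˡ (trans (⊗-assoc _ _ _) (trans (⊗-congˡ E⊗P) (⊗-identityʳ _)))
    (⊗-≋ (≋-trans (⊗-≋ ≋-refl (E-≋ n (ℕₚ.n≤1+n n)))
      (≋-trans (≈⇒≋ B⊗F) (≋-sym (V-≋-q↑ n (E-≋ n (ℕₚ.n≤1+n n)))))) (≋-refl {P}))

-- Euler's pentagonal number theorem

-- With a = -q, b = -q², x = q³ the three products run through the residue classes of exponents
-- modulo 3, and the exponent k(k+1)/2 + 2 k(k-1)/2 is k(3k-1)/2.
module Pentagonal = TripleProduct (⊝ q) (⊝ (q ⊗ q)) (q ⊗ q) (solve 1 (λ q → (:- q) :* (:- (q :* q)) := q :* (q :* q)) refl q)

pentagonal-x↑ : ∀ n → Pentagonal.x ↑ n ≈ q ↑ (n * 3)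
pentagonal-x↑ zero    = refl
pentagonal-x↑ (suc n) = trans (⊗-congˡ (pentagonal-x↑ n)) (solve 2 (λ q Q → (:- q) :* (:- (q :* q)) :* Q := q :* (q :* (q :* Q))) refl q (q ↑ (n * 3)))

Pentagonal-Θ : ∀ n → Pentagonal.Θ n ≋ E mod (q ↑ n)
Pentagonal-Θ n = let module MR = SetoidReasoning (≋-setoid (q ↑ n)) in MR.begin
  Pentagonal.Θ n                                             MR.≈⟨ Pentagonal.triple-product n ⟨
  -- `X∏` is cut back to n factors so that the three products interleave to the first 3n factors of
  -- `E`.
  Pentagonal.X∏ (n + n) ⊗ Pentagonal.A∏ n ⊗ Pentagonal.B∏ n  MR.≈⟨ ⊗-≋ (⊗-≋ (∏-stable _ n (λ j n≤j → ≋-respʳ (solve 0 (con (+ 1) :- con (+ 0) := con (+ 1)) refl) (⊕-≋ ≋-refl (⊝-≋ (q↑-weaken (ℕₚ.m≤n⇒m≤1+n n≤j) (Pentagonal.x↑-order (suc j)))))) n) ≋-refl) ≋-refl ⟩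
  Pentagonal.X∏ n ⊗ Pentagonal.A∏ n ⊗ Pentagonal.B∏ n        MR.≈⟨ ≈⇒≋ (triple n) ⟩
  ∏ F (n * 3)                                                MR.≈⟨ E-≋ (n * 3) (ℕₚ.m≤n⇒m≤1+n (ℕₚ.m≤m*n n 3)) ⟨
  E                                                          MR.∎
  where
  triple : ∀ n → Pentagonal.X∏ n ⊗ Pentagonal.A∏ n ⊗ Pentagonal.B∏ n ≈ ∏ F (n * 3)
  triple zero    = solve 0 (con (+ 1) :* con (+ 1) :* con (+ 1) := con (+ 1)) refl
  triple (suc n) = begin
    X ⊗ (𝟙 ⊖ Pentagonal.x ↑ suc n) ⊗ (A ⊗ (𝟙 ⊕ ⊝ q ⊗ Pentagonal.x ↑ n)) ⊗ (B ⊗ (𝟙 ⊕ ⊝ (q ⊗ q) ⊗ Pentagonal.x ↑ n))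
      ≈⟨ *-cong (*-cong (⊗-congˡ (⊖-cong refl (pentagonal-x↑ (suc n)))) (⊗-congˡ (⊕-congˡ (⊗-congˡ (pentagonal-x↑ n))))) (⊗-congˡ (⊕-congˡ (⊗-congˡ (pentagonal-x↑ n)))) ⟩
    X ⊗ (𝟙 ⊖ q ↑ (suc n * 3)) ⊗ (A ⊗ (𝟙 ⊕ ⊝ q ⊗ Q)) ⊗ (B ⊗ (𝟙 ⊕ ⊝ (q ⊗ q) ⊗ Q))
      ≈⟨ solve 5 (λ X A B q Q → X :* (con (+ 1) :- q :* (q :* (q :* Q))) :* (A :* (con (+ 1) :+ (:- q) :* Q)) :* (B :* (con (+ 1) :+ (:- (q :* q)) :* Q))
           := X :* A :* B :* (con (+ 1) :- q :* Q) :* (con (+ 1) :- q :* (q :* Q)) :* (con (+ 1) :- q :* (q :* (q :* Q)))) refl X A B q Q ⟩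
    X ⊗ A ⊗ B ⊗ F (n * 3) ⊗ F (suc (n * 3)) ⊗ F (suc (suc (n * 3)))
      ≈⟨ ⊗-congʳ (⊗-congʳ (⊗-congʳ (triple n))) ⟩
    ∏ F (suc n * 3) ∎
    where
    X = Pentagonal.X∏ n
    A = Pentagonal.A∏ n
    B = Pentagonal.B∏ n
    Q = q ↑ (n * 3)

q↑-≢ : ∀ N n → ¬ n ≡ N → (q ↑ N) n ≡ + 0
q↑-≢ N n n≢N = ≡.trans (≡.sym (⊗-identityʳ (q ↑ N) .at n)) (coefficient (ℕₚ.<-cmp n N))
  where
  coefficient : Tri (n < N) (n ≡ N) (N < n) → (q ↑ N ⊗ 𝟙) n ≡ + 0
  coefficient (tri< n<N _ _) = q↑⊗-below N 𝟙 n n<N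
  coefficient (tri≈ _ n≡N _) = ⊥-elim (n≢N n≡N)
  coefficient (tri> _ _ N<n) = ≡.subst (λ m → (q ↑ N ⊗ 𝟙) m ≡ + 0)
    (≡.trans (ℕₚ.+-suc N (n ∸ suc N)) (ℕₚ.m+[n∸m]≡n N<n))
    (≡.trans (q↑⊗-at N 𝟙 (suc (n ∸ suc N))) (ι-suc (+ 1) (n ∸ suc N)))

record SignedPower (f : PS) (N : ℕ) : Set where
  constructor signed
  field
    sign     : ℤ
    monomial : f ≈ ι sign ⊗ q ↑ N

signed-≢ : ∀ {f N} → SignedPower f N → ∀ n → ¬ n ≡ N → f n ≡ + 0
signed-≢ {N = N} (signed s p) n n≢N = ≡.trans (p .at n) (≡.trans (ι-⊗ s (q ↑ N) n)
  (≡.trans (cong (s ℤ.*_) (q↑-≢ N n n≢N)) (ℤₚ.*-zeroʳ s)))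

-- k(3k-1)/2 and k(3k+1)/2, given by their increments 3k+1 and 3k+2: these are the exponents of -q
-- x^k and -q² x^k in the recursion of `Pentagonal.T`.
pent⁺ pent⁻ : ℕ → ℕ
pent⁺ zero    = 0
pent⁺ (suc k) = pent⁺ k + (1 + k * 3)
pent⁻ zero    = 0
pent⁻ (suc k) = pent⁻ k + (2 + k * 3)

pent⁺-gen : ∀ k → + (2 * pent⁺ k) ≡ + k ℤ.* (+ 3 ℤ.* + k ℤ.- + 1)
pent⁺-gen zero    = ≡.refl
pent⁺-gen (suc k) = ≡.trans (ℤₚ.pos-* 2 (pent⁺ (suc k)))
  (≡.trans (cong (λ t → + 2 ℤ.* (+ pent⁺ k ℤ.+ (+ 1 ℤ.+ t))) (ℤₚ.pos-* k 3))
    (≡.trans (expand (+ pent⁺ k) (+ k))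
      (≡.trans (cong (λ t → t ℤ.+ + 2 ℤ.* (+ 1 ℤ.+ + k ℤ.* + 3)) (≡.trans (≡.sym (ℤₚ.pos-* 2 (pent⁺ k))) (pent⁺-gen k)))
        (collect (+ k)))))
  where
  expand : ∀ p k → + 2 ℤ.* (p ℤ.+ (+ 1 ℤ.+ k ℤ.* + 3)) ≡ + 2 ℤ.* p ℤ.+ + 2 ℤ.* (+ 1 ℤ.+ k ℤ.* + 3)
  expand = ℤ-Solver.solve-∀
  collect : ∀ k → k ℤ.* (+ 3 ℤ.* k ℤ.- + 1) ℤ.+ + 2 ℤ.* (+ 1 ℤ.+ k ℤ.* + 3) ≡ (+ 1 ℤ.+ k) ℤ.* (+ 3 ℤ.* (+ 1 ℤ.+ k) ℤ.- + 1)
  collect = ℤ-Solver.solve-∀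

pent⁻-gen : ∀ k → + (2 * pent⁻ k) ≡ (ℤ.- + k) ℤ.* (+ 3 ℤ.* (ℤ.- + k) ℤ.- + 1)
pent⁻-gen zero    = ≡.refl
pent⁻-gen (suc k) = ≡.trans (ℤₚ.pos-* 2 (pent⁻ (suc k)))
  (≡.trans (cong (λ t → + 2 ℤ.* (+ pent⁻ k ℤ.+ (+ 2 ℤ.+ t))) (ℤₚ.pos-* k 3))
    (≡.trans (expand (+ pent⁻ k) (+ k))
      (≡.trans (cong (λ t → t ℤ.+ + 2 ℤ.* (+ 2 ℤ.+ + k ℤ.* + 3)) (≡.trans (≡.sym (ℤₚ.pos-* 2 (pent⁻ k))) (pent⁻-gen k)))
        (collect (+ k)))))
  where
  expand : ∀ p k → + 2 ℤ.* (p ℤ.+ (+ 2 ℤ.+ k ℤ.* + 3)) ≡ + 2 ℤ.* p ℤ.+ + 2 ℤ.* (+ 2 ℤ.+ k ℤ.* + 3)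
  expand = ℤ-Solver.solve-∀
  collect : ∀ k → (ℤ.- k) ℤ.* (+ 3 ℤ.* (ℤ.- k) ℤ.- + 1) ℤ.+ + 2 ℤ.* (+ 2 ℤ.+ k ℤ.* + 3) ≡ (ℤ.- (+ 1 ℤ.+ k)) ℤ.* (+ 3 ℤ.* (ℤ.- (+ 1 ℤ.+ k)) ℤ.- + 1)
  collect = ℤ-Solver.solve-∀

Pentagonal-T⁺ : ∀ k → SignedPower (Pentagonal.T k 0) (pent⁺ k)
Pentagonal-T⁺ zero    = signed (+ 1) (sym (⊗-identityˡ 𝟙))
Pentagonal-T⁺ (suc k) with Pentagonal-T⁺ k
... | signed s p = signed (ℤ.- s) (begin
  Pentagonal.T k 0 ⊗ (⊝ q ⊗ Pentagonal.x ↑ k)     ≈⟨ *-cong p (⊗-congˡ (pentagonal-x↑ k)) ⟩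
  ι s ⊗ q ↑ pent⁺ k ⊗ (⊝ q ⊗ q ↑ (k * 3))         ≈⟨ solve 4 (λ s A q B → s :* A :* ((:- q) :* B) := (:- s) :* (A :* (q :* B))) refl (ι s) (q ↑ pent⁺ k) q (q ↑ (k * 3)) ⟩
  ⊝ ι s ⊗ (q ↑ pent⁺ k ⊗ q ↑ (1 + k * 3))         ≈⟨ *-cong (ι-neg s) (↑-+ q (pent⁺ k) (1 + k * 3)) ⟨
  ι (ℤ.- s) ⊗ q ↑ (pent⁺ k + (1 + k * 3))         ∎)

Pentagonal-T⁻ : ∀ k → SignedPower (Pentagonal.T 0 k) (pent⁻ k)
Pentagonal-T⁻ zero    = signed (+ 1) (sym (⊗-identityˡ 𝟙))
Pentagonal-T⁻ (suc k) with Pentagonal-T⁻ k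
... | signed s p = signed (ℤ.- s) (begin
  Pentagonal.T 0 k ⊗ (⊝ (q ⊗ q) ⊗ Pentagonal.x ↑ k)  ≈⟨ *-cong p (⊗-congˡ (pentagonal-x↑ k)) ⟩
  ι s ⊗ q ↑ pent⁻ k ⊗ (⊝ (q ⊗ q) ⊗ q ↑ (k * 3))      ≈⟨ solve 4 (λ s A q B → s :* A :* ((:- (q :* q)) :* B) := (:- s) :* (A :* (q :* (q :* B)))) refl (ι s) (q ↑ pent⁻ k) q (q ↑ (k * 3)) ⟩
  ⊝ ι s ⊗ (q ↑ pent⁻ k ⊗ q ↑ (2 + k * 3))            ≈⟨ *-cong (ι-neg s) (↑-+ q (pent⁻ k) (2 + k * 3)) ⟨
  ι (ℤ.- s) ⊗ q ↑ (pent⁻ k + (2 + k * 3))            ∎)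

E-nonpentagonal : ∀ n → ¬ GenPentagonal n → E n ≡ + 0
E-nonpentagonal n ¬gen = ≡.trans (≡.sym (≋-coeff (suc n) (Pentagonal-Θ (suc n)) n ℕₚ.≤-refl)) (vanish (suc n))
  where
  vanish⁺ : ∀ k → Pentagonal.T k 0 n ≡ + 0
  vanish⁺ k = signed-≢ (Pentagonal-T⁺ k) n λ { ≡.refl → ¬gen (+ k , pent⁺-gen k) }
  vanish⁻ : ∀ k → Pentagonal.T 0 k n ≡ + 0
  vanish⁻ k = signed-≢ (Pentagonal-T⁻ k) n λ { ≡.refl → ¬gen (ℤ.- + k , pent⁻-gen k) }
  vanish : ∀ m → Pentagonal.Θ m n ≡ + 0
  vanish zero    = vanish⁺ 0
  vanish (suc m) = ≡.trans (⊕-at _ _ n) (cong₂ ℤ._+_ (vanish m)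
    (≡.trans (⊕-at _ _ n) (cong₂ ℤ._+_ (vanish⁺ (suc m)) (vanish⁻ (suc m)))))

-- The 2-dissection of φ(-q)

q²↑ : ∀ m → (q ⊗ q) ↑ m ≈ q ↑ m ⊗ q ↑ m
q²↑ = ↑-⊗ q q

V-q↑² : ∀ m → V (q ↑ m) ≈ q ↑ m ⊗ q ↑ m
V-q↑² m = trans (V-q↑ m) (q²↑ m)

square-x↑ : ∀ m → Square.x ↑ m ≈ q ↑ m ⊗ q ↑ m
square-x↑ m = trans (↑-cong m square-x) (q²↑ m)

square-x↑*2 : ∀ m → Square.x ↑ (m * 2) ≈ (q ↑ m) ↑ 4
square-x↑*2 m = begin
  Square.x ↑ (m * 2)              ≈⟨ square-x↑ (m * 2) ⟩
  q ↑ (m * 2) ⊗ q ↑ (m * 2)       ≈⟨ *-cong double double ⟩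
  (A ⊗ A) ⊗ (A ⊗ A)               ≈⟨ solve 1 (λ A → A :* A :* (A :* A) := A :^ 4) refl A ⟩
  A ↑ 4                           ∎
  where
  A = q ↑ m
  double : q ↑ (m * 2) ≈ A ⊗ A
  double = trans (q↑*2 m) (q²↑ m)

s : ℕ → PS
s k = Square.T k 0

Square-T-sym : ∀ k → Square.T 0 k ≡ s k
Square-T-sym zero    = ≡.refl
Square-T-sym (suc k) = cong (λ t → t ⊗ (⊝ q ⊗ Square.x ↑ k)) (Square-T-sym k)

s-+2 : ∀ j X → Square.x ↑ j ≈ X → s (suc (suc j)) ≈ s j ⊗ (q ↑ 4 ⊗ X ⊗ X)
s-+2 j X p = trans (*-cong (⊗-congˡ (⊗-congˡ p)) (⊗-congˡ (*-cong square-x p)))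
  (solve 3 (λ s q X → s :* ((:- q) :* X) :* ((:- q) :* (q :* q :* X)) := s :* (q :^ 4 :* X :* X)) refl (s j) q X)

-- `s k` is (-1)^k q^(k²). Since (2m)² = 4m², two applications of `V` suffice, and `σ` removes the
-- sign because m² and m have the same parity.
s-even : ∀ m → s (m * 2) ≈ V (V (σ (s m)))
s-even zero    = sym (trans (V-cong (trans (V-cong (σ-ι _)) (V-ι _))) (V-ι _))
s-even (suc m) = begin
  s (suc m * 2)                                  ≈⟨ s-+2 (m * 2) (A ↑ 4) (square-x↑*2 m) ⟩
  s (m * 2) ⊗ (q ↑ 4 ⊗ A ↑ 4 ⊗ A ↑ 4)            ≈⟨ *-cong (s-even m) (sym VVσ) ⟩
  V (V (σ (s m))) ⊗ V (V (σ t))                  ≈⟨ trans (V-cong (trans (V-cong (σ-⊗ _ _)) (V-⊗ _ _))) (V-⊗ _ _) ⟨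
  V (V (σ (s (suc m))))                          ∎
  where
  A = q ↑ m
  t = ⊝ q ⊗ Square.x ↑ m
  VVσ : V (V (σ t)) ≈ q ↑ 4 ⊗ A ↑ 4 ⊗ A ↑ 4
  VVσ = begin
    V (V (σ t))             ≈⟨ V-cong (V-cong (trans (σ-⊗ _ _) (*-cong (trans (σ-⊝ q) (-‿cong σ-q)) (trans (σ-cong (trans (square-x↑ m) (sym (V-q↑² m)))) (σ-V A))))) ⟩
    V (V (⊝ ⊝ q ⊗ V A))     ≈⟨ V-cong (V-cong (solve 2 (λ q B → (:- (:- q)) :* B := q :* B) refl q (V A))) ⟩
    V (V (q ⊗ V A))         ≈⟨ V-cong (trans (V-⊗ _ _) (*-cong V-q (V-cong (V-q↑² m)))) ⟩
    V (q ⊗ q ⊗ V (A ⊗ A))   ≈⟨ trans (V-⊗ _ _) (*-cong (trans (V-⊗ q q) (*-cong V-q V-q)) (V-cong (trans (V-⊗ _ _) (*-cong (V-q↑² m) (V-q↑² m))))) ⟩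
    q ⊗ q ⊗ (q ⊗ q) ⊗ V (A ⊗ A ⊗ (A ⊗ A))  ≈⟨ ⊗-congˡ (trans (V-⊗ _ _) (*-cong (trans (V-⊗ _ _) (*-cong (V-q↑² m) (V-q↑² m))) (trans (V-⊗ _ _) (*-cong (V-q↑² m) (V-q↑² m))))) ⟩
    q ⊗ q ⊗ (q ⊗ q) ⊗ (A ⊗ A ⊗ (A ⊗ A) ⊗ (A ⊗ A ⊗ (A ⊗ A)))  ≈⟨ solve 2 (λ q A → q :* q :* (q :* q) :* (A :* A :* (A :* A) :* (A :* A :* (A :* A))) := q :^ 4 :* A :^ 4 :* A :^ 4) refl q A ⟩
    q ↑ 4 ⊗ A ↑ 4 ⊗ A ↑ 4   ∎

V³ : PS → PS
V³ f = V (V (V f))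

V³-⊗ : ∀ f g → V³ (f ⊗ g) ≈ V³ f ⊗ V³ g
V³-⊗ f g = trans (V-cong (trans (V-cong (V-⊗ f g)) (V-⊗ _ _))) (V-⊗ _ _)

V³-⊕ : ∀ f g → V³ (f ⊕ g) ≈ V³ f ⊕ V³ g
V³-⊕ f g = trans (V-cong (trans (V-cong (V-⊕ f g)) (V-⊕ _ _))) (V-⊕ _ _)

V³-q↑ : ∀ n → V³ (q ↑ n) ≈ (q ↑ n) ↑ 8
V³-q↑ n = begin
  V³ A                     ≈⟨ V-cong (V-cong (V-q↑² n)) ⟩
  V (V (A ⊗ A))            ≈⟨ V-cong (trans (V-⊗ _ _) (*-cong (V-q↑² n) (V-q↑² n))) ⟩
  V (A ⊗ A ⊗ (A ⊗ A))      ≈⟨ trans (V-⊗ _ _) (*-cong (trans (V-⊗ _ _) (*-cong (V-q↑² n) (V-q↑² n))) (trans (V-⊗ _ _) (*-cong (V-q↑² n) (V-q↑² n)))) ⟩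
  A ⊗ A ⊗ (A ⊗ A) ⊗ (A ⊗ A ⊗ (A ⊗ A))  ≈⟨ solve 1 (λ A → A :* A :* (A :* A) :* (A :* A :* (A :* A)) := A :^ 8) refl A ⟩
  A ↑ 8                    ∎
  where A = q ↑ n

t : ℕ → PS
t m = Triangular.T 0 m

Triangular-T-sym : ∀ m → Triangular.T (suc m) 0 ≈ t m
Triangular-T-sym zero    = solve 0 (con (+ 1) :* (con (+ 1) :* con (+ 1)) := con (+ 1)) refl
Triangular-T-sym (suc m) = *-cong (Triangular-T-sym m) (trans (⊗-identityˡ _) (⊗-congʳ triangular-x))

-- (2m+1)² = 8 · m(m+1)/2 + 1, and `t m` is q^(m(m+1)/2).
s-odd : ∀ m → s (suc (m * 2)) ≈ ⊝ (q ⊗ V³ (t m))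
s-odd zero    = trans (solve 1 (λ q → con (+ 1) :* ((:- q) :* con (+ 1)) := :- (q :* con (+ 1))) refl q)
  (-‿cong (⊗-congˡ (sym (trans (V-cong (trans (V-cong (V-ι _)) (V-ι _))) (V-ι _)))))
s-odd (suc m) = begin
  s (suc (suc m * 2))                                      ≈⟨ s-+2 (suc (m * 2)) (q ⊗ q ⊗ A ↑ 4) (*-cong square-x (square-x↑*2 m)) ⟩
  s (suc (m * 2)) ⊗ (q ↑ 4 ⊗ (q ⊗ q ⊗ A ↑ 4) ⊗ (q ⊗ q ⊗ A ↑ 4))  ≈⟨ ⊗-congʳ (s-odd m) ⟩
  ⊝ (q ⊗ V³ (t m)) ⊗ (q ↑ 4 ⊗ (q ⊗ q ⊗ A ↑ 4) ⊗ (q ⊗ q ⊗ A ↑ 4))  ≈⟨ solve 3 (λ q A t → (:- (q :* t)) :* (q :^ 4 :* (q :* q :* A :^ 4) :* (q :* q :* A :^ 4)) := :- (q :* (t :* (q :* A) :^ 8))) refl q A (V³ (t m)) ⟩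
  ⊝ (q ⊗ (V³ (t m) ⊗ (q ⊗ A) ↑ 8))                         ≈⟨ -‿cong (⊗-congˡ (⊗-congˡ (V³-q↑ (suc m)))) ⟨
  ⊝ (q ⊗ (V³ (t m) ⊗ V³ (q ⊗ A)))                          ≈⟨ -‿cong (⊗-congˡ (trans (V³-⊗ _ _) (⊗-congˡ (V-cong (V-cong (V-cong (⊗-congˡ (↑-cong m triangular-x)))))))) ⟨
  ⊝ (q ⊗ V³ (t (suc m)))                                   ∎
  where A = q ↑ m

-- The odd k with |k| < 2m give each of `t 0`, ..., `t (m - 1)` twice, whereas `Triangular.Θ m`
-- holds `t m` once in addition; the last summand compensates for it.
Θ-dissection : ∀ m → Square.Θ (m * 2) ≈ V (V (σ (Square.Θ m))) ⊖ q ⊗ V³ (Triangular.Θ m) ⊕ q ⊗ V³ (t m)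
Θ-dissection zero    = trans (solve 2 (λ a b → a := a :- b :+ b) refl 𝟙 (q ⊗ V³ 𝟙))
  (⊕-congʳ (⊕-congʳ (sym (trans (V-cong (trans (V-cong (σ-ι _)) (V-ι _))) (V-ι _)))))
Θ-dissection (suc m) = begin
  Square.Θ (m * 2) ⊕ (s (suc (m * 2)) ⊕ Square.T 0 (suc (m * 2))) ⊕ (s (suc m * 2) ⊕ Square.T 0 (suc m * 2))
    ≈⟨ +-cong (+-cong (Θ-dissection m) (twice (suc (m * 2)) (s-odd m))) (twice (suc m * 2) (s-even (suc m))) ⟩
  Θ₂ ⊖ q ⊗ Θ₃ ⊕ q ⊗ t₀ ⊕ ι (+ 2) ⊗ ⊝ (q ⊗ t₀) ⊕ ι (+ 2) ⊗ s₂
    ≈⟨ solve 6 (λ Θ₂ q Θ₃ t₀ s₂ t₁ → Θ₂ :- q :* Θ₃ :+ q :* t₀ :+ con (+ 2) :* (:- (q :* t₀)) :+ con (+ 2) :* s₂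
         := (Θ₂ :+ con (+ 2) :* s₂) :- q :* (Θ₃ :+ (t₀ :+ t₁)) :+ q :* t₁) refl Θ₂ q Θ₃ t₀ s₂ t₁ ⟩
  (Θ₂ ⊕ ι (+ 2) ⊗ s₂) ⊖ q ⊗ (Θ₃ ⊕ (t₀ ⊕ t₁)) ⊕ q ⊗ t₁
    ≈⟨ ⊕-congʳ (⊖-cong evenΘ (⊗-congˡ oddΘ)) ⟨
  V (V (σ (Square.Θ (suc m)))) ⊖ q ⊗ V³ (Triangular.Θ (suc m)) ⊕ q ⊗ V³ (t (suc m)) ∎
  where
  Θ₂ = V (V (σ (Square.Θ m)))
  Θ₃ = V³ (Triangular.Θ m)
  t₀ = V³ (t m)
  t₁ = V³ (t (suc m))
  s₂ = V (V (σ (s (suc m))))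
  2× : ∀ f → f ⊕ f ≈ ι (+ 2) ⊗ f
  2× = solve 1 (λ f → f :+ f := con (+ 2) :* f) refl
  twice : ∀ k {f} → s k ≈ f → s k ⊕ Square.T 0 k ≈ ι (+ 2) ⊗ f
  twice k p rewrite Square-T-sym k = trans (2× (s k)) (⊗-congˡ p)
  VVσ-⊕ : ∀ f g → V (V (σ (f ⊕ g))) ≈ V (V (σ f)) ⊕ V (V (σ g))
  VVσ-⊕ f g = trans (V-cong (trans (V-cong (σ-⊕ f g)) (V-⊕ _ _))) (V-⊕ _ _)
  evenΘ : V (V (σ (Square.Θ (suc m)))) ≈ Θ₂ ⊕ ι (+ 2) ⊗ s₂
  evenΘ = trans (VVσ-⊕ _ _) (⊕-congˡ (trans (VVσ-⊕ _ _) (≡.subst (λ u → s₂ ⊕ V (V (σ u)) ≈ ι (+ 2) ⊗ s₂) (≡.sym (Square-T-sym (suc m))) (2× s₂))))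
  oddΘ : V³ (Triangular.Θ (suc m)) ≈ Θ₃ ⊕ (t₀ ⊕ t₁)
  oddΘ = trans (V³-⊕ _ _) (⊕-congˡ (trans (V³-⊕ _ _) (⊕-congʳ (V-cong (V-cong (V-cong (Triangular-T-sym m)))))))

φ⁻-dissection : φ⁻ ≈ V (V φ) ⊖ q ⊗ V³ θ
-- `T⁻-order N` bounds `T 0 (suc N)`, hence m = N + 1 makes the correction term vanish modulo q^N.
φ⁻-dissection = ≋-ext λ N → let module MR = SetoidReasoning (≋-setoid (q ↑ N)); m = suc N; N≤m = ℕₚ.n≤1+n N in MR.begin
  φ⁻                                                                          MR.≈⟨ q↑-weaken (ℕₚ.≤-trans N≤m (n≤n*2 m)) (Square-Θ (m * 2)) ⟨
  Square.Θ (m * 2)                                                            MR.≈⟨ ≈⇒≋ (Θ-dissection m) ⟩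
  V (V (σ (Square.Θ m))) ⊖ q ⊗ V³ (Triangular.Θ m) ⊕ q ⊗ V³ (t m)
    MR.≈⟨ ≋-⊕0 (⊕-≋ (V-≋-q↑ N (V-≋-q↑ N (σ-≋-q↑ N (q↑-weaken N≤m (Square-Θ m)))))
                    (⊝-≋ (⊗-≋ ≋-refl (V-≋-q↑ N (V-≋-q↑ N (V-≋-q↑ N (q↑-weaken N≤m (Triangular-Θ m))))))))
               (≋0-⊗ˡ q (V0 N (V0 N (V0 N (Triangular.T⁻-order N))))) ⟩
  V (V φ) ⊖ q ⊗ V³ θ                                                          MR.∎
  where
  V0 : ∀ N {f} → f ≋ 𝟘 mod (q ↑ N) → V f ≋ 𝟘 mod (q ↑ N)
  V0 N p = ≋-respʳ (V-ι _) (V-≋-q↑ N p)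

σ-V⊖qV : ∀ f g → σ (V f ⊖ q ⊗ V g) ≈ V f ⊕ q ⊗ V g
σ-V⊖qV f g = begin
  σ (V f ⊖ q ⊗ V g)        ≈⟨ trans (σ-⊕ _ _) (+-cong (σ-V f) (trans (σ-⊝ _) (-‿cong (trans (σ-⊗ _ _) (*-cong σ-q (σ-V g)))))) ⟩
  V f ⊖ (⊝ q ⊗ V g)        ≈⟨ solve 3 (λ a q b → a :- (:- q) :* b := a :+ q :* b) refl (V f) q (V g) ⟩
  V f ⊕ q ⊗ V g            ∎

φ-dissection : φ ≈ V (V φ) ⊕ q ⊗ V³ θ
φ-dissection = trans (σ-cong φ⁻-dissection) (σ-V⊖qV (V φ) (V (V θ)))

-- Jacobi's quartic identity

-- Identities between eta quotients are proved by letting the solver collect the pairs `E ⊗ P`,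
-- `E₂ ⊗ P₂`, `E₄ ⊗ P₄`, which it treats as products of independent variables, and then removing
-- them.
absorb : ∀ {u f} → u ≈ 𝟙 → u ⊗ f ≈ f
absorb p = trans (⊗-congʳ p) (⊗-identityˡ _)

φ⊗φ⁻ : φ ⊗ φ⁻ ≈ V (φ⁻ ⊗ φ⁻)
φ⊗φ⁻ = begin
  σ (E ⊗ E ⊗ P₂) ⊗ φ⁻                        ≈⟨ ⊗-congʳ (trans (σ-⊗ _ _) (*-cong (σ-⊗ _ _) (σ-V P))) ⟩
  σ E ⊗ σ E ⊗ P₂ ⊗ (E ⊗ E ⊗ P₂)              ≈⟨ solve 3 (λ e f p → f :* f :* p :* (e :* e :* p) := (e :* f) :* (e :* f) :* (p :* p)) refl E (σ E) P₂ ⟩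
  (E ⊗ σ E) ⊗ (E ⊗ σ E) ⊗ (P₂ ⊗ P₂)          ≈⟨ ⊗-congʳ (*-cong E⊗σE E⊗σE) ⟩
  E₂ ↑ 3 ⊗ P₄ ⊗ (E₂ ↑ 3 ⊗ P₄) ⊗ (P₂ ⊗ P₂)    ≈⟨ solve 3 (λ e p₂ p₄ → e :^ 3 :* p₄ :* (e :^ 3 :* p₄) :* (p₂ :* p₂) := (e :* p₂) :* ((e :* p₂) :* (e :* e :* p₄ :* (e :* e :* p₄)))) refl E₂ P₂ P₄ ⟩
  (E₂ ⊗ P₂) ⊗ ((E₂ ⊗ P₂) ⊗ (E₂ ⊗ E₂ ⊗ P₄ ⊗ (E₂ ⊗ E₂ ⊗ P₄)))  ≈⟨ trans (absorb E₂⊗P₂) (absorb E₂⊗P₂) ⟩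
  E₂ ⊗ E₂ ⊗ P₄ ⊗ (E₂ ⊗ E₂ ⊗ P₄)              ≈⟨ *-cong Vφ⁻ Vφ⁻ ⟨
  V φ⁻ ⊗ V φ⁻                                ≈⟨ V-⊗ _ _ ⟨
  V (φ⁻ ⊗ φ⁻)                                ∎
  where
  Vφ⁻ : V φ⁻ ≈ E₂ ⊗ E₂ ⊗ P₄
  Vφ⁻ = trans (V-⊗ _ _) (⊗-congʳ (V-⊗ _ _))

-- After q ↦ q² the left side is φ(q) φ(-q), and the two dissections make this a difference of
-- squares.
φ⁻² : φ⁻ ⊗ φ⁻ ≈ V (φ ⊗ φ) ⊖ q ⊗ V (V θ ⊗ V θ)
φ⁻² = V-injective (begin
  V (φ⁻ ⊗ φ⁻)                                             ≈⟨ φ⊗φ⁻ ⟨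
  φ ⊗ φ⁻                                                  ≈⟨ *-cong φ-dissection φ⁻-dissection ⟩
  (V (V φ) ⊕ q ⊗ V³ θ) ⊗ (V (V φ) ⊖ q ⊗ V³ θ)             ≈⟨ solve 3 (λ a q b → (a :+ q :* b) :* (a :- q :* b) := a :* a :- q :* q :* (b :* b)) refl (V (V φ)) q (V³ θ) ⟩
  V (V φ) ⊗ V (V φ) ⊖ q ⊗ q ⊗ (V³ θ ⊗ V³ θ)               ≈⟨ ⊖-cong (trans (V-cong (V-⊗ _ _)) (V-⊗ _ _)) (trans (V-⊗ _ _) (*-cong V-q (trans (V-cong (V-⊗ _ _)) (V-⊗ _ _)))) ⟨
  V (V (φ ⊗ φ)) ⊖ V (q ⊗ V (V θ ⊗ V θ))                   ≈⟨ V-⊖ _ _ ⟨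
  V (V (φ ⊗ φ) ⊖ q ⊗ V (V θ ⊗ V θ))                       ∎)

φ² : φ ⊗ φ ≈ V (φ ⊗ φ) ⊕ q ⊗ V (V θ ⊗ V θ)
φ² = trans (sym (σ-⊗ φ⁻ φ⁻)) (trans (σ-cong φ⁻²) (σ-V⊖qV _ _))

σE : σ E ≈ E₂ ↑ 3 ⊗ P₄ ⊗ P
σE = begin
  σ E                ≈⟨ absorb E⊗P ⟨
  E ⊗ P ⊗ σ E        ≈⟨ solve 3 (λ e p f → e :* p :* f := e :* f :* p) refl E P (σ E) ⟩
  E ⊗ σ E ⊗ P        ≈⟨ ⊗-congʳ E⊗σE ⟩
  E₂ ↑ 3 ⊗ P₄ ⊗ P    ∎

σP : σ P ≈ P₂ ↑ 3 ⊗ E₄ ⊗ E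
σP = ⊗-cancelˡ (σ E) (σ P) (trans (⊗-comm _ _) σE⊗σP) (begin
  σ E ⊗ σ P                                ≈⟨ σE⊗σP ⟩
  𝟙                                        ≈⟨ 𝟙-↑ 3 E₂⊗P₂ ⟨
  (E₂ ⊗ P₂) ↑ 3                            ≈⟨ trans (absorb E⊗P) (absorb E₄⊗P₄) ⟨
  E ⊗ P ⊗ (E₄ ⊗ P₄ ⊗ (E₂ ⊗ P₂) ↑ 3)        ≈⟨ solve 6 (λ e p e₂ p₂ e₄ p₄ → e :* p :* (e₄ :* p₄ :* (e₂ :* p₂) :^ 3) := e₂ :^ 3 :* p₄ :* p :* (p₂ :^ 3 :* e₄ :* e)) refl E P E₂ P₂ E₄ P₄ ⟩
  E₂ ↑ 3 ⊗ P₄ ⊗ P ⊗ (P₂ ↑ 3 ⊗ E₄ ⊗ E)      ≈⟨ ⊗-congʳ σE ⟨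
  σ E ⊗ (P₂ ↑ 3 ⊗ E₄ ⊗ E)                  ∎)
  where
  σE⊗σP : σ E ⊗ σ P ≈ 𝟙
  σE⊗σP = trans (sym (σ-⊗ E P)) (trans (σ-cong E⊗P) (σ-ι _))

-- The relation between y(q), y(-q) and y(q²)

-- `r` is (-q; q)_∞. The intermediate power `z` has its own name because `y` is z(q²) modulo 8.
r z y : PS
r = E₂ ⊗ P
z = r ↑ 4
y = z ⊗ z

V-r : V r ≈ E₄ ⊗ P₂
V-r = V-⊗ E₂ P

σ-r : σ r ≈ P₂ ↑ 2 ⊗ E₄ ⊗ E
σ-r = begin
  σ r                                 ≈⟨ trans (σ-⊗ _ _) (*-cong (σ-V E) σP) ⟩
  E₂ ⊗ (P₂ ↑ 3 ⊗ E₄ ⊗ E)              ≈⟨ solve 4 (λ e e₂ p₂ e₄ → e₂ :* (p₂ :^ 3 :* e₄ :* e) := e₂ :* p₂ :* (p₂ :^ 2 :* e₄ :* e)) refl E E₂ P₂ E₄ ⟩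
  E₂ ⊗ P₂ ⊗ (P₂ ↑ 2 ⊗ E₄ ⊗ E)         ≈⟨ absorb E₂⊗P₂ ⟩
  P₂ ↑ 2 ⊗ E₄ ⊗ E                     ∎

r⊗σr : r ⊗ σ r ≈ V r
r⊗σr = begin
  r ⊗ σ r                              ≈⟨ ⊗-congˡ σ-r ⟩
  E₂ ⊗ P ⊗ (P₂ ↑ 2 ⊗ E₄ ⊗ E)           ≈⟨ solve 5 (λ e p e₂ p₂ e₄ → e₂ :* p :* (p₂ :^ 2 :* e₄ :* e) := e :* p :* (e₂ :* p₂ :* (e₄ :* p₂))) refl E P E₂ P₂ E₄ ⟩
  E ⊗ P ⊗ (E₂ ⊗ P₂ ⊗ (E₄ ⊗ P₂))        ≈⟨ trans (absorb E⊗P) (absorb E₂⊗P₂) ⟩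
  E₄ ⊗ P₂                              ≈⟨ V-r ⟨
  V r                                  ∎

-- E(q²)³/E(q⁴)² is the factor common to φ(q) = r(q)² κ and φ(-q) = r(-q)² κ. Being a unit, its
-- fourth power can be cancelled from φ(q)⁴ - φ(-q)⁴ to leave y(q) - y(-q).
κ κ⁻¹ : PS
κ   = E₂ ↑ 3 ⊗ P₄ ↑ 2
κ⁻¹ = P₂ ↑ 3 ⊗ E₄ ↑ 2

κ⊗κ⁻¹ : κ ⊗ κ⁻¹ ≈ 𝟙
κ⊗κ⁻¹ = begin
  κ ⊗ κ⁻¹                               ≈⟨ solve 4 (λ e₂ p₂ e₄ p₄ → e₂ :^ 3 :* p₄ :^ 2 :* (p₂ :^ 3 :* e₄ :^ 2) := (e₂ :* p₂) :^ 3 :* (e₄ :* p₄) :^ 2) refl E₂ P₂ E₄ P₄ ⟩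
  (E₂ ⊗ P₂) ↑ 3 ⊗ (E₄ ⊗ P₄) ↑ 2         ≈⟨ trans (absorb (𝟙-↑ 3 E₂⊗P₂)) (𝟙-↑ 2 E₄⊗P₄) ⟩
  𝟙                                     ∎

φ-r : φ ≈ r ↑ 2 ⊗ κ
φ-r = begin
  σ (E ⊗ E ⊗ P₂)                                  ≈⟨ trans (σ-⊗ _ _) (*-cong (trans (σ-⊗ _ _) (*-cong σE σE)) (σ-V P)) ⟩
  E₂ ↑ 3 ⊗ P₄ ⊗ P ⊗ (E₂ ↑ 3 ⊗ P₄ ⊗ P) ⊗ P₂        ≈⟨ solve 4 (λ p e₂ p₂ p₄ → e₂ :^ 3 :* p₄ :* p :* (e₂ :^ 3 :* p₄ :* p) :* p₂ := e₂ :* p₂ :* ((e₂ :* p) :^ 2 :* (e₂ :^ 3 :* p₄ :^ 2))) refl P E₂ P₂ P₄ ⟩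
  E₂ ⊗ P₂ ⊗ (r ↑ 2 ⊗ κ)                           ≈⟨ absorb E₂⊗P₂ ⟩
  r ↑ 2 ⊗ κ                                       ∎

φ⁻-σr : φ⁻ ≈ σ r ↑ 2 ⊗ κ
φ⁻-σr = sym (begin
  σ r ↑ 2 ⊗ κ                                        ≈⟨ ⊗-congʳ (↑-cong 2 σ-r) ⟩
  (P₂ ↑ 2 ⊗ E₄ ⊗ E) ↑ 2 ⊗ (E₂ ↑ 3 ⊗ P₄ ↑ 2)          ≈⟨ solve 5 (λ e e₂ p₂ e₄ p₄ → (p₂ :^ 2 :* e₄ :* e) :^ 2 :* (e₂ :^ 3 :* p₄ :^ 2) := (e₂ :* p₂) :^ 3 :* ((e₄ :* p₄) :^ 2 :* (e :* e :* p₂))) refl E E₂ P₂ E₄ P₄ ⟩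
  (E₂ ⊗ P₂) ↑ 3 ⊗ ((E₄ ⊗ P₄) ↑ 2 ⊗ φ⁻)               ≈⟨ trans (absorb (𝟙-↑ 3 E₂⊗P₂)) (absorb (𝟙-↑ 2 E₄⊗P₄)) ⟩
  φ⁻                                                 ∎)

-- With θ = 2ψ this is the classical φ(q) ψ(q²) = ψ(q)²; it turns the cross term of `φ⁴⊖φ⁻⁴` into an
-- eta quotient.
φ⊗Vθ : φ ⊗ V θ ≈ ι (+ 2) ⊗ (E₂ ↑ 4 ⊗ P ↑ 2)
φ⊗Vθ = begin
  φ ⊗ V θ
    ≈⟨ *-cong φ-r (trans (V-⊗ _ _) (⊗-congʳ (trans (V-⊗ _ _) (*-cong (V-ι _) (V-⊗ _ _))))) ⟩
  (E₂ ⊗ P) ↑ 2 ⊗ (E₂ ↑ 3 ⊗ P₄ ↑ 2) ⊗ (ι (+ 2) ⊗ (E₄ ⊗ E₄) ⊗ P₂)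
    ≈⟨ solve 5 (λ p e₂ p₂ e₄ p₄ → (e₂ :* p) :^ 2 :* (e₂ :^ 3 :* p₄ :^ 2) :* (con (+ 2) :* (e₄ :* e₄) :* p₂) := e₂ :* p₂ :* ((e₄ :* p₄) :^ 2 :* (con (+ 2) :* (e₂ :^ 4 :* p :^ 2)))) refl P E₂ P₂ E₄ P₄ ⟩
  E₂ ⊗ P₂ ⊗ ((E₄ ⊗ P₄) ↑ 2 ⊗ (ι (+ 2) ⊗ (E₂ ↑ 4 ⊗ P ↑ 2)))
    ≈⟨ trans (absorb E₂⊗P₂) (absorb (𝟙-↑ 2 E₄⊗P₄)) ⟩
  ι (+ 2) ⊗ (E₂ ↑ 4 ⊗ P ↑ 2) ∎

Vφ⊗VVθ : V φ ⊗ V (V θ) ≈ ι (+ 2) ⊗ (E₄ ↑ 4 ⊗ P₂ ↑ 2)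
Vφ⊗VVθ = trans (sym (V-⊗ _ _)) (trans (V-cong φ⊗Vθ) (trans (V-⊗ _ _) (*-cong (V-ι _) (trans (V-⊗ _ _) (*-cong (V-↑ E₂ 4) (V-↑ P 2))))))

-- Jacobi's identity θ₃⁴ - θ₄⁴ = θ₂⁴.
φ⁴⊖φ⁻⁴ : (φ ⊗ φ) ↑ 2 ⊖ (φ⁻ ⊗ φ⁻) ↑ 2 ≈ ι (+ 16) ⊗ (q ⊗ (E₄ ↑ 4 ⊗ P₂ ↑ 2) ↑ 2)
φ⁴⊖φ⁻⁴ = begin
  (φ ⊗ φ) ↑ 2 ⊖ (φ⁻ ⊗ φ⁻) ↑ 2
    ≈⟨ ⊖-cong (↑-cong 2 (trans φ² (+-cong (V-⊗ _ _) (⊗-congˡ (V-⊗ _ _))))) (↑-cong 2 (trans φ⁻² (⊖-cong (V-⊗ _ _) (⊗-congˡ (V-⊗ _ _))))) ⟩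
  (a ⊗ a ⊕ q ⊗ (b ⊗ b)) ↑ 2 ⊖ (a ⊗ a ⊖ q ⊗ (b ⊗ b)) ↑ 2
    ≈⟨ solve 3 (λ a q b → (a :* a :+ q :* (b :* b)) :^ 2 :- (a :* a :- q :* (b :* b)) :^ 2 := con (+ 4) :* (q :* (a :* b) :^ 2)) refl a q b ⟩
  ι (+ 4) ⊗ (q ⊗ (a ⊗ b) ↑ 2)
    ≈⟨ ⊗-congˡ (⊗-congˡ (↑-cong 2 Vφ⊗VVθ)) ⟩
  ι (+ 4) ⊗ (q ⊗ (ι (+ 2) ⊗ (E₄ ↑ 4 ⊗ P₂ ↑ 2)) ↑ 2)
    ≈⟨ solve 2 (λ q w → con (+ 4) :* (q :* (con (+ 2) :* w) :^ 2) := con (+ 16) :* (q :* w :^ 2)) refl q (E₄ ↑ 4 ⊗ P₂ ↑ 2) ⟩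
  ι (+ 16) ⊗ (q ⊗ (E₄ ↑ 4 ⊗ P₂ ↑ 2) ↑ 2) ∎
  where
  a = V φ
  b = V (V θ)

σ-y : σ y ≈ σ r ↑ 4 ⊗ σ r ↑ 4
σ-y = trans (σ-⊗ z z) (*-cong (σ-↑ r 4) (σ-↑ r 4))

V-y : V y ≈ V r ↑ 4 ⊗ V r ↑ 4
V-y = trans (V-⊗ z z) (*-cong (V-↑ r 4) (V-↑ r 4))

y⊗σy : y ⊗ σ y ≈ V y
y⊗σy = begin
  y ⊗ σ y                                          ≈⟨ ⊗-congˡ σ-y ⟩
  z ⊗ z ⊗ (σ r ↑ 4 ⊗ σ r ↑ 4)                      ≈⟨ solve 2 (λ z w → z :* z :* (w :* w) := z :* w :* (z :* w)) refl z (σ r ↑ 4) ⟩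
  r ↑ 4 ⊗ σ r ↑ 4 ⊗ (r ↑ 4 ⊗ σ r ↑ 4)              ≈⟨ *-cong lemma lemma ⟩
  V r ↑ 4 ⊗ V r ↑ 4                                ≈⟨ V-y ⟨
  V y                                              ∎
  where
  lemma : r ↑ 4 ⊗ σ r ↑ 4 ≈ V r ↑ 4
  lemma = trans (sym (↑-⊗ r (σ r) 4)) (↑-cong 4 r⊗σr)

y⊖σy : y ⊖ σ y ≈ ι (+ 16) ⊗ (q ⊗ (V y ⊗ V y))
y⊖σy = begin
  y ⊖ σ y                                            ≈⟨ ⊖-cong refl σ-y ⟩
  r ↑ 4 ⊗ r ↑ 4 ⊖ r′ ↑ 4 ⊗ r′ ↑ 4                    ≈⟨ absorb (𝟙-↑ 4 κ⊗κ⁻¹) ⟨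
  (κ ⊗ κ⁻¹) ↑ 4 ⊗ (r ↑ 4 ⊗ r ↑ 4 ⊖ r′ ↑ 4 ⊗ r′ ↑ 4)  ≈⟨ solve 4 (λ r r′ κ d → (κ :* d) :^ 4 :* (r :^ 4 :* r :^ 4 :- r′ :^ 4 :* r′ :^ 4)
                                                           := d :^ 4 :* ((r :^ 2 :* κ :* (r :^ 2 :* κ)) :^ 2 :- (r′ :^ 2 :* κ :* (r′ :^ 2 :* κ)) :^ 2)) refl r r′ κ κ⁻¹ ⟩
  κ⁻¹ ↑ 4 ⊗ ((r ↑ 2 ⊗ κ ⊗ (r ↑ 2 ⊗ κ)) ↑ 2 ⊖ (r′ ↑ 2 ⊗ κ ⊗ (r′ ↑ 2 ⊗ κ)) ↑ 2)
                                                     ≈⟨ ⊗-congˡ (⊖-cong (↑-cong 2 (*-cong φ-r φ-r)) (↑-cong 2 (*-cong φ⁻-σr φ⁻-σr))) ⟨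
  κ⁻¹ ↑ 4 ⊗ ((φ ⊗ φ) ↑ 2 ⊖ (φ⁻ ⊗ φ⁻) ↑ 2)            ≈⟨ ⊗-congˡ φ⁴⊖φ⁻⁴ ⟩
  (P₂ ↑ 3 ⊗ E₄ ↑ 2) ↑ 4 ⊗ (ι (+ 16) ⊗ (q ⊗ (E₄ ↑ 4 ⊗ P₂ ↑ 2) ↑ 2))
                                                     ≈⟨ solve 3 (λ q p e → (p :^ 3 :* e :^ 2) :^ 4 :* (con (+ 16) :* (q :* (e :^ 4 :* p :^ 2) :^ 2))
                                                           := con (+ 16) :* (q :* (((e :* p) :^ 4 :* (e :* p) :^ 4) :* ((e :* p) :^ 4 :* (e :* p) :^ 4)))) refl q P₂ E₄ ⟩
  ι (+ 16) ⊗ (q ⊗ ((R ↑ 4 ⊗ R ↑ 4) ⊗ (R ↑ 4 ⊗ R ↑ 4)))  ≈⟨ ⊗-congˡ (⊗-congˡ (*-cong V-y′ V-y′)) ⟨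
  ι (+ 16) ⊗ (q ⊗ (V y ⊗ V y))                       ∎
  where
  r′ = σ r
  R = E₄ ⊗ P₂
  V-y′ : V y ≈ R ↑ 4 ⊗ R ↑ 4
  V-y′ = trans V-y (*-cong (↑-cong 4 V-r) (↑-cong 4 V-r))

y² : y ⊗ y ≈ V y ⊕ ι (+ 16) ⊗ (q ⊗ (V y ⊗ V y)) ⊗ y
y² = begin
  y ⊗ y                                            ≈⟨ solve 2 (λ y s → y :* y := y :* s :+ (y :- s) :* y) refl y (σ y) ⟩
  y ⊗ σ y ⊕ (y ⊖ σ y) ⊗ y                          ≈⟨ +-cong y⊗σy (⊗-congʳ y⊖σy) ⟩
  V y ⊕ ι (+ 16) ⊗ (q ⊗ (V y ⊗ V y)) ⊗ y           ∎

-- Even and odd parts of powers of y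

ι-cancel : ∀ n {f g} → ι (+ suc n) ⊗ f ≈ ι (+ suc n) ⊗ g → f ≈ g
ι-cancel n {f} {g} p .at m = ℤₚ.*-cancelˡ-≡ (+ suc n) (f m) (g m)
  (≡.trans (≡.sym (ι-⊗ (+ suc n) f m)) (≡.trans (p .at m) (ι-⊗ (+ suc n) g m)))

U′-qV : ∀ f → U′ (q ⊗ V f) ≈ f
U′-qV f = trans (U′-q (V f)) (U-V f)

f⊖σf : ∀ f → f ⊖ σ f ≈ ι (+ 2) ⊗ (q ⊗ V (U′ f))
f⊖σf f = begin
  f ⊖ σ f                                            ≈⟨ ⊖-cong (split f) (σ-cong (trans (split f) (solve 3 (λ a q b → a :+ q :* b := a :- q :* (:- b)) refl (V (U f)) q (V (U′ f))))) ⟩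
  V (U f) ⊕ q ⊗ V (U′ f) ⊖ σ (V (U f) ⊖ q ⊗ ⊝ V (U′ f))  ≈⟨ ⊖-cong refl (trans (σ-cong (⊖-cong refl (⊗-congˡ (sym (V-⊝ _))))) (trans (σ-V⊖qV _ _) (⊕-congˡ (⊗-congˡ (V-⊝ _))))) ⟩
  V (U f) ⊕ q ⊗ V (U′ f) ⊖ (V (U f) ⊕ q ⊗ ⊝ V (U′ f))  ≈⟨ solve 3 (λ a q b → a :+ q :* b :- (a :+ q :* (:- b)) := con (+ 2) :* (q :* b)) refl (V (U f)) q (V (U′ f)) ⟩
  ι (+ 2) ⊗ (q ⊗ V (U′ f))                           ∎

-- y(q) - y(-q) is twice the odd part, and by `y⊖σy` it is also 16 q V(y²). This is the origin of
-- the factor 8 of every odd extraction.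
U′y : U′ y ≈ ι (+ 8) ⊗ (y ⊗ y)
U′y = ι-cancel 1 (begin
  ι (+ 2) ⊗ U′ y                          ≈⟨ ⊗-congˡ (U′-qV _) ⟨
  ι (+ 2) ⊗ U′ (q ⊗ V (U′ y))             ≈⟨ U′-ι⊗ _ _ ⟨
  U′ (ι (+ 2) ⊗ (q ⊗ V (U′ y)))           ≈⟨ U′-cong (f⊖σf y) ⟨
  U′ (y ⊖ σ y)                            ≈⟨ U′-cong (trans y⊖σy (⊗-congˡ (⊗-congˡ (sym (V-⊗ y y))))) ⟩
  U′ (ι (+ 16) ⊗ (q ⊗ V (y ⊗ y)))         ≈⟨ trans (U′-ι⊗ _ _) (⊗-congˡ (U′-qV _)) ⟩
  ι (+ 16) ⊗ (y ⊗ y)                      ≈⟨ solve 1 (λ w → con (+ 16) :* w := con (+ 2) :* (con (+ 8) :* w)) refl (y ⊗ y) ⟩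
  ι (+ 2) ⊗ (ι (+ 8) ⊗ (y ⊗ y))           ∎)

K-V : K ≈ V K ⊗ y
K-V = begin
  P ↑ 8                            ≈⟨ absorb (𝟙-↑ 8 E₂⊗P₂) ⟨
  (E₂ ⊗ P₂) ↑ 8 ⊗ P ↑ 8            ≈⟨ ⊗-congʳ (↑-⊗ E₂ P₂ 8) ⟩
  E₂ ↑ 8 ⊗ P₂ ↑ 8 ⊗ P ↑ 8          ≈⟨ solve 3 (λ a b c → a :* b :* c := b :* (a :* c)) refl (E₂ ↑ 8) (P₂ ↑ 8) (P ↑ 8) ⟩
  P₂ ↑ 8 ⊗ (E₂ ↑ 8 ⊗ P ↑ 8)        ≈⟨ *-cong (V-↑ P 8) (trans (sym (↑-+ r 4 4)) (↑-⊗ E₂ P 8)) ⟨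
  V (P ↑ 8) ⊗ (r ↑ 4 ⊗ r ↑ 4)      ∎

Y : PS
Y = V y

V-Y↑ : ∀ n → V (y ↑ n) ≈ Y ↑ n
V-Y↑ = V-↑ y

V-ι⊗ : ∀ n f {g} → V f ≈ g → V (ι n ⊗ f) ≈ ι n ⊗ g
V-ι⊗ n f p = trans (V-⊗ _ f) (*-cong (V-ι n) p)

V-q⊗ : ∀ f {g} → V f ≈ g → V (q ⊗ f) ≈ q ⊗ q ⊗ g
V-q⊗ f p = trans (V-⊗ q f) (*-cong V-q p)

-- Powers of `y` reduce by `y²` to combinations, over the series in q², of `q` and `y` here and of 1
-- and `q ⊗ y` in `U-form`; `U′y` then gives their parts.
U′-form : ∀ {f} a b → f ≈ q ⊗ V a ⊕ V b ⊗ y → U′ f ≈ a ⊕ b ⊗ (ι (+ 8) ⊗ (y ⊗ y))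
U′-form a b p = trans (U′-cong p) (trans (U′-⊕ _ _) (+-cong (U′-qV a) (trans (U′-V⊗ b y) (⊗-congˡ U′y))))

U-form : ∀ {f} a b → f ≈ V a ⊕ V b ⊗ (q ⊗ y) → U f ≈ a ⊕ b ⊗ (q ⊗ (ι (+ 8) ⊗ (y ⊗ y)))
U-form a b p = trans (U-cong p) (trans (U-⊕ _ _) (+-cong (U-V a) (trans (U-V⊗ b _) (⊗-congˡ (trans (U-q y) (⊗-congˡ U′y))))))

y³-form : y ↑ 3 ≈ ι (+ 16) ⊗ (q ⊗ Y ↑ 3) ⊕ (Y ⊕ ι (+ 256) ⊗ (q ⊗ q ⊗ Y ↑ 4)) ⊗ y
y³-form = begin
  y ↑ 3                                           ≈⟨ solve 1 (λ y → y :^ 3 := y :* y :* y) refl y ⟩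
  y ⊗ y ⊗ y                                       ≈⟨ ⊗-congʳ y² ⟩
  (Y ⊕ ι (+ 16) ⊗ (q ⊗ (Y ⊗ Y)) ⊗ y) ⊗ y          ≈⟨ solve 3 (λ q Y y → (Y :+ con (+ 16) :* (q :* (Y :* Y)) :* y) :* y := Y :* y :+ con (+ 16) :* (q :* (Y :* Y)) :* (y :* y)) refl q Y y ⟩
  Y ⊗ y ⊕ ι (+ 16) ⊗ (q ⊗ (Y ⊗ Y)) ⊗ (y ⊗ y)      ≈⟨ ⊕-congˡ (⊗-congˡ y²) ⟩
  Y ⊗ y ⊕ ι (+ 16) ⊗ (q ⊗ (Y ⊗ Y)) ⊗ (Y ⊕ ι (+ 16) ⊗ (q ⊗ (Y ⊗ Y)) ⊗ y)
    ≈⟨ solve 3 (λ q Y y → Y :* y :+ con (+ 16) :* (q :* (Y :* Y)) :* (Y :+ con (+ 16) :* (q :* (Y :* Y)) :* y)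
         := con (+ 16) :* (q :* Y :^ 3) :+ (Y :+ con (+ 256) :* (q :* q :* Y :^ 4)) :* y) refl q Y y ⟩
  ι (+ 16) ⊗ (q ⊗ Y ↑ 3) ⊕ (Y ⊕ ι (+ 256) ⊗ (q ⊗ q ⊗ Y ↑ 4)) ⊗ y ∎

y⁴-form : y ↑ 4 ≈ (Y ↑ 2 ⊕ ι (+ 256) ⊗ (q ⊗ q ⊗ Y ↑ 5)) ⊕ (ι (+ 32) ⊗ Y ↑ 3 ⊕ ι (+ 4096) ⊗ (q ⊗ q ⊗ Y ↑ 6)) ⊗ (q ⊗ y)
y⁴-form = begin
  y ↑ 4                                                             ≈⟨ solve 1 (λ y → y :^ 4 := (y :* y) :^ 2) refl y ⟩
  (y ⊗ y) ↑ 2                                                       ≈⟨ ↑-cong 2 y² ⟩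
  (Y ⊕ ι (+ 16) ⊗ (q ⊗ (Y ⊗ Y)) ⊗ y) ↑ 2                            ≈⟨ solve 3 (λ q Y y → (Y :+ con (+ 16) :* (q :* (Y :* Y)) :* y) :^ 2
                                                                         := Y :^ 2 :+ con (+ 32) :* Y :^ 3 :* (q :* y) :+ con (+ 256) :* (q :* q :* Y :^ 4) :* (y :* y)) refl q Y y ⟩
  Y ↑ 2 ⊕ ι (+ 32) ⊗ Y ↑ 3 ⊗ (q ⊗ y) ⊕ ι (+ 256) ⊗ (q ⊗ q ⊗ Y ↑ 4) ⊗ (y ⊗ y)  ≈⟨ ⊕-congˡ (⊗-congˡ y²) ⟩
  Y ↑ 2 ⊕ ι (+ 32) ⊗ Y ↑ 3 ⊗ (q ⊗ y) ⊕ ι (+ 256) ⊗ (q ⊗ q ⊗ Y ↑ 4) ⊗ (Y ⊕ ι (+ 16) ⊗ (q ⊗ (Y ⊗ Y)) ⊗ y)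
    ≈⟨ solve 3 (λ q Y y → Y :^ 2 :+ con (+ 32) :* Y :^ 3 :* (q :* y) :+ con (+ 256) :* (q :* q :* Y :^ 4) :* (Y :+ con (+ 16) :* (q :* (Y :* Y)) :* y)
         := (Y :^ 2 :+ con (+ 256) :* (q :* q :* Y :^ 5)) :+ (con (+ 32) :* Y :^ 3 :+ con (+ 4096) :* (q :* q :* Y :^ 6)) :* (q :* y)) refl q Y y ⟩
  (Y ↑ 2 ⊕ ι (+ 256) ⊗ (q ⊗ q ⊗ Y ↑ 5)) ⊕ (ι (+ 32) ⊗ Y ↑ 3 ⊕ ι (+ 4096) ⊗ (q ⊗ q ⊗ Y ↑ 6)) ⊗ (q ⊗ y) ∎

-- 128 is the largest scale for which all images below have integer coefficients in `X`: U(y⁴) = y²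
-- (1 + 512 q y³ + 32768 q² y⁶) with 32768 = 2 · 128². It is also the 2⁷ that the modulus 2^(3α+10)
-- demands beyond 8^(α+1).
X : PS
X = ι (+ 128) ⊗ (q ⊗ y ↑ 3)

V-X : V X ≈ ι (+ 128) ⊗ (q ⊗ q ⊗ Y ↑ 3)
V-X = V-ι⊗ (+ 128) (q ⊗ y ↑ 3) (V-q⊗ (y ↑ 3) (V-Y↑ 3))

U′y³ : U′ (y ↑ 3) ≈ ι (+ 8) ⊗ y ↑ 3 ⊗ (ι (+ 3) ⊕ ι (+ 2) ⊗ X)
U′y³ = trans (U′-form (ι (+ 16) ⊗ y ↑ 3) (y ⊕ ι (+ 256) ⊗ (q ⊗ y ↑ 4)) (begin
  y ↑ 3                                                                                    ≈⟨ y³-form ⟩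
  ι (+ 16) ⊗ (q ⊗ Y ↑ 3) ⊕ (Y ⊕ ι (+ 256) ⊗ (q ⊗ q ⊗ Y ↑ 4)) ⊗ y                           ≈⟨ ⊕-congʳ (solve 2 (λ q Y → con (+ 16) :* (q :* Y) := q :* (con (+ 16) :* Y)) refl q (Y ↑ 3)) ⟩
  q ⊗ (ι (+ 16) ⊗ Y ↑ 3) ⊕ (Y ⊕ ι (+ 256) ⊗ (q ⊗ q ⊗ Y ↑ 4)) ⊗ y                           ≈⟨ +-cong (⊗-congˡ (V-ι⊗ (+ 16) _ (V-Y↑ 3))) (⊗-congʳ (trans (V-⊕ _ _) (⊕-congˡ (V-ι⊗ (+ 256) (q ⊗ y ↑ 4) (V-q⊗ (y ↑ 4) (V-Y↑ 4)))))) ⟨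
  q ⊗ V (ι (+ 16) ⊗ y ↑ 3) ⊕ V (y ⊕ ι (+ 256) ⊗ (q ⊗ y ↑ 4)) ⊗ y                           ∎))
  (solve 2 (λ q y → con (+ 16) :* y :^ 3 :+ (y :+ con (+ 256) :* (q :* y :^ 4)) :* (con (+ 8) :* (y :* y))
    := con (+ 8) :* y :^ 3 :* (con (+ 3) :+ con (+ 2) :* (con (+ 128) :* (q :* y :^ 3)))) refl q y)

X₄ : PS
X₄ = 𝟙 ⊕ ι (+ 4) ⊗ X ⊕ ι (+ 2) ⊗ (X ⊗ X)

Uy⁴ : U (y ↑ 4) ≈ y ↑ 2 ⊗ X₄
Uy⁴ = trans (U-form (y ↑ 2 ⊕ ι (+ 256) ⊗ (q ⊗ y ↑ 5)) (ι (+ 32) ⊗ y ↑ 3 ⊕ ι (+ 4096) ⊗ (q ⊗ y ↑ 6))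
  (trans y⁴-form (sym (+-cong
    (trans (V-⊕ _ _) (+-cong (V-Y↑ 2) (V-ι⊗ (+ 256) (q ⊗ y ↑ 5) (V-q⊗ (y ↑ 5) (V-Y↑ 5)))))
    (⊗-congʳ (trans (V-⊕ _ _) (+-cong (V-ι⊗ (+ 32) (y ↑ 3) (V-Y↑ 3)) (V-ι⊗ (+ 4096) (q ⊗ y ↑ 6) (V-q⊗ (y ↑ 6) (V-Y↑ 6))))))))))
  (solve 2 (λ q y → y :^ 2 :+ con (+ 256) :* (q :* y :^ 5) :+ (con (+ 32) :* y :^ 3 :+ con (+ 4096) :* (q :* y :^ 6)) :* (q :* (con (+ 8) :* (y :* y)))
    := (let x = con (+ 128) :* (q :* y :^ 3) in y :^ 2 :* (con (+ 1) :+ con (+ 4) :* x :+ con (+ 2) :* (x :* x)))) refl q y)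

-- Chosen so that q V(y³ X₆) = y(q)³ - y(-q)³, which is D³ + 3 y(q²) D with D = 16 q y(q²)².
X₆ : PS
X₆ = ι (+ 48) ⊕ ι (+ 32) ⊗ X

V-X₆ : V (y ↑ 3 ⊗ X₆) ≈ ι (+ 48) ⊗ Y ↑ 3 ⊕ ι (+ 4096) ⊗ (q ⊗ q ⊗ Y ↑ 6)
V-X₆ = begin
  V (y ↑ 3 ⊗ X₆)                                                    ≈⟨ trans (V-⊗ _ _) (*-cong (V-Y↑ 3) (trans (V-⊕ _ _) (+-cong (V-ι _) (V-ι⊗ (+ 32) X V-X)))) ⟩
  Y ↑ 3 ⊗ (ι (+ 48) ⊕ ι (+ 32) ⊗ (ι (+ 128) ⊗ (q ⊗ q ⊗ Y ↑ 3)))      ≈⟨ solve 2 (λ q Y → Y :^ 3 :* (con (+ 48) :+ con (+ 32) :* (con (+ 128) :* (q :* q :* Y :^ 3))) := con (+ 48) :* Y :^ 3 :+ con (+ 4096) :* (q :* q :* Y :^ 6)) refl q Y ⟩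
  ι (+ 48) ⊗ Y ↑ 3 ⊕ ι (+ 4096) ⊗ (q ⊗ q ⊗ Y ↑ 6)                    ∎

-- y³ and -σ(y)³ are the roots of a quadratic equation over the series in q².
y⁶ : y ↑ 6 ≈ V (y ↑ 3) ⊕ V (y ↑ 3 ⊗ X₆) ⊗ (q ⊗ y ↑ 3)
y⁶ = begin
  y ↑ 6
    ≈⟨ solve 2 (λ y s → y :^ 6 := (y :* s) :^ 3 :+ ((y :- s) :^ 3 :+ con (+ 3) :* (y :* s) :* (y :- s)) :* y :^ 3) refl y (σ y) ⟩
  (y ⊗ σ y) ↑ 3 ⊕ ((y ⊖ σ y) ↑ 3 ⊕ ι (+ 3) ⊗ (y ⊗ σ y) ⊗ (y ⊖ σ y)) ⊗ y ↑ 3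
    ≈⟨ +-cong (↑-cong 3 y⊗σy) (⊗-congʳ (+-cong (↑-cong 3 y⊖σy) (*-cong (⊗-congˡ y⊗σy) y⊖σy))) ⟩
  Y ↑ 3 ⊕ (D ↑ 3 ⊕ ι (+ 3) ⊗ Y ⊗ D) ⊗ y ↑ 3
    ≈⟨ ⊕-congˡ (solve 3 (λ q Y w → (let D = con (+ 16) :* (q :* (Y :* Y)) in (D :^ 3 :+ con (+ 3) :* Y :* D) :* w)
         := (con (+ 48) :* Y :^ 3 :+ con (+ 4096) :* (q :* q :* Y :^ 6)) :* (q :* w)) refl q Y (y ↑ 3)) ⟩
  Y ↑ 3 ⊕ (ι (+ 48) ⊗ Y ↑ 3 ⊕ ι (+ 4096) ⊗ (q ⊗ q ⊗ Y ↑ 6)) ⊗ (q ⊗ y ↑ 3)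
    ≈⟨ +-cong (V-Y↑ 3) (⊗-congʳ V-X₆) ⟨
  V (y ↑ 3) ⊕ V (y ↑ 3 ⊗ X₆) ⊗ (q ⊗ y ↑ 3) ∎
  where D = ι (+ 16) ⊗ (q ⊗ (Y ⊗ Y))

-- The relation `y⁶` scaled by 128² q². Both coefficients are polynomials in `V X` over ℤ, so ℤ[X]
-- is spanned by 1 and `X` over ℤ[V X].
X² : X ⊗ X ≈ V (X ⊗ X₆) ⊗ X ⊕ V (ι (+ 128) ⊗ X)
X² = begin
  X ⊗ X
    ≈⟨ solve 2 (λ q y → con (+ 128) :* (q :* y :^ 3) :* (con (+ 128) :* (q :* y :^ 3)) := con (+ 16384) :* (q :* q :* y :^ 6)) refl q y ⟩
  ι (+ 16384) ⊗ (q ⊗ q ⊗ y ↑ 6)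
    ≈⟨ ⊗-congˡ (⊗-congˡ (trans y⁶ (+-cong (V-Y↑ 3) (⊗-congʳ (V-⊗ _ _))))) ⟩
  ι (+ 16384) ⊗ (q ⊗ q ⊗ (Y ↑ 3 ⊕ V (y ↑ 3) ⊗ V X₆ ⊗ (q ⊗ y ↑ 3)))
    ≈⟨ ⊗-congˡ (⊗-congˡ (⊕-congˡ (⊗-congʳ (⊗-congʳ (V-Y↑ 3))))) ⟩
  ι (+ 16384) ⊗ (q ⊗ q ⊗ (Y ↑ 3 ⊕ Y ↑ 3 ⊗ V X₆ ⊗ (q ⊗ y ↑ 3)))
    ≈⟨ solve 4 (λ q Y w v → con (+ 16384) :* (q :* q :* (Y :+ Y :* v :* (q :* w)))
         := con (+ 128) :* (q :* q :* Y) :* v :* (con (+ 128) :* (q :* w)) :+ con (+ 128) :* (con (+ 128) :* (q :* q :* Y))) refl q (Y ↑ 3) (y ↑ 3) (V X₆) ⟩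
  ι (+ 128) ⊗ (q ⊗ q ⊗ Y ↑ 3) ⊗ V X₆ ⊗ X ⊕ ι (+ 128) ⊗ (ι (+ 128) ⊗ (q ⊗ q ⊗ Y ↑ 3))
    ≈⟨ +-cong (⊗-congʳ (trans (V-⊗ _ _) (⊗-congʳ V-X))) (V-ι⊗ (+ 128) X V-X) ⟨
  V (X ⊗ X₆) ⊗ X ⊕ V (ι (+ 128) ⊗ X) ∎

U′Xy³ : U′ (X ⊗ y ↑ 3) ≈ ι (+ 8) ⊗ y ↑ 3 ⊗ (ι (+ 16) ⊕ X ⊗ (X₆ ⊗ (ι (+ 3) ⊕ ι (+ 2) ⊗ X)))
U′Xy³ = begin
  U′ (X ⊗ y ↑ 3)
    ≈⟨ U′-cong (solve 2 (λ q y → con (+ 128) :* (q :* y :^ 3) :* y :^ 3 := con (+ 128) :* (q :* y :^ 6)) refl q y) ⟩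
  U′ (ι (+ 128) ⊗ (q ⊗ y ↑ 6))
    ≈⟨ trans (U′-ι⊗ _ _) (⊗-congˡ (trans (U′-q _) (U-cong y⁶))) ⟩
  ι (+ 128) ⊗ U (V (y ↑ 3) ⊕ V (y ↑ 3 ⊗ X₆) ⊗ (q ⊗ y ↑ 3))
    ≈⟨ ⊗-congˡ (trans (U-⊕ _ _) (+-cong (U-V _) (trans (U-V⊗ _ _) (⊗-congˡ (trans (U-q _) (⊗-congˡ U′y³)))))) ⟩
  ι (+ 128) ⊗ (y ↑ 3 ⊕ y ↑ 3 ⊗ X₆ ⊗ (q ⊗ (ι (+ 8) ⊗ y ↑ 3 ⊗ (ι (+ 3) ⊕ ι (+ 2) ⊗ X))))
    ≈⟨ solve 4 (λ q w v u → con (+ 128) :* (w :+ w :* v :* (q :* (con (+ 8) :* w :* u)))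
         := con (+ 8) :* w :* (con (+ 16) :+ con (+ 128) :* (q :* w) :* (v :* u))) refl q (y ↑ 3) X₆ (ι (+ 3) ⊕ ι (+ 2) ⊗ X) ⟩
  ι (+ 8) ⊗ y ↑ 3 ⊗ (ι (+ 16) ⊕ X ⊗ (X₆ ⊗ (ι (+ 3) ⊕ ι (+ 2) ⊗ X))) ∎

UXy⁴ : U (X ⊗ y ↑ 4) ≈ y ↑ 2 ⊗ (X ⊗ (ι (+ 8) ⊕ X₆ ⊗ X₄))
UXy⁴ = begin
  U (X ⊗ y ↑ 4)
    ≈⟨ U-cong (solve 2 (λ q y → con (+ 128) :* (q :* y :^ 3) :* y :^ 4 := con (+ 128) :* (q :* (y :^ 6 :* y))) refl q y) ⟩
  U (ι (+ 128) ⊗ (q ⊗ (y ↑ 6 ⊗ y)))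
    ≈⟨ trans (U-ι⊗ _ _) (⊗-congˡ (trans (U-q _) (⊗-congˡ (U′-cong (⊗-congʳ y⁶))))) ⟩
  ι (+ 128) ⊗ (q ⊗ U′ ((V (y ↑ 3) ⊕ V (y ↑ 3 ⊗ X₆) ⊗ (q ⊗ y ↑ 3)) ⊗ y))
    ≈⟨ ⊗-congˡ (⊗-congˡ (U′-cong (solve 4 (λ a b q y → (a :+ b :* (q :* y :^ 3)) :* y := a :* y :+ b :* (q :* y :^ 4)) refl (V (y ↑ 3)) (V (y ↑ 3 ⊗ X₆)) q y))) ⟩
  ι (+ 128) ⊗ (q ⊗ U′ (V (y ↑ 3) ⊗ y ⊕ V (y ↑ 3 ⊗ X₆) ⊗ (q ⊗ y ↑ 4)))
    ≈⟨ ⊗-congˡ (⊗-congˡ (trans (U′-⊕ _ _) (+-cong (trans (U′-V⊗ _ _) (⊗-congˡ U′y)) (trans (U′-V⊗ _ _) (⊗-congˡ (trans (U′-q _) Uy⁴)))))) ⟩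
  ι (+ 128) ⊗ (q ⊗ (y ↑ 3 ⊗ (ι (+ 8) ⊗ (y ⊗ y)) ⊕ y ↑ 3 ⊗ X₆ ⊗ (y ↑ 2 ⊗ X₄)))
    ≈⟨ solve 4 (λ q y v u → con (+ 128) :* (q :* (y :^ 3 :* (con (+ 8) :* (y :* y)) :+ y :^ 3 :* v :* (y :^ 2 :* u)))
         := y :^ 2 :* (con (+ 128) :* (q :* y :^ 3) :* (con (+ 8) :+ v :* u))) refl q y X₆ X₄ ⟩
  y ↑ 2 ⊗ (X ⊗ (ι (+ 8) ⊕ X₆ ⊗ X₄)) ∎

-- The ring ℤ[X] and its stability under extraction

-- A Horner scheme witnessing that the series `f` lies in ℤ[X]. The constant coefficient stands
-- outermost, so the residue modulo 128 can be read off directly.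
data Pol (f : PS) : Set where
  nil  : f ≈ 𝟘 → Pol f
  cons : ∀ c {g} → Pol g → f ≈ ι c ⊕ X ⊗ g → Pol f

Pol-resp : ∀ {f g} → f ≈ g → Pol f → Pol g
Pol-resp e (nil p)      = nil (trans (sym e) p)
Pol-resp e (cons c G p) = cons c G (trans (sym e) p)

Pol-ι : ∀ c → Pol (ι c)
Pol-ι c = cons c (nil refl) (solve 2 (λ c X → c := c :+ X :* con (+ 0)) refl (ι c) X)

Pol-X⊗ : ∀ {f} → Pol f → Pol (X ⊗ f)
Pol-X⊗ F = cons (+ 0) F (sym (⊕-identityˡ _))

Pol-X : Pol X
Pol-X = Pol-resp (⊗-identityʳ X) (Pol-X⊗ (Pol-ι (+ 1)))

Pol-⊕ : ∀ {f g} → Pol f → Pol g → Pol (f ⊕ g)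
Pol-⊕ (nil p) G = Pol-resp (sym (trans (⊕-congʳ p) (⊕-identityˡ _))) G
Pol-⊕ F@(cons _ _ _) (nil p) = Pol-resp (sym (trans (⊕-congˡ p) (⊕-identityʳ _))) F
Pol-⊕ (cons c {f} F p) (cons d {g} G r) = cons (c ℤ.+ d) (Pol-⊕ F G) (trans (+-cong p r)
  (trans (solve 5 (λ c d X f g → (c :+ X :* f) :+ (d :+ X :* g) := c :+ d :+ X :* (f :+ g)) refl (ι c) (ι d) X f g) (⊕-congʳ (sym (ι-+ c d)))))

Pol-ι⊗ : ∀ c {f} → Pol f → Pol (ι c ⊗ f)
Pol-ι⊗ c (nil p) = nil (trans (⊗-congˡ p) (⊗-zeroʳ _))
Pol-ι⊗ c (cons d {f} F p) = cons (c ℤ.* d) (Pol-ι⊗ c F) (trans (⊗-congˡ p)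
  (trans (solve 4 (λ c d X f → c :* (d :+ X :* f) := c :* d :+ X :* (c :* f)) refl (ι c) (ι d) X f) (⊕-congʳ (sym (ι-* c d)))))

Pol-⊗ : ∀ {f g} → Pol f → Pol g → Pol (f ⊗ g)
Pol-⊗ (nil p) G = nil (trans (⊗-congʳ p) (⊗-zeroˡ _))
Pol-⊗ {g = g} (cons c {f} F p) G = Pol-resp
  (trans (solve 4 (λ c X f g → c :* g :+ X :* (f :* g) := (c :+ X :* f) :* g) refl (ι c) X f g) (⊗-congʳ (sym p)))
  (Pol-⊕ (Pol-ι⊗ c G) (Pol-X⊗ (Pol-⊗ F G)))

Pol-X₆ : Pol X₆
Pol-X₆ = Pol-⊕ (Pol-ι _) (Pol-ι⊗ _ Pol-X)

Pol-X₄ : Pol X₄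
Pol-X₄ = Pol-⊕ (Pol-⊕ (Pol-ι _) (Pol-ι⊗ _ Pol-X)) (Pol-ι⊗ _ (Pol-X⊗ Pol-X))

-- By X², if L sends p·g₀ and X·p·g₀ into t₀·ℤ[X] then also X²·p·g₀: the two base cases 1 and X suffice.

module Descent
  (L : PS → PS) (L-cong : ∀ {f g} → f ≈ g → L f ≈ L g) (L-⊕ : ∀ f g → L (f ⊕ g) ≈ L f ⊕ L g)
  (L-V⊗ : ∀ f g → L (V f ⊗ g) ≈ f ⊗ L g) (g₀ t₀ : PS) where

  record Good (f : PS) : Set where
    constructor good
    field
      {image} : PS
      pol     : Pol image
      L-image : L (f ⊗ g₀) ≈ t₀ ⊗ image

  Good-resp : ∀ {f g} → f ≈ g → Good f → Good g
  Good-resp e (good F p) = good F (trans (L-cong (⊗-congʳ (sym e))) p)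

  Good-⊕ : ∀ {f g} → Good f → Good g → Good (f ⊕ g)
  Good-⊕ {f} {g} (good {f′} F p) (good {g′} G r) = good (Pol-⊕ F G) (begin
    L ((f ⊕ g) ⊗ g₀)          ≈⟨ L-cong (solve 3 (λ f g h → (f :+ g) :* h := f :* h :+ g :* h) refl f g g₀) ⟩
    L (f ⊗ g₀ ⊕ g ⊗ g₀)       ≈⟨ trans (L-⊕ _ _) (+-cong p r) ⟩
    t₀ ⊗ f′ ⊕ t₀ ⊗ g′         ≈⟨ solve 3 (λ t f g → t :* f :+ t :* g := t :* (f :+ g)) refl t₀ f′ g′ ⟩
    t₀ ⊗ (f′ ⊕ g′)            ∎)

  Good-V⊗ : ∀ {f g} → Pol f → Good g → Good (V f ⊗ g)
  Good-V⊗ {f} {g} F (good {g′} G r) = good (Pol-⊗ F G) (begin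
    L (V f ⊗ g ⊗ g₀)    ≈⟨ trans (L-cong (⊗-assoc _ _ _)) (L-V⊗ _ _) ⟩
    f ⊗ L (g ⊗ g₀)      ≈⟨ ⊗-congˡ r ⟩
    f ⊗ (t₀ ⊗ g′)       ≈⟨ solve 3 (λ f t g → f :* (t :* g) := t :* (f :* g)) refl f t₀ g′ ⟩
    t₀ ⊗ (f ⊗ g′)       ∎)

  Good-ι⊗ : ∀ c {g} → Good g → Good (ι c ⊗ g)
  Good-ι⊗ c G = Good-resp (⊗-congʳ (V-ι c)) (Good-V⊗ (Pol-ι c) G)

  module _ (good-𝟙 : Good 𝟙) (good-X : Good X) where

    -- The induction must carry both halves: X (c + X g) contains X² g, which reduces to `X ⊗ g` and
    -- `g`.
    descent² : ∀ {f} → Pol f → Good f × Good (X ⊗ f)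
    descent² {f} (nil p) =
      Good-resp (trans (⊗-zeroˡ _) (sym p)) (Good-ι⊗ (+ 0) good-𝟙) ,
      Good-resp (trans (⊗-zeroˡ _) (sym (trans (⊗-congˡ p) (⊗-zeroʳ _)))) (Good-ι⊗ (+ 0) good-𝟙)
    descent² {f} (cons c {g} G p) with descent² G
    ... | g-good , Xg-good =
      Good-resp (trans (⊕-congʳ (⊗-identityʳ _)) (sym p)) (Good-⊕ (Good-ι⊗ c good-𝟙) Xg-good) ,
      Good-resp (begin
        ι c ⊗ X ⊕ (V (X ⊗ X₆) ⊗ (X ⊗ g) ⊕ V (ι (+ 128) ⊗ X) ⊗ g)  ≈⟨ solve 5 (λ c X g a b → c :* X :+ (a :* (X :* g) :+ b :* g) := c :* X :+ (a :* X :+ b) :* g) refl (ι c) X g (V (X ⊗ X₆)) (V (ι (+ 128) ⊗ X)) ⟩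
        ι c ⊗ X ⊕ (V (X ⊗ X₆) ⊗ X ⊕ V (ι (+ 128) ⊗ X)) ⊗ g        ≈⟨ ⊕-congˡ (⊗-congʳ X²) ⟨
        ι c ⊗ X ⊕ X ⊗ X ⊗ g                                       ≈⟨ solve 3 (λ c X g → c :* X :+ X :* X :* g := X :* (c :+ X :* g)) refl (ι c) X g ⟩
        X ⊗ (ι c ⊕ X ⊗ g)                                         ≈⟨ ⊗-congˡ p ⟨
        X ⊗ f                                                     ∎)
        (Good-⊕ (Good-ι⊗ c good-X) (Good-⊕ (Good-V⊗ (Pol-X⊗ Pol-X₆) Xg-good) (Good-V⊗ (Pol-ι⊗ (+ 128) Pol-X) g-good)))

    descent : ∀ {f} → Pol f → Good f
    descent F = proj₁ (descent² F)

-- K = V K · y raises the power of `y` by one: the odd part of K y² A involves A y³, the even part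
-- of K y³ B involves B y⁴.
module Odd = Descent U′ U′-cong U′-⊕ U′-V⊗ (y ↑ 3) (ι (+ 8) ⊗ y ↑ 3)
module Even = Descent U U-cong U-⊕ U-V⊗ (y ↑ 4) (y ↑ 2)

odd-descent : ∀ {f} → Pol f → Odd.Good f
odd-descent = Odd.descent
  (Odd.good Pol-3+2X (trans (U′-cong (⊗-identityˡ _)) U′y³))
  (Odd.good (Pol-⊕ (Pol-ι _) (Pol-X⊗ (Pol-⊗ Pol-X₆ Pol-3+2X))) U′Xy³)
  where
  Pol-3+2X : Pol (ι (+ 3) ⊕ ι (+ 2) ⊗ X)
  Pol-3+2X = Pol-⊕ (Pol-ι _) (Pol-ι⊗ _ Pol-X)

even-descent : ∀ {f} → Pol f → Even.Good f
even-descent = Even.descent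
  (Even.good Pol-X₄ (trans (U-cong (⊗-identityˡ _)) Uy⁴))
  (Even.good (Pol-X⊗ (Pol-⊕ (Pol-ι _) (Pol-⊗ Pol-X₆ Pol-X₄))) UXy⁴)

-- The subsequences of p₈ and their factorisation

-- S₁ α n = p₈(2·4^α n + (2·4^α + 1)/3) and S₂ α n = p₈(4^{α+1} n + (2·4^{α+1} + 1)/3).
S₁ S₂ : ℕ → PS
S₁ zero    = U′ K
S₁ (suc α) = U (S₂ α)
S₂ α       = U′ (S₁ α)

U-ι↑⊗ : ∀ d m f → U (ι d ↑ m ⊗ f) ≈ ι d ↑ m ⊗ U f
U-ι↑⊗ d m f = trans (U-cong (⊗-congʳ (sym (trans (V-↑ _ m) (↑-cong m (V-ι d)))))) (U-V⊗ _ f)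

U′-ι↑⊗ : ∀ d m f → U′ (ι d ↑ m ⊗ f) ≈ ι d ↑ m ⊗ U′ f
U′-ι↑⊗ d m f = trans (U′-cong (⊗-congʳ (sym (trans (V-↑ _ m) (↑-cong m (V-ι d)))))) (U′-V⊗ _ f)

record Shape (f g : PS) (m : ℕ) : Set where
  constructor shape
  field
    {cofactor} : PS
    pol        : Pol cofactor
    equal      : f ≈ ι (+ 8) ↑ m ⊗ (K ⊗ (g ⊗ cofactor))

S₁⇒S₂ : ∀ {f} m → Shape f (y ↑ 2) m → Shape (U′ f) (y ↑ 3) (suc m)
S₁⇒S₂ {h} m (shape {f} F p) = shape Pol-g (begin
  U′ h                                        ≈⟨ trans (U′-cong p) (U′-ι↑⊗ _ m _) ⟩
  C ⊗ U′ (K ⊗ (y ↑ 2 ⊗ f))                    ≈⟨ ⊗-congˡ (U′-cong (⊗-congʳ K-V)) ⟩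
  C ⊗ U′ (V K ⊗ y ⊗ (y ↑ 2 ⊗ f))              ≈⟨ ⊗-congˡ (trans (U′-cong (solve 3 (λ k y f → k :* y :* (y :^ 2 :* f) := k :* (f :* y :^ 3)) refl (V K) y f)) (U′-V⊗ _ _)) ⟩
  C ⊗ (K ⊗ U′ (f ⊗ y ↑ 3))                    ≈⟨ ⊗-congˡ (⊗-congˡ U-image) ⟩
  C ⊗ (K ⊗ (ι (+ 8) ⊗ y ↑ 3 ⊗ g))             ≈⟨ solve 4 (λ c k w g → c :* (k :* (con (+ 8) :* w :* g)) := con (+ 8) :* c :* (k :* (w :* g))) refl C K (y ↑ 3) g ⟩
  ι (+ 8) ⊗ C ⊗ (K ⊗ (y ↑ 3 ⊗ g))             ∎)
  where
  C = ι (+ 8) ↑ m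
  open Odd.Good (odd-descent F) renaming (image to g; pol to Pol-g; L-image to U-image)

S₂⇒S₁ : ∀ {f} m → Shape f (y ↑ 3) m → Shape (U f) (y ↑ 2) m
S₂⇒S₁ {h} m (shape {f} F p) = shape Pol-g (begin
  U h                                         ≈⟨ trans (U-cong p) (U-ι↑⊗ _ m _) ⟩
  C ⊗ U (K ⊗ (y ↑ 3 ⊗ f))                     ≈⟨ ⊗-congˡ (U-cong (⊗-congʳ K-V)) ⟩
  C ⊗ U (V K ⊗ y ⊗ (y ↑ 3 ⊗ f))               ≈⟨ ⊗-congˡ (trans (U-cong (solve 3 (λ k y f → k :* y :* (y :^ 3 :* f) := k :* (f :* y :^ 4)) refl (V K) y f)) (U-V⊗ _ _)) ⟩
  C ⊗ (K ⊗ U (f ⊗ y ↑ 4))                     ≈⟨ ⊗-congˡ (⊗-congˡ U-image) ⟩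
  C ⊗ (K ⊗ (y ↑ 2 ⊗ g))                       ∎)
  where
  C = ι (+ 8) ↑ m
  open Even.Good (even-descent F) renaming (image to g; pol to Pol-g; L-image to U-image)

S₁-shape : ∀ α → Shape (S₁ α) (y ↑ 2) (suc α)
S₁-shape zero    = shape (Pol-ι (+ 1)) (begin
  U′ K                                   ≈⟨ trans (U′-cong K-V) (trans (U′-V⊗ K y) (⊗-congˡ U′y)) ⟩
  K ⊗ (ι (+ 8) ⊗ (y ⊗ y))                ≈⟨ solve 3 (λ k w y → k :* (w :* (y :* y)) := w :* con (+ 1) :* (k :* (y :^ 2 :* con (+ 1)))) refl K (ι (+ 8)) y ⟩
  ι (+ 8) ↑ 1 ⊗ (K ⊗ (y ↑ 2 ⊗ 𝟙))        ∎)
S₁-shape (suc α) = S₂⇒S₁ (suc (suc α)) (S₁⇒S₂ (suc α) (S₁-shape α))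

S₂-shape : ∀ α → Shape (S₂ α) (y ↑ 3) (suc (suc α))
S₂-shape α = S₁⇒S₂ (suc α) (S₁-shape α)

-- Frobenius congruences modulo powers of 2

square-even : ∀ a → ∃ λ k → a ℤ.* a ≡ a ℤ.+ + 2 ℤ.* k
square-even (+ n) = natural n
  where
  natural : ∀ n → ∃ λ k → + n ℤ.* + n ≡ + n ℤ.+ + 2 ℤ.* k
  natural zero    = + 0 , ≡.refl
  natural (suc n) with natural n
  ... | k , p = k ℤ.+ + n , ≡.trans (expand (+ n)) (≡.trans (cong (λ t → t ℤ.+ (+ 2 ℤ.* + n ℤ.+ + 1)) p) (collect (+ n) k))
    where
    expand : ∀ n → (+ 1 ℤ.+ n) ℤ.* (+ 1 ℤ.+ n) ≡ n ℤ.* n ℤ.+ (+ 2 ℤ.* n ℤ.+ + 1)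
    expand = ℤ-Solver.solve-∀
    collect : ∀ n k → n ℤ.+ + 2 ℤ.* k ℤ.+ (+ 2 ℤ.* n ℤ.+ + 1) ≡ + 1 ℤ.+ n ℤ.+ + 2 ℤ.* (k ℤ.+ n)
    collect = ℤ-Solver.solve-∀
square-even ℤ.-[1+ n ] with square-even (+ suc n)
... | k , p = k ℤ.+ + suc n , ≡.trans p (flip (+ suc n) k)
  where
  flip : ∀ a k → a ℤ.+ + 2 ℤ.* k ≡ ℤ.- a ℤ.+ + 2 ℤ.* (k ℤ.+ a)
  flip = ℤ-Solver.solve-∀

opaque
  unfolding V

  -- Peeling f(0) from both factors leaves 2 f(0) f(n+2) plus coefficient n of the square of
  -- `tail f`; only diagonal terms remain modulo 2.
  frobenius-at : ∀ n f → ∃ λ k → (f ⊗ f) n ≡ V f n ℤ.+ + 2 ℤ.* k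
  frobenius-at zero          f with square-even (f 0)
  ... | k , p = k , ≡.trans (⊗-zero f f) p
  frobenius-at (suc zero)    f = f 0 ℤ.* f 1 , ≡.trans (⊗-suc f f 0)
    (≡.trans (cong (λ t → f 0 ℤ.* f 1 ℤ.+ t) (⊗-zero (tail f) f)) (double (f 0) (f 1)))
    where
    double : ∀ a b → a ℤ.* b ℤ.+ b ℤ.* a ≡ + 0 ℤ.+ + 2 ℤ.* (a ℤ.* b)
    double = ℤ-Solver.solve-∀
  frobenius-at (suc (suc n)) f with frobenius-at n (tail f)
  ... | k , p = f 0 ℤ.* f (suc (suc n)) ℤ.+ k , (≡.trans (⊗-suc f f (suc n))
    (≡.trans (cong (λ t → f 0 ℤ.* f (suc (suc n)) ℤ.+ t)
        (≡.trans (⊗-comm (tail f) f .at (suc n)) (≡.trans (⊗-suc f (tail f) n) (cong (λ t → f 0 ℤ.* f (suc (suc n)) ℤ.+ t) p))))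
      (double (f 0 ℤ.* f (suc (suc n))) (V (tail f) n) k)))
    where
    double : ∀ a v k → a ℤ.+ (a ℤ.+ (v ℤ.+ + 2 ℤ.* k)) ≡ v ℤ.+ + 2 ℤ.* (a ℤ.+ k)
    double = ℤ-Solver.solve-∀

frobenius : ∀ f → f ⊗ f ≋ V f mod ι (+ 2)
frobenius f = quotient h (pointwise λ n → ≡.trans (proj₂ (frobenius-at n f))
  (≡.sym (≡.trans (⊕-at (V f) _ n) (cong (λ t → V f n ℤ.+ t) (ι-⊗ (+ 2) h n)))))
  where
  h : PS
  h n = proj₁ (frobenius-at n f)

-- (g + d h)² = g² + 2d g h + d² h², and d² is a multiple of 2d because d is even.
≋-square : ∀ {f g} c {d e} → d ≡ + 2 ℤ.* c → e ≡ + 2 ℤ.* d → f ≋ g mod ι d → f ⊗ f ≋ g ⊗ g mod ι e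
≋-square {f} {g} c ≡.refl ≡.refl (quotient h p) = quotient (g ⊗ h ⊕ ι c ⊗ (h ⊗ h)) (begin
  f ⊗ f                                                            ≈⟨ *-cong p p ⟩
  (g ⊕ ι (+ 2 ℤ.* c) ⊗ h) ⊗ (g ⊕ ι (+ 2 ℤ.* c) ⊗ h)                ≈⟨ *-cong (⊕-congˡ (⊗-congʳ (ι-* _ c))) (⊕-congˡ (⊗-congʳ (ι-* _ c))) ⟩
  (g ⊕ ι (+ 2) ⊗ ι c ⊗ h) ⊗ (g ⊕ ι (+ 2) ⊗ ι c ⊗ h)                ≈⟨ solve 3 (λ g c h → (g :+ con (+ 2) :* c :* h) :* (g :+ con (+ 2) :* c :* h) := g :* g :+ con (+ 2) :* (con (+ 2) :* c) :* (g :* h :+ c :* (h :* h))) refl g (ι c) h ⟩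
  g ⊗ g ⊕ ι (+ 2) ⊗ (ι (+ 2) ⊗ ι c) ⊗ (g ⊗ h ⊕ ι c ⊗ (h ⊗ h))      ≈⟨ ⊕-congˡ (⊗-congʳ (trans (ι-* _ _) (⊗-congˡ (ι-* _ c)))) ⟨
  g ⊗ g ⊕ ι (+ 2 ℤ.* (+ 2 ℤ.* c)) ⊗ (g ⊗ h ⊕ ι c ⊗ (h ⊗ h))        ∎)

frobenius₂ : ∀ f → f ↑ 2 ≋ V f mod ι (+ 2)
frobenius₂ f = ≋-respˡ (solve 1 (λ f → f :* f := f :^ 2) refl f) (frobenius f)

frobenius₄ : ∀ f → f ↑ 4 ≋ V (f ↑ 2) mod ι (+ 4)
frobenius₄ f = ≋-respˡ (solve 1 (λ f → f :* f :* (f :* f) := f :^ 4) refl f)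
  (≋-respʳ (trans (solve 1 (λ f → f :* f := f :^ 2) refl (V f)) (sym (V-↑ f 2))) (≋-square (+ 1) ≡.refl ≡.refl (frobenius f)))

frobenius₈ : ∀ f → f ↑ 8 ≋ V (f ↑ 4) mod ι (+ 8)
frobenius₈ f = ≋-respˡ (solve 1 (λ f → f :^ 4 :* f :^ 4 := f :^ 8) refl f)
  (≋-respʳ (trans (sym (V-⊗ _ _)) (V-cong (solve 1 (λ f → f :^ 2 :* f :^ 2 := f :^ 4) refl f))) (≋-square (+ 2) ≡.refl ≡.refl (frobenius₄ f)))

weaken : ∀ {f g} d e → f ≋ g mod ι (d ℤ.* e) → f ≋ g mod ι d
weaken d e p = ≋-weaken (ι e) (≋-modulus (ι-* d e) p)

U-V≋ : ∀ {f g d} → f ≋ V g mod ι d → U f ≋ g mod ι d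
U-V≋ {d = d} p = ≋-respʳ (U-V _) (U-≋ d p)

U′-V≋ : ∀ {f g d} → f ≋ V g mod ι d → U′ f ≋ 𝟘 mod ι d
U′-V≋ {d = d} p = ≋-respʳ (U′-V _) (U′-≋ d p)

-- Residues of K y² and K y³ along subprogressions

y≋Vz : y ≋ V z mod ι (+ 8)
y≋Vz = ≋-respˡ (solve 1 (λ r → r :^ 8 := r :^ 4 :* r :^ 4) refl r) (frobenius₈ r)

z≋V : z ≋ V (r ↑ 2) mod ι (+ 4)
z≋V = frobenius₄ r

K≋V : K ≋ V (P ↑ 4) mod ι (+ 8)
K≋V = frobenius₈ P

-- Both factors are series in q² modulo 8, with product V(P⁴ z²). Here P⁴ z² = (E₂⁴ P⁸) z, and the
-- bracket is 1 modulo 8 since P⁸ ≡ P₂⁴.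
Ky²≋Vz : K ⊗ y ↑ 2 ≋ V z mod ι (+ 8)
Ky²≋Vz = ≋-trans (⊗-≋ K≋V (↑-≋ 2 y≋Vz)) (≋-trans (≈⇒≋ (begin
  V (P ↑ 4) ⊗ V z ↑ 2                ≈⟨ trans (⊗-congˡ (sym (V-↑ z 2))) (sym (V-⊗ _ _)) ⟩
  V (P ↑ 4 ⊗ z ↑ 2)                  ≈⟨ V-cong (⊗-congˡ (↑-cong 2 (↑-⊗ E₂ P 4))) ⟩
  V (P ↑ 4 ⊗ (E₂ ↑ 4 ⊗ P ↑ 4) ↑ 2)   ≈⟨ V-cong (solve 2 (λ p e → p :^ 4 :* (e :^ 4 :* p :^ 4) :^ 2 := e :^ 4 :* p :^ 8 :* (e :^ 4 :* p :^ 4)) refl P E₂) ⟩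
  V (E₂ ↑ 4 ⊗ P ↑ 8 ⊗ (E₂ ↑ 4 ⊗ P ↑ 4))  ≈⟨ V-cong (⊗-congˡ (sym (↑-⊗ E₂ P 4))) ⟩
  V (E₂ ↑ 4 ⊗ P ↑ 8 ⊗ z)             ∎))
  (V-≋ (+ 8) (≋-respʳ (⊗-identityˡ z) (⊗-≋ unit ≋-refl))))
  where
  unit : E₂ ↑ 4 ⊗ P ↑ 8 ≋ 𝟙 mod ι (+ 8)
  unit = ≋-respʳ (trans (⊗-congˡ (V-↑ P 4)) (trans (sym (↑-⊗ E₂ P₂ 4)) (𝟙-↑ 4 E₂⊗P₂))) (⊗-≋ (≋-refl {E₂ ↑ 4}) (frobenius₈ P))

-- `z` = V C + q V D is the dissection of `z`. `D′` is D/4, which exists because `z` is a series in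
-- q² modulo 4; `ρ` is 1/r.
C D D′ ρ : PS
C  = U z
D  = U′ z
D′ = quot (U′-V≋ z≋V)
ρ  = E ⊗ P₂

D-D′ : D ≈ ι (+ 4) ⊗ D′
D-D′ = trans (equal (U′-V≋ z≋V)) (⊕-identityˡ _)

-- Comparing odd parts in z² = y gives 2 C D = U′ y = 8 y², and D = 4 D′.
C⊗D′ : C ⊗ D′ ≈ y ⊗ y
C⊗D′ = ι-cancel 7 (begin
  ι (+ 8) ⊗ (C ⊗ D′)                    ≈⟨ solve 2 (λ c d → con (+ 8) :* (c :* d) := con (+ 2) :* (c :* (con (+ 4) :* d))) refl C D′ ⟩
  ι (+ 2) ⊗ (C ⊗ (ι (+ 4) ⊗ D′))        ≈⟨ ⊗-congˡ (⊗-congˡ D-D′) ⟨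
  ι (+ 2) ⊗ (C ⊗ D)                     ≈⟨ trans (⊕-congʳ (U′-V _)) (trans (⊕-identityˡ _) (U′-qV _)) ⟨
  U′ (V (C ⊗ C ⊕ q ⊗ (D ⊗ D))) ⊕ U′ (q ⊗ V (ι (+ 2) ⊗ (C ⊗ D)))  ≈⟨ U′-⊕ _ _ ⟨
  U′ (V (C ⊗ C ⊕ q ⊗ (D ⊗ D)) ⊕ q ⊗ V (ι (+ 2) ⊗ (C ⊗ D)))
    ≈⟨ U′-cong (+-cong (trans (V-⊕ _ _) (+-cong (V-⊗ _ _) (V-q⊗ _ (V-⊗ _ _)))) (⊗-congˡ (V-ι⊗ (+ 2) _ (V-⊗ _ _)))) ⟩
  U′ (V C ⊗ V C ⊕ q ⊗ q ⊗ (V D ⊗ V D) ⊕ q ⊗ (ι (+ 2) ⊗ (V C ⊗ V D)))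
    ≈⟨ U′-cong (solve 3 (λ a q b → a :* a :+ q :* q :* (b :* b) :+ q :* (con (+ 2) :* (a :* b)) := (a :+ q :* b) :* (a :+ q :* b)) refl (V C) q (V D)) ⟩
  U′ ((V C ⊕ q ⊗ V D) ⊗ (V C ⊕ q ⊗ V D))  ≈⟨ U′-cong (*-cong (split z) (split z)) ⟨
  U′ (z ⊗ z)                            ≈⟨ U′y ⟩
  ι (+ 8) ⊗ (y ⊗ y)                     ∎)

C≋r² : C ≋ r ↑ 2 mod ι (+ 4)
C≋r² = U-V≋ z≋V

C≋Vr : C ≋ V r mod ι (+ 2)
C≋Vr = ≋-trans (weaken (+ 2) (+ 2) C≋r²) (frobenius₂ r)

-- Modulo 2, C is r², so D′ = y²/C is the square of ρ y. Hence the odd coefficients of `D` are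
-- divisible by 8 and not merely by 4.
D′≋V : D′ ≋ V (ρ ⊗ y) mod ι (+ 2)
D′≋V = ≋-trans (⊗-cancelˡ-≋ (r ↑ 2) (ρ ↑ 2) ρ²r² (≋-trans (⊗-≋ (≋-sym (weaken (+ 2) (+ 2) C≋r²)) ≋-refl)
    (≈⇒≋ (trans C⊗D′ (sym (trans (sym (⊗-assoc _ _ _)) (absorb (trans (⊗-comm _ _) ρ²r²))))))))
  (≋-respˡ (solve 2 (λ ρ y → ρ :* y :* (ρ :* y) := ρ :^ 2 :* (y :* y)) refl ρ y) (frobenius (ρ ⊗ y)))
  where
  ρ²r² : ρ ↑ 2 ⊗ r ↑ 2 ≈ 𝟙
  ρ²r² = trans (sym (↑-⊗ ρ r 2)) (𝟙-↑ 2 (trans (solve 4 (λ e p e₂ p₂ → e :* p₂ :* (e₂ :* p) := e :* p :* (e₂ :* p₂)) refl E P E₂ P₂) (trans (absorb E⊗P) E₂⊗P₂)))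

Ky²-4n+2 : U′ (U (K ⊗ y ↑ 2)) ≋ 𝟘 mod ι (+ 4)
Ky²-4n+2 = ≋-trans (weaken (+ 4) (+ 2) (U′-≋ (+ 8) (U-V≋ Ky²≋Vz))) (U′-V≋ z≋V)

Ky²-8n+6 : U′ (U′ (U (K ⊗ y ↑ 2))) ≋ 𝟘 mod ι (+ 8)
Ky²-8n+6 = ≋-trans (U′-≋ (+ 8) (U′-≋ (+ 8) (U-V≋ Ky²≋Vz)))
  (≋-respˡ (sym (trans (U′-cong D-D′) (U′-ι⊗ _ _)))
    (≋-modulus (sym (ι-* (+ 4) (+ 2))) (≋-respʳ (⊗-zeroʳ _) (≋-scale (ι (+ 4)) (U′-V≋ D′≋V)))))

Ky²-4n : U (U (K ⊗ y ↑ 2)) ≋ V r mod ι (+ 2)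
Ky²-4n = ≋-trans (weaken (+ 2) (+ 4) (U-≋ (+ 8) (U-V≋ Ky²≋Vz))) C≋Vr

Ky²-8n+4 : U′ (U (U (K ⊗ y ↑ 2))) ≋ 𝟘 mod ι (+ 2)
Ky²-8n+4 = U′-V≋ Ky²-4n

-- What is left is r = E₂/E, and E₂ ≡ E² modulo 2.
Ky²-8n : U (U (U (K ⊗ y ↑ 2))) ≋ E mod ι (+ 2)
Ky²-8n = ≋-trans (U-V≋ Ky²-4n) (≋-trans (⊗-≋ (≋-sym (frobenius E)) (≋-refl {P}))
  (≈⇒≋ (trans (⊗-assoc _ _ _) (trans (⊗-congˡ E⊗P) (⊗-identityʳ _)))))

-- K y³ = V K · y⁴; in `y⁴-form` the coefficients 256 and 4096 vanish modulo 128, and the remaining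
-- even part drops out.
Ky³-2n+1 : U′ (K ⊗ y ↑ 3) ≋ ι (+ 32) ⊗ (K ⊗ y ↑ 3 ⊗ U y) mod ι (+ 128)
Ky³-2n+1 = ≋-trans (U′-≋ (+ 128) expansion) (≈⇒≋ (begin
  U′ (V (K ⊗ y ↑ 2) ⊕ ι (+ 32) ⊗ (V (K ⊗ y ↑ 3) ⊗ (q ⊗ y)))      ≈⟨ trans (U′-⊕ _ _) (+-cong (U′-V _) (trans (U′-ι⊗ _ _) (⊗-congˡ (trans (U′-V⊗ _ _) (⊗-congˡ (U′-q y)))))) ⟩
  𝟘 ⊕ ι (+ 32) ⊗ (K ⊗ y ↑ 3 ⊗ U y)                               ≈⟨ ⊕-identityˡ _ ⟩
  ι (+ 32) ⊗ (K ⊗ y ↑ 3 ⊗ U y)                                   ∎))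
  where
  expansion : K ⊗ y ↑ 3 ≋ V (K ⊗ y ↑ 2) ⊕ ι (+ 32) ⊗ (V (K ⊗ y ↑ 3) ⊗ (q ⊗ y)) mod ι (+ 128)
  expansion = quotient (V K ⊗ (ι (+ 2) ⊗ (q ⊗ q ⊗ Y ↑ 5) ⊕ ι (+ 32) ⊗ (q ⊗ q ⊗ Y ↑ 6) ⊗ (q ⊗ y))) (begin
    K ⊗ y ↑ 3                        ≈⟨ ⊗-congʳ K-V ⟩
    V K ⊗ y ⊗ y ↑ 3                  ≈⟨ trans (⊗-assoc _ _ _) (⊗-congˡ y⁴-form) ⟩
    V K ⊗ ((Y ↑ 2 ⊕ ι (+ 256) ⊗ (q ⊗ q ⊗ Y ↑ 5)) ⊕ (ι (+ 32) ⊗ Y ↑ 3 ⊕ ι (+ 4096) ⊗ (q ⊗ q ⊗ Y ↑ 6)) ⊗ (q ⊗ y))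
      ≈⟨ solve 6 (λ k a b d e x → k :* ((a :+ con (+ 256) :* b) :+ (con (+ 32) :* d :+ con (+ 4096) :* e) :* x)
           := k :* a :+ con (+ 32) :* (k :* d :* x) :+ con (+ 128) :* (k :* (con (+ 2) :* b :+ con (+ 32) :* e :* x))) refl
           (V K) (Y ↑ 2) (q ⊗ q ⊗ Y ↑ 5) (Y ↑ 3) (q ⊗ q ⊗ Y ↑ 6) (q ⊗ y) ⟩
    V K ⊗ Y ↑ 2 ⊕ ι (+ 32) ⊗ (V K ⊗ Y ↑ 3 ⊗ (q ⊗ y)) ⊕ ι (+ 128) ⊗ (V K ⊗ (ι (+ 2) ⊗ (q ⊗ q ⊗ Y ↑ 5) ⊕ ι (+ 32) ⊗ (q ⊗ q ⊗ Y ↑ 6) ⊗ (q ⊗ y)))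
      ≈⟨ ⊕-congʳ (+-cong (trans (V-⊗ _ _) (⊗-congˡ (V-Y↑ 2))) (⊗-congˡ (⊗-congʳ (trans (V-⊗ _ _) (⊗-congˡ (V-Y↑ 3)))))) ⟨
    V (K ⊗ y ↑ 2) ⊕ ι (+ 32) ⊗ (V (K ⊗ y ↑ 3) ⊗ (q ⊗ y)) ⊕ ι (+ 128) ⊗ (V K ⊗ (ι (+ 2) ⊗ (q ⊗ q ⊗ Y ↑ 5) ⊕ ι (+ 32) ⊗ (q ⊗ q ⊗ Y ↑ 6) ⊗ (q ⊗ y))) ∎)

Ky³-2n+1-≋0 : U′ (K ⊗ y ↑ 3) ≋ 𝟘 mod ι (+ 32)
Ky³-2n+1-≋0 = ≋-trans (weaken (+ 32) (+ 4) Ky³-2n+1) (≋-multiple _ _)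

-- Each of the three factors is a series in q² modulo 4, so an odd extraction after `Ky³-2n+1` gains
-- 4 and gives 32 · 4 = 128.
Ky³Uy≋V : K ⊗ y ↑ 3 ⊗ U y ≋ V (P ↑ 4 ⊗ z ↑ 3 ⊗ r ↑ 2) mod ι (+ 4)
Ky³Uy≋V = ≋-respʳ (sym (trans (V-⊗ _ _) (⊗-congʳ (trans (V-⊗ _ _) (⊗-congˡ (V-↑ z 3))))))
  (⊗-≋ (⊗-≋ (weaken (+ 4) (+ 2) K≋V) (↑-≋ 3 (weaken (+ 4) (+ 2) y≋Vz))) (≋-trans (weaken (+ 4) (+ 2) (U-V≋ y≋Vz)) z≋V))

Ky³-4n+3 : U′ (U′ (K ⊗ y ↑ 3)) ≋ 𝟘 mod ι (+ 128)
Ky³-4n+3 = ≋-trans (U′-≋ (+ 128) Ky³-2n+1) (≋-respˡ (sym (U′-ι⊗ _ _))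
  (≋-modulus (sym (ι-* (+ 32) (+ 4))) (≋-respʳ (⊗-zeroʳ _) (≋-scale (ι (+ 32)) (U′-V≋ Ky³Uy≋V)))))

Ky³-8n+5 : U′ (U (U′ (K ⊗ y ↑ 3))) ≋ 𝟘 mod ι (+ 64)
Ky³-8n+5 = ≋-trans (U′-≋ (+ 64) (U-≋ (+ 64) (weaken (+ 64) (+ 2) Ky³-2n+1)))
  (≋-respˡ (sym (trans (U′-cong (U-ι⊗ _ _)) (U′-ι⊗ _ _)))
    (≋-modulus (sym (ι-* (+ 32) (+ 2))) (≋-respʳ (⊗-zeroʳ _) (≋-scale (ι (+ 32)) (U′-V≋
      -- The even part P⁴ z³ r² is again a series in q², but only modulo 2, because of r²; hence 32
      -- · 2 = 64.
      (≋-trans (weaken (+ 2) (+ 2) (U-V≋ Ky³Uy≋V))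
        (≋-respʳ (sym (trans (V-⊗ _ _) (⊗-congʳ (trans (V-⊗ _ _) (⊗-congˡ (V-↑ (r ↑ 2) 3))))))
          (⊗-≋ (⊗-≋ (weaken (+ 2) (+ 2) (frobenius₄ P)) (↑-≋ 3 (weaken (+ 2) (+ 2) z≋V))) (frobenius₂ r)))))))))

-- From residues to divisibility of coefficients

record Dissector (L : PS → PS) : Set where
  field
    L-cong : ∀ {f g} → f ≈ g → L f ≈ L g
    L-⊕    : ∀ f g → L (f ⊕ g) ≈ L f ⊕ L g
    L-ι⊗   : ∀ d f → L (ι d ⊗ f) ≈ ι d ⊗ L f

open Dissector

id-dissector : Dissector (λ f → f)
id-dissector = record { L-cong = λ p → p ; L-⊕ = λ _ _ → refl ; L-ι⊗ = λ _ _ → refl }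

U∘ : ∀ {L} → Dissector L → Dissector (U ∘ L)
U∘ d = record
  { L-cong = U-cong ∘ L-cong d
  ; L-⊕    = λ f g → trans (U-cong (L-⊕ d f g)) (U-⊕ _ _)
  ; L-ι⊗   = λ c f → trans (U-cong (L-ι⊗ d c f)) (U-ι⊗ c _) }

U′∘ : ∀ {L} → Dissector L → Dissector (U′ ∘ L)
U′∘ d = record
  { L-cong = U′-cong ∘ L-cong d
  ; L-⊕    = λ f g → trans (U′-cong (L-⊕ d f g)) (U′-⊕ _ _)
  ; L-ι⊗   = λ c f → trans (U′-cong (L-ι⊗ d c f)) (U′-ι⊗ c _) }

ι8↑⊗ : ∀ m f n → (ι (+ 8) ↑ m ⊗ f) n ≡ + (8 ^ m) ℤ.* f n
ι8↑⊗ zero    f n = ι-⊗ (+ 1) f n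
ι8↑⊗ (suc m) f n = ≡.trans (⊗-assoc _ _ f .at n) (≡.trans (ι-⊗ (+ 8) _ n)
  (≡.trans (cong (+ 8 ℤ.*_) (ι8↑⊗ m f n)) (≡.trans (≡.sym (ℤₚ.*-assoc (+ 8) (+ (8 ^ m)) (f n))) (cong (ℤ._* f n) (≡.sym (ℤₚ.pos-* 8 (8 ^ m)))))))

L-ι↑⊗ : ∀ {L} → Dissector L → ∀ m f → L (ι (+ 8) ↑ m ⊗ f) ≈ ι (+ 8) ↑ m ⊗ L f
L-ι↑⊗ d zero    f = L-ι⊗ d (+ 1) f
L-ι↑⊗ d (suc m) f = trans (L-cong d (⊗-assoc _ _ f)) (trans (L-ι⊗ d (+ 8) _) (trans (⊗-congˡ (L-ι↑⊗ d m f)) (sym (⊗-assoc _ _ _))))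

Pol-≋ : ∀ {f} → Pol f → ∃ λ c → f ≋ ι c mod ι (+ 128)
Pol-≋ (nil p)          = + 0 , ≈⇒≋ p
Pol-≋ (cons c {g} _ p) = c , quotient (q ⊗ y ↑ 3 ⊗ g) (trans p (⊕-congˡ (⊗-assoc _ _ _)))

-- The cofactor is c + 128 u with c unspecified, so the residue enters as c e(n) and the conclusion
-- is drawn where e(n) = 0. Keeping `e` general allows `E` as residue in the pentagonal claim.
shape-coeff : ∀ {L f g e m} → Dissector L → ∀ d d′ → + 128 ≡ d ℤ.* d′ → L (K ⊗ g) ≋ e mod ι d → Shape f g m →
  ∀ n → e n ≡ + 0 → ∃ λ k → L f n ≡ + (8 ^ m) ℤ.* (d ℤ.* k)
shape-coeff {L} {f} {g} {e} {m} δ d d′ 128≡dd′ (quotient h r) (shape {p} Pol-p s) n e≡0 = k , (begin≡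
  L f n                                        ≡⟨ L-cong δ s .at n ⟩
  L (ι (+ 8) ↑ m ⊗ (K ⊗ (g ⊗ p))) n            ≡⟨ L-ι↑⊗ δ m _ .at n ⟩
  (ι (+ 8) ↑ m ⊗ L (K ⊗ (g ⊗ p))) n            ≡⟨ ι8↑⊗ m _ n ⟩
  + (8 ^ m) ℤ.* L (K ⊗ (g ⊗ p)) n              ≡⟨ cong (+ (8 ^ m) ℤ.*_) (expansion .at n) ⟩
  + (8 ^ m) ℤ.* (ι c ⊗ e ⊕ ι d ⊗ w) n          ≡⟨ cong (+ (8 ^ m) ℤ.*_) (≡.trans (⊕-at _ _ n) (cong₂ ℤ._+_ (≡.trans (ι-⊗ c e n) (≡.trans (cong (c ℤ.*_) e≡0) (ℤₚ.*-zeroʳ c))) (ι-⊗ d w n))) ⟩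
  + (8 ^ m) ℤ.* (+ 0 ℤ.+ d ℤ.* w n)            ≡⟨ cong (+ (8 ^ m) ℤ.*_) (ℤₚ.+-identityˡ (d ℤ.* w n)) ⟩
  + (8 ^ m) ℤ.* (d ℤ.* w n)                    ∎≡)
  where
  open ≡.≡-Reasoning renaming (begin_ to begin≡_; _∎ to _∎≡)
  c = proj₁ (Pol-≋ Pol-p)
  u = quot (proj₂ (Pol-≋ Pol-p))
  v = L (K ⊗ (g ⊗ u))
  w = ι c ⊗ h ⊕ ι d′ ⊗ v
  k = w n
  expansion : L (K ⊗ (g ⊗ p)) ≈ ι c ⊗ e ⊕ ι d ⊗ w
  expansion = begin
    L (K ⊗ (g ⊗ p))                                          ≈⟨ L-cong δ (⊗-congˡ (⊗-congˡ (equal (proj₂ (Pol-≋ Pol-p))))) ⟩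
    L (K ⊗ (g ⊗ (ι c ⊕ ι (+ 128) ⊗ u)))                      ≈⟨ L-cong δ (solve 5 (λ K g c a u → K :* (g :* (c :+ a :* u)) := c :* (K :* g) :+ a :* (K :* (g :* u))) refl K g (ι c) (ι (+ 128)) u) ⟩
    L (ι c ⊗ (K ⊗ g) ⊕ ι (+ 128) ⊗ (K ⊗ (g ⊗ u)))            ≈⟨ trans (L-⊕ δ _ _) (+-cong (L-ι⊗ δ c _) (L-ι⊗ δ (+ 128) _)) ⟩
    ι c ⊗ L (K ⊗ g) ⊕ ι (+ 128) ⊗ v                          ≈⟨ +-cong (⊗-congˡ r) (⊗-congʳ (≡.subst (λ t → ι (+ 128) ≈ ι t) 128≡dd′ refl)) ⟩
    ι c ⊗ (e ⊕ ι d ⊗ h) ⊕ ι (d ℤ.* d′) ⊗ v                   ≈⟨ ⊕-congˡ (⊗-congʳ (ι-* d d′)) ⟩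
    ι c ⊗ (e ⊕ ι d ⊗ h) ⊕ ι d ⊗ ι d′ ⊗ v                     ≈⟨ solve 6 (λ c e d h d′ v → c :* (e :+ d :* h) :+ d :* d′ :* v := c :* e :+ d :* (c :* h :+ d′ :* v)) refl (ι c) e (ι d) h (ι d′) v ⟩
    ι c ⊗ e ⊕ ι d ⊗ w                                        ∎

-- Arithmetic of the progressions, and the theorem

-- 2 · 4^α and (2 · 4^α + 1)/3, by recurrences that keep the division by 3 out of `S₁-index`.
stride start : ℕ → ℕ
stride zero     = 2
stride (suc α)  = 4 * stride α
start zero    = 1
start (suc α) = start α + stride α

S₁-index : ∀ α n → S₁ α n ≡ K (stride α * n + start α)
S₁-index zero    n = ≡.trans (U′-at K n) (cong K (ℕₚ.+-comm 1 (2 * n)))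
S₁-index (suc α) n = ≡.trans (U-at _ n) (≡.trans (U′-at _ (2 * n)) (≡.trans (S₁-index α (suc (2 * (2 * n)))) (cong K (arith (stride α) n (start α)))))
  where
  arith : ∀ h n o → h * suc (2 * (2 * n)) + o ≡ 4 * h * n + (o + h)
  arith = ℕ-Solver.solve-∀

stride-pow : ∀ α → stride α ≡ 2 ^ (2 * suc α ∸ 1)
stride-pow zero    = ≡.refl
stride-pow (suc α) = ≡.trans (cong (4 *_) (stride-pow α))
  (≡.trans (≡.sym (ℕₚ.^-distribˡ-+-* 2 2 (2 * suc α ∸ 1))) (cong (2 ^_) (arith α)))
  where
  arith : ∀ α → suc (suc (α + suc (α + 0))) ≡ suc (α + suc (suc (α + 0)))
  arith = ℕ-Solver.solve-∀

3start : ∀ α → 3 * start α ≡ stride α + 1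
3start zero    = ≡.refl
3start (suc α) = ≡.trans (ℕₚ.*-distribˡ-+ 3 (start α) (stride α)) (≡.trans (cong (_+ 3 * stride α) (3start α)) (arith (stride α)))
  where
  arith : ∀ h → h + 1 + 3 * h ≡ 4 * h + 1
  arith = ℕ-Solver.solve-∀

-- As multiples of `stride α`, the numerators 1, 7, 13, 19 and 2·5, 2·11, 2·17 of the theorem are
-- all of the form 1 + 3b, so the quotient is exact and b is the place inside `S₁ α`.
offset : ∀ α b → ((1 + 3 * b) * stride α + 1) / 3 ≡ b * stride α + start α
offset α b = ≡.trans (cong (_/ 3) (≡.trans (arith b (stride α)) (≡.trans (cong (λ t → 3 * (b * stride α) + t) (≡.sym (3start α))) (factor (b * stride α) (start α)))))
  (m*n/n≡m (b * stride α + start α) 3)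
  where
  arith : ∀ b h → (1 + 3 * b) * h + 1 ≡ 3 * (b * h) + (h + 1)
  arith = ℕ-Solver.solve-∀
  factor : ∀ x o → 3 * x + 3 * o ≡ (x + o) * 3
  factor = ℕ-Solver.solve-∀

2^-stride : ∀ α k → 2 ^ (2 * suc α + k) ≡ 2 ^ suc k * stride α
2^-stride α k = ≡.trans (cong (2 ^_) (arith α k)) (≡.trans (ℕₚ.^-distribˡ-+-* 2 (suc k) (2 * suc α ∸ 1)) (cong (2 ^ suc k *_) (≡.sym (stride-pow α))))
  where
  arith : ∀ α k → suc (α + suc (α + 0)) + k ≡ suc (k + (α + suc (α + 0)))
  arith = ℕ-Solver.solve-∀

∣-p8 : ∀ m j i {v} → v ≡ + p8 i → (∃ λ k → v ≡ + (8 ^ m) ℤ.* (+ (2 ^ j) ℤ.* k)) → 2 ^ (3 * m + j) ∣ p8 i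
∣-p8 m j i v≡p8 (k , v≡) = divides ℤ.∣ k ∣ (begin≡
  p8 i                                               ≡⟨ cong ℤ.∣_∣ (≡.trans (≡.sym v≡p8) v≡) ⟩
  ℤ.∣ + (8 ^ m) ℤ.* (+ (2 ^ j) ℤ.* k) ∣              ≡⟨ ≡.trans (ℤₚ.abs-* (+ (8 ^ m)) _) (cong (8 ^ m *_) (ℤₚ.abs-* (+ (2 ^ j)) k)) ⟩
  8 ^ m * (2 ^ j * ℤ.∣ k ∣)                          ≡⟨ ≡.trans (≡.sym (ℕₚ.*-assoc (8 ^ m) (2 ^ j) ℤ.∣ k ∣)) (ℕₚ.*-comm (8 ^ m * 2 ^ j) ℤ.∣ k ∣) ⟩
  ℤ.∣ k ∣ * (8 ^ m * 2 ^ j)                          ≡⟨ cong (λ t → ℤ.∣ k ∣ * (t * 2 ^ j)) (ℕₚ.^-*-assoc 2 3 m) ⟩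
  ℤ.∣ k ∣ * (2 ^ (3 * m) * 2 ^ j)                    ≡⟨ cong (ℤ.∣ k ∣ *_) (≡.sym (ℕₚ.^-distribˡ-+-* 2 (3 * m) j)) ⟩
  ℤ.∣ k ∣ * 2 ^ (3 * m + j)                          ∎≡)
  where open ≡.≡-Reasoning renaming (begin_ to begin≡_; _∎ to _∎≡)

-- Claims about `S₂ α` are included: it is the odd part of `S₁ α`, hence they appear with b odd and
-- with one more factor 8.
∣-p8-progression : ∀ α m j a b n N {e A B v} → v ≡ S₁ α N → N ≡ a * n + b → e ≡ 3 * m + j →
  A ≡ a * stride α → B ≡ (1 + 3 * b) * stride α →
  (∃ λ k → v ≡ + (8 ^ m) ℤ.* (+ (2 ^ j) ℤ.* k)) → 2 ^ e ∣ p8 (A * n + (B + 1) / 3)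
∣-p8-progression α m j a b n N v≡ ≡.refl ≡.refl ≡.refl ≡.refl = ∣-p8 m j (a * stride α * n + ((1 + 3 * b) * stride α + 1) / 3)
  (≡.trans v≡ (≡.trans (S₁-index α N) (≡.trans (K-p8 _) (cong (λ i → + p8 i)
    (≡.trans (arith (stride α) a n b (start α)) (cong (λ t → a * stride α * n + t) (≡.sym (offset α b))))))))
  where
  arith : ∀ h a n b o → h * (a * n + b) + o ≡ a * h * n + (b * h + o)
  arith = ℕ-Solver.solve-∀

𝟘-at : ∀ n → 𝟘 n ≡ + 0
𝟘-at zero    = ι-zero _
𝟘-at (suc n) = ι-suc _ n

≋-mod-1 : ∀ f → f ≋ 𝟘 mod ι (+ 1)
≋-mod-1 f = quotient f (solve 1 (λ f → f := con (+ 0) :+ con (+ 1) :* f) refl f)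

theorem1p1 : (n α : ℕ) → 1 ≤ α →
    (2 ^ 3 ∣ p8 (2 * n + 1))
    × (2 ^ (3 * α + 3) ∣ p8 (2 ^ (2 * α) * n + (2 ^ (2 * α + 1) + 1) / 3))
    × (2 ^ (3 * α + 2) ∣ p8 (2 ^ (2 * α + 1) * n + (7 * 2 ^ (2 * α ∸ 1) + 1) / 3))
    × (2 ^ (3 * α + 8) ∣ p8 (2 ^ (2 * α + 1) * n + (5 * 2 ^ (2 * α) + 1) / 3))
    × (2 ^ (3 * α + 1) ∣ p8 (2 ^ (2 * α + 2) * n + (13 * 2 ^ (2 * α ∸ 1) + 1) / 3))
    × (2 ^ (3 * α + 3) ∣ p8 (2 ^ (2 * α + 2) * n + (19 * 2 ^ (2 * α ∸ 1) + 1) / 3))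
    × (2 ^ (3 * α + 10) ∣ p8 (2 ^ (2 * α + 2) * n + (11 * 2 ^ (2 * α) + 1) / 3))
    × (2 ^ (3 * α + 9) ∣ p8 (2 ^ (2 * α + 3) * n + (17 * 2 ^ (2 * α) + 1) / 3))
    × (¬ GenPentagonal n →
    2 ^ (3 * α + 1) ∣ p8 (2 ^ (2 * α + 2) * n + (2 ^ (2 * α ∸ 1) + 1) / 3))
theorem1p1 n (suc α) _ =
    -- In this claim and the next the power of 8 in the shape is the whole modulus, so the residue
    -- is taken modulo 1.
    ∣-p8 1 0 (2 * n + 1) (≡.trans (S₁-index 0 n) (K-p8 _))
      (shape-coeff id-dissector (+ 1) (+ 128) ≡.refl (≋-mod-1 _) (S₁-shape 0) n (𝟘-at n))
  , ∣-p8-progression α (suc (suc α)) 0 2 1 n _ (U′-at _ n) (pos₂ n) (exponent α 0) 2^2α (2^-stride α 1)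
      (shape-coeff id-dissector (+ 1) (+ 128) ≡.refl (≋-mod-1 _) (S₂-shape α) n (𝟘-at n))
  , ∣-p8-progression α (suc α) 2 4 2 n _ (≡.trans (U′-at _ n) (U-at _ _)) (pos₃ n) ≡.refl (2^-stride α 1) (multiple 7)
      (shape-coeff (U′∘ (U∘ id-dissector)) (+ 4) (+ 32) ≡.refl Ky²-4n+2 (S₁-shape α) n (𝟘-at n))
  , ∣-p8-progression α (suc (suc α)) 5 4 3 n _ (≡.trans (U′-at _ n) (U′-at _ _)) (pos₄ n) (exponent α 5) (2^-stride α 1) (multiple₂ 5)
      (shape-coeff (U′∘ id-dissector) (+ 32) (+ 4) ≡.refl Ky³-2n+1-≋0 (S₂-shape α) n (𝟘-at n))
  , ∣-p8-progression α (suc α) 1 8 4 n _ (≡.trans (U′-at _ n) (≡.trans (U-at _ _) (U-at _ _))) (pos₅ n) ≡.refl (2^-stride α 2) (multiple 13)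
      (shape-coeff (U′∘ (U∘ (U∘ id-dissector))) (+ 2) (+ 64) ≡.refl Ky²-8n+4 (S₁-shape α) n (𝟘-at n))
  , ∣-p8-progression α (suc α) 3 8 6 n _ (≡.trans (U′-at _ n) (≡.trans (U′-at _ _) (U-at _ _))) (pos₆ n) ≡.refl (2^-stride α 2) (multiple 19)
      (shape-coeff (U′∘ (U′∘ (U∘ id-dissector))) (+ 8) (+ 16) ≡.refl Ky²-8n+6 (S₁-shape α) n (𝟘-at n))
  , ∣-p8-progression α (suc (suc α)) 7 8 7 n _ (≡.trans (U′-at _ n) (≡.trans (U′-at _ _) (U′-at _ _))) (pos₇ n) (exponent α 7) (2^-stride α 2) (multiple₂ 11)
      (shape-coeff (U′∘ (U′∘ id-dissector)) (+ 128) (+ 1) ≡.refl Ky³-4n+3 (S₂-shape α) n (𝟘-at n))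
  , ∣-p8-progression α (suc (suc α)) 6 16 11 n _ (≡.trans (U′-at _ n) (≡.trans (U-at _ _) (≡.trans (U′-at _ _) (U′-at _ _)))) (pos₈ n) (exponent α 6) (2^-stride α 3) (multiple₂ 17)
      (shape-coeff (U′∘ (U∘ (U′∘ id-dissector))) (+ 64) (+ 2) ≡.refl Ky³-8n+5 (S₂-shape α) n (𝟘-at n))
  -- Here b = 0, and the residue is `E` rather than 0, so the nonpentagonal hypothesis makes the
  -- coefficient vanish.
  , λ ¬gen → ∣-p8-progression α (suc α) 1 8 0 n _ (≡.trans (U-at _ n) (≡.trans (U-at _ _) (U-at _ _))) (pos₉ n) ≡.refl (2^-stride α 2)
      (≡.trans (≡.sym (stride-pow α)) (≡.sym (ℕₚ.*-identityˡ (stride α))))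
      (shape-coeff (U∘ (U∘ (U∘ id-dissector))) (+ 2) (+ 64) ≡.refl Ky²-8n (S₁-shape α) n (E-nonpentagonal n ¬gen))
  where
  2^2α : 2 ^ (2 * suc α) ≡ 2 * stride α
  2^2α = ≡.trans (cong (2 ^_) (≡.sym (ℕₚ.+-identityʳ (2 * suc α)))) (2^-stride α 0)
  multiple : ∀ k → k * 2 ^ (2 * suc α ∸ 1) ≡ k * stride α
  multiple k = cong (k *_) (≡.sym (stride-pow α))
  multiple₂ : ∀ k → k * 2 ^ (2 * suc α) ≡ k * 2 * stride α
  multiple₂ k = ≡.trans (cong (k *_) 2^2α) (≡.sym (ℕₚ.*-assoc k 2 (stride α)))
  exponent : ∀ α j → 3 * suc α + (3 + j) ≡ 3 * suc (suc α) + j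
  exponent = ℕ-Solver.solve-∀
  pos₂ : ∀ n → suc (2 * n) ≡ 2 * n + 1
  pos₂ = ℕ-Solver.solve-∀
  pos₃ : ∀ n → 2 * suc (2 * n) ≡ 4 * n + 2
  pos₃ = ℕ-Solver.solve-∀
  pos₄ : ∀ n → suc (2 * suc (2 * n)) ≡ 4 * n + 3
  pos₄ = ℕ-Solver.solve-∀
  pos₅ : ∀ n → 2 * (2 * suc (2 * n)) ≡ 8 * n + 4
  pos₅ = ℕ-Solver.solve-∀
  pos₆ : ∀ n → 2 * suc (2 * suc (2 * n)) ≡ 8 * n + 6
  pos₆ = ℕ-Solver.solve-∀
  pos₇ : ∀ n → suc (2 * suc (2 * suc (2 * n))) ≡ 8 * n + 7
  pos₇ = ℕ-Solver.solve-∀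
  pos₈ : ∀ n → suc (2 * suc (2 * (2 * suc (2 * n)))) ≡ 16 * n + 11
  pos₈ = ℕ-Solver.solve-∀
  pos₉ : ∀ n → 2 * (2 * (2 * n)) ≡ 8 * n + 0
  pos₉ = ℕ-Solver.solve-∀
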